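{- Let $C(z)=\sum_{n\ge 0}c_n z^n$, where $c_n$ is the number of nonnesting permutations of the multiset $\{1,1,2,2,\dots,n,n\}$ that avoid the pattern $123$ (with $c_0=1$). Then $C$ is algebraic of degree exactly $4$ over $\mathbb{Q}(z)$: it is the unique formal power series with $C(0)=1$ and $[z]C=1$ (coefficient of $z^1$ equal to $1$) satisfying \begin{multline*} (1-4z+4z^2)+(-4+16z-16z^2)\,C+(5-22z+36z^2+8z^3)\,C^2\\ +(-2+12z-40z^2-16z^3)\,C^3+(-2z+17z^2+12z^3+4z^4)\,C^4=0 . \end{multline*}
   Context: For $n\ge 0$, a nonnesting permutation of $\{1,1,2,2,\dots,n,n\}$ is a word $w=w_1w_2\cdots w_{2n}$ using each of the labels $1,\dots,n$ exactly twice such that there are no indices $i<j<k<\ell$ and labels $a\ne b$ with $w_i=w_\ell=a$ and $w_j=w_k=b$. The word $w$ avoids $123$ if there are no indices $i<j<k$ with $w_i<w_j<w_k$. The empty word is the unique such word for $n=0$. -}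

module Defs where

open import Data.Empty using (⊥-elim)
open import Data.Fin.Base as Fin using (Fin; toℕ; fromℕ<; punchIn)
open import Data.Fin.Properties as Fin using (any?; all?; punchInᵢ≢i)
open import Data.Integer.Base as ℤ using (ℤ; +_; -_)
open import Data.List.Base as List using (List; []; _∷_)
open import Data.Nat.Base as ℕ using (ℕ; zero; suc)
import Data.Nat.Properties as ℕ
open import Data.Nat.Induction using (<-rec)
open import Data.Product using (Σ; ∃-syntax; _×_)
open import Data.Rational.Base as ℚ using (ℚ; 0ℚ; 1ℚ)
import Data.Rational.Properties as ℚ
open import Data.Vec.Base as Vec using (Vec; []; _∷_; lookup)
open import Relation.Binary.Definitions using (tri<; tri≈; tri>)
open import Relation.Binary.PropositionalEquality
  using (_≡_; _≢_; refl; sym; trans; cong; cong₂; subst; module ≡-Reasoning)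
open import Relation.Nullary using (¬_; Dec; yes; no; ¬?; _×-dec_)
open import Algebra.Properties.CommutativeMonoid.Sum ℚ.+-0-commutativeMonoid
  using (sum; sum⁺-syntax; sum-remove; sum-cong-≗; sum-replicate-zero)

-- The label a ∈ {1,…,n} is represented by the element a − 1 of Fin n.
Word : ℕ → Set
Word n = Vec (Fin n) (2 ℕ.* n)

EachLabelTwice : ∀ {n} → Word n → Set
EachLabelTwice {n} w = ∀ (a : Fin n) → Vec.count (Fin._≟ a) w ≡ 2

HasNesting : ∀ {n} → Word n → Set
HasNesting w =
  ∃[ i ] ∃[ j ] ∃[ k ] ∃[ ℓ ] i Fin.< j × j Fin.< k × k Fin.< ℓ ×
  (∃[ a ] ∃[ b ] a ≢ b ×
    lookup w i ≡ a × lookup w ℓ ≡ a × lookup w j ≡ b × lookup w k ≡ b)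

Contains123 : ∀ {n} → Word n → Set
Contains123 w =
  ∃[ i ] ∃[ j ] ∃[ k ] i Fin.< j × j Fin.< k ×
  lookup w i Fin.< lookup w j × lookup w j Fin.< lookup w k

record IsNonnesting {n} (w : Word n) : Set where
  constructor nonnesting
  field
    eachLabelTwice : EachLabelTwice w
    noNesting      : ¬ HasNesting w

eachLabelTwice? : ∀ {n} (w : Word n) → Dec (EachLabelTwice w)
eachLabelTwice? w = all? λ a → Vec.count (Fin._≟ a) w ℕ.≟ 2

hasNesting? : ∀ {n} (w : Word n) → Dec (HasNesting w)
hasNesting? w =
  any? λ i → any? λ j → any? λ k → any? λ ℓ →
  (i Fin.<? j) ×-dec (j Fin.<? k) ×-dec (k Fin.<? ℓ) ×-dec
  (any? λ a → any? λ b → ¬? (a Fin.≟ b) ×-dec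
    (lookup w i Fin.≟ a) ×-dec (lookup w ℓ Fin.≟ a) ×-dec
    (lookup w j Fin.≟ b) ×-dec (lookup w k Fin.≟ b))

contains123? : ∀ {n} (w : Word n) → Dec (Contains123 w)
contains123? w =
  any? λ i → any? λ j → any? λ k → (i Fin.<? j) ×-dec (j Fin.<? k) ×-dec
  (lookup w i Fin.<? lookup w j) ×-dec (lookup w j Fin.<? lookup w k)

isNonnesting? : ∀ {n} (w : Word n) → Dec (IsNonnesting w)
isNonnesting? w with eachLabelTwice? w | hasNesting? w
... | yes p | no q  = yes (nonnesting p q)
... | yes _ | yes q = no λ nn → IsNonnesting.noNesting nn q
... | no p  | _     = no λ nn → p (IsNonnesting.eachLabelTwice nn)

-- Every vector over Fin n of the given length, each listed exactly once.
allVecs : ∀ n k → List (Vec (Fin n) k)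
allVecs n zero    = [] ∷ []
allVecs n (suc k) = List.cartesianProductWith _∷_ (List.allFin n) (allVecs n k)

c : ℕ → ℕ
c n = List.length
  (List.filter (λ w → isNonnesting? w ×-dec ¬? (contains123? w)) (allVecs n (2 ℕ.* n)))

PowerSeries : Set
PowerSeries = ℕ → ℚ

infix  4 _≈_
infixl 6 _⊕_
infixl 7 _⊛_
infixr 8 _^_

_≈_ : PowerSeries → PowerSeries → Set
f ≈ g = ∀ n → f n ≡ g n

-- Lists of coefficients in increasing degree; trailing zeros are allowed.
Polynomial : Set
Polynomial = List ℚ

⟦_⟧ : Polynomial → PowerSeries
⟦ []    ⟧ n       = 0ℚ
⟦ a ∷ p ⟧ zero    = a
⟦ a ∷ p ⟧ (suc n) = ⟦ p ⟧ n

0# 1# : PowerSeries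
0# = ⟦ [] ⟧
1# = ⟦ 1ℚ ∷ [] ⟧

_⊕_ _⊛_ : PowerSeries → PowerSeries → PowerSeries
(f ⊕ g) n = f n ℚ.+ g n
(f ⊛ g) n = ∑[ i ≤ n ] (f (toℕ i) ℚ.* g (n ℕ.∸ toℕ i))

_^_ : PowerSeries → ℕ → PowerSeries
f ^ zero  = 1#
f ^ suc k = f ⊛ f ^ k

private
  ℚ-integral : ∀ {p q} → p ≢ 0ℚ → p ℚ.* q ≡ 0ℚ → q ≡ 0ℚ
  ℚ-integral {p} {q} p≢0 pq≡0 = begin
    q                       ≡⟨ ℚ.*-identityˡ q ⟨
    1ℚ ℚ.* q                ≡⟨ cong (ℚ._* q) (ℚ.*-inverseˡ p) ⟨
    (ℚ.1/ p ℚ.* p) ℚ.* q    ≡⟨ ℚ.*-assoc (ℚ.1/ p) p q ⟩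
    ℚ.1/ p ℚ.* (p ℚ.* q)    ≡⟨ cong (ℚ.1/ p ℚ.*_) pq≡0 ⟩
    ℚ.1/ p ℚ.* 0ℚ           ≡⟨ ℚ.*-zeroʳ (ℚ.1/ p) ⟩
    0ℚ                      ∎
    where
    open ≡-Reasoning
    instance p-nonZero : ℚ.NonZero p
             p-nonZero = ℚ.≢-nonZero p≢0

  sum-single : ∀ {n} (t : Fin (suc n) → ℚ) i → (∀ j → j ≢ i → t j ≡ 0ℚ) → sum t ≡ t i
  sum-single {n} t i t≡0 = begin
    sum t                                   ≡⟨ sum-remove {i = i} t ⟩
    t i ℚ.+ sum (λ j → t (punchIn i j))     ≡⟨ cong (t i ℚ.+_) (sum-cong-≗ λ j → t≡0 (punchIn i j) (punchInᵢ≢i i j)) ⟩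
    t i ℚ.+ sum {n} (λ _ → 0ℚ)              ≡⟨ cong (t i ℚ.+_) (sum-replicate-zero n) ⟩
    t i ℚ.+ 0ℚ                              ≡⟨ ℚ.+-identityʳ (t i) ⟩
    t i                                     ∎
    where open ≡-Reasoning

  coefficient : ∀ f g m n → (∀ {i} → i ℕ.< m → f i ≡ 0ℚ) → (∀ {i} → i ℕ.< n → g i ≡ 0ℚ) →
                (f ⊛ g) (m ℕ.+ n) ≡ f m ℚ.* g n
  coefficient f g m n f<m g<n =
    trans (sum-single t i₀ others) (cong₂ (λ k l → f k ℚ.* g l) i₀≡m
      (trans (cong (m ℕ.+ n ℕ.∸_) i₀≡m) (ℕ.m+n∸m≡n m n)))
    where
    t : Fin (suc (m ℕ.+ n)) → ℚ
    t i = f (toℕ i) ℚ.* g (m ℕ.+ n ℕ.∸ toℕ i)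
    m<1+m+n = ℕ.s≤s (ℕ.m≤m+n m n)
    i₀ = fromℕ< m<1+m+n
    i₀≡m : toℕ i₀ ≡ m
    i₀≡m = Fin.toℕ-fromℕ< m<1+m+n
    others : ∀ j → j ≢ i₀ → t j ≡ 0ℚ
    others j j≢i₀ with ℕ.<-cmp (toℕ j) m
    ... | tri< j<m _ _ = trans
            (cong (ℚ._* g (m ℕ.+ n ℕ.∸ toℕ j)) (f<m j<m))
            (ℚ.*-zeroˡ (g (m ℕ.+ n ℕ.∸ toℕ j)))
    ... | tri≈ _ j≡m _ = ⊥-elim (j≢i₀ (Fin.toℕ-injective (trans j≡m (sym i₀≡m))))
    ... | tri> _ _ m<j = trans (cong (f (toℕ j) ℚ.*_) (g<n
            (subst (m ℕ.+ n ℕ.∸ toℕ j ℕ.<_) (ℕ.m+n∸m≡n m n)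
              (ℕ.∸-monoʳ-< m<j (ℕ.s≤s⁻¹ (Fin.toℕ<n j)))))) (ℚ.*-zeroʳ (f (toℕ j)))

⊛-nonzero : ∀ {f g} → ¬ f ≈ 0# → ¬ g ≈ 0# → ¬ f ⊛ g ≈ 0#
⊛-nonzero {f} {g} f≉0 g≉0 fg≈0 = f≉0 (<-rec (λ m → f m ≡ 0ℚ) step)
  where
  step : ∀ m → (∀ {i} → i ℕ.< m → f i ≡ 0ℚ) → f m ≡ 0ℚ
  step m f<m with f m ℚ.≟ 0ℚ
  ... | yes fm≡0 = fm≡0
  ... | no  fm≢0 = ⊥-elim (g≉0 (<-rec (λ n → g n ≡ 0ℚ) λ n g<n →
        ℚ-integral fm≢0 (trans (sym (coefficient f g m n f<m g<n)) (fg≈0 (m ℕ.+ n)))))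

1#≉0# : ¬ 1# ≈ 0#
1#≉0# 1≈0 = ℚ.1≢0 (1≈0 0)

record RationalFunction : Set where
  constructor _/_[_]
  field
    num   : Polynomial
    den   : Polynomial
    den≉0 : ¬ ⟦ den ⟧ ≈ 0#

-- ℚ((z)), as the field of fractions of the integral domain ℚ[[z]].
record Laurent : Set where
  constructor _/_[_]
  field
    num   : PowerSeries
    den   : PowerSeries
    den≉0 : ¬ den ≈ 0#

infix 4 _≃_

_≃_ : Laurent → Laurent → Set
(a / b [ _ ]) ≃ (a′ / b′ [ _ ]) = a ⊛ b′ ≈ a′ ⊛ b

fromSeries : PowerSeries → Laurent
fromSeries f = f / 1# [ 1#≉0# ]

fromRational : RationalFunction → Laurent
fromRational (p / q [ q≉0 ]) = ⟦ p ⟧ / ⟦ q ⟧ [ q≉0 ]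

0ᴸ : Laurent
0ᴸ = fromSeries 0#

infixl 6 _+ᴸ_
infixl 7 _*ᴸ_

_+ᴸ_ _*ᴸ_ : Laurent → Laurent → Laurent
(a / b [ b≉0 ]) +ᴸ (a′ / b′ [ b′≉0 ]) = (a ⊛ b′ ⊕ a′ ⊛ b) / (b ⊛ b′) [ ⊛-nonzero b≉0 b′≉0 ]
(a / b [ b≉0 ]) *ᴸ (a′ / b′ [ b′≉0 ]) = (a ⊛ a′) / (b ⊛ b′) [ ⊛-nonzero b≉0 b′≉0 ]

-- Over ℚ(z), with coefficients in increasing degree.
record PolynomialOfDegree (d : ℕ) : Set where
  field
    coefficients : Vec RationalFunction (suc d)
    leading≉0    : ¬ fromRational (Vec.last coefficients) ≃ 0ᴸ

evaluate : ∀ {m} → Vec RationalFunction m → Laurent → Laurent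
evaluate []       x = 0ᴸ
evaluate (r ∷ rs) x = fromRational r +ᴸ x *ᴸ evaluate rs x

Annihilates : ∀ {d} → PolynomialOfDegree d → PowerSeries → Set
Annihilates P f = evaluate (PolynomialOfDegree.coefficients P) (fromSeries f) ≃ 0ᴸ

-- d is the degree of the minimal polynomial of f over ℚ(z).
AlgebraicOfDegree : PowerSeries → ℕ → Set
AlgebraicOfDegree f d =
  (Σ (PolynomialOfDegree d) λ P → Annihilates P f) ×
  (∀ e → e ℕ.< d → (P : PolynomialOfDegree e) → ¬ Annihilates P f)

C : PowerSeries
C n = + c n ℚ./ 1

integral : List ℤ → PowerSeries
integral as = ⟦ List.map (ℚ._/ 1) as ⟧

quartic : PowerSeries → PowerSeries
quartic F =
    integral (+ 1     ∷ - (+ 4)  ∷ + 4      ∷ [])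
  ⊕ integral (- (+ 4) ∷ + 16     ∷ - (+ 16) ∷ [])                  ⊛ F
  ⊕ integral (+ 5     ∷ - (+ 22) ∷ + 36     ∷ + 8      ∷ [])       ⊛ F ^ 2
  ⊕ integral (- (+ 2) ∷ + 12     ∷ - (+ 40) ∷ - (+ 16) ∷ [])       ⊛ F ^ 3
  ⊕ integral (+ 0     ∷ - (+ 2)  ∷ + 17     ∷ + 12     ∷ + 4 ∷ []) ⊛ F ^ 4

{-# OPTIONS --safe #-}

-- Read a word from left to right and keep a queue of the labels seen once. A word avoiding 123 is a union of
-- two weakly decreasing sequences, the running minima and the rest, and this leaves few possible states: what
-- matters is the number m of labels below the current minimum, all of them unused, the number p of unused
-- ("pending") labels above it, and the length of the queue, which counts only while p = 0. A pending label can
-- be used only in decreasing order and while at most one label waits before it.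
-- As series in z, with z marking m, the completions of the states satisfy linear recurrences in p and in the
-- queue length that are solved by geometric progressions, with ratios 1 + 2μ and K for the power series
-- K = 1 + z K² and μ = 2z(1 + μ + μ²). Hence C is an explicit rational function of z, K and μ, that is, of z,
-- A = √(1 − 4z) and B = √((1 − 6z)(1 + 2z)), which are given by A = 1 − 2zK and B = 1 − 2z − 4zμ. The quartic is
-- checked in ℤ[z][A, B]. Evaluating at integers, where 1 − 4z, (1 − 6z)(1 + 2z) or their product is negative,
-- shows that 1, A, B, AB are linearly independent over ℚ(z), and the coordinates of 1, C, C², C³ in this basis
-- have a nonzero determinant; so the degree is 4. Two solutions F, F′ agreeing with 1 + z up to z² make the
-- divided difference of the quartic nonzero, and so F = F′.
module Submission where

open import Defs
open import Algebra.Bundles using (CommutativeRing; RawRing)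
import Algebra.Properties.CommutativeSemigroup
open import Algebra.Solver.Ring.AlmostCommutativeRing
  using (_-Raw-AlmostCommutative⟶_; fromCommutativeRing; AlmostCommutativeRing)
open import Algebra.Structures using (IsCommutativeRing)
open import Data.Empty using (⊥; ⊥-elim)
open import Data.Fin.Base as Fin using (Fin; toℕ; fromℕ<)
open import Data.Fin.Patterns using (0F; 1F; 2F; 3F)
import Data.Fin.Properties as Fin
open import Data.Integer.Base as ℤ using (ℤ; +_; -_; -[1+_]; +0; +[1+_])
import Data.Integer.Properties as ℤ
import Data.Integer.Tactic.RingSolver as ℤ-Solver
open import Data.List.Base as List using (List; []; _∷_; _++_; length; map; filter)
import Data.List.Properties as List
open import Data.List.Membership.Propositional using (_∈_)
import Data.List.Membership.Propositional.Properties as ∈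
open import Data.List.Membership.Propositional.Properties.WithK using (unique∧set⇒bag)
open import Data.List.Relation.Binary.BagAndSetEquality using (∼bag⇒↭)
open import Data.List.Relation.Binary.Disjoint.Propositional using (Disjoint)
open import Data.List.Relation.Binary.Permutation.Propositional.Properties using (↭-length)
open import Data.List.Relation.Binary.Sublist.Propositional
  using (_⊆_; []; _∷_; _∷ʳ_; ⊆-refl; ⊆-trans; minimum)
import Data.List.Relation.Binary.Sublist.Propositional.Properties as Sublist
open import Data.List.Relation.Unary.All as All using (All; []; _∷_)
import Data.List.Relation.Unary.All.Properties as All
open import Data.List.Relation.Unary.AllPairs using (AllPairs; []; _∷_)
import Data.List.Relation.Unary.AllPairs.Properties as AllPairs
open import Data.List.Relation.Unary.Any using (here; there)
open import Data.List.Relation.Unary.Unique.Propositional using (Unique)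
import Data.List.Relation.Unary.Unique.Propositional.Properties as Unique
open import Data.Maybe.Base using (Maybe; just; nothing)
open import Data.Nat.Base as ℕ using (ℕ; zero; suc; _+_; _*_; _<_; _≤_; _>_; z≤n; s≤s)
import Data.Nat.Properties as ℕ
import Data.Nat.Tactic.RingSolver as ℕ-Solver
open import Data.Product using (_,_; _×_; proj₁; proj₂; ∃; ∃₂)
open import Data.Rational.Base as ℚ using (ℚ; 0ℚ; 1ℚ)
import Data.Rational.Properties as ℚ
import Data.Rational.Solver as ℚ-Solver
import Data.Rational.Unnormalised.Base as ℚᵘ
import Data.Rational.Unnormalised.Properties as ℚᵘ
open import Data.Sum.Base using (_⊎_; inj₁; inj₂)
open import Data.Vec.Base as Vec using (Vec; []; _∷_; lookup)
import Data.Vec.Properties as Vec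
open import Data.Vec.Relation.Unary.All as VecAll using ([]; _∷_)
import Data.Vec.Relation.Unary.All.Properties as VecAll
open import Function.Bundles using (mk⇔)
open import Function.Strict using (force; force-≡)
open import Level using (0ℓ)
import Relation.Binary.Reasoning.Setoid
open import Relation.Binary.PropositionalEquality
  using (_≡_; _≢_; refl; sym; trans; cong; cong₂; subst; module ≡-Reasoning)
open import Relation.Nullary using (¬_; Dec; yes; no; ¬?; _×-dec_)
open import Relation.Nullary.Decidable using (decidable-stable)
open import Algebra.Properties.CommutativeMonoid.Sum ℚ.+-0-commutativeMonoid using (sum-cong-≗)
open import Algebra.Properties.Ring (CommutativeRing.ring ℚ.+-*-commutativeRing)
  using () renaming (-‿involutive to ℚ-involutive)
open ℚ-Solver.+-*-Solver using ()
  renaming (solve to ℚ-solve; _:=_ to _⟨=⟩_; _:+_ to _⟨+⟩_; _:*_ to _⟨*⟩_; _:-_ to _⟨-⟩_; con to ℚ-con)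

-- Nonnesting means that second occurrences come in the order of the first ones, so the labels seen
-- once form a queue served at its front. Suppose that m is the minimum and p is pending. If p is
-- used while a larger label l waits, then m p l becomes a 123; this is why p tolerates no company
-- except m itself. If m still waits, no new minimum y can come: a p after the second m gives the
-- 123 y m p, and both p before it nest inside the two m. The recurrences refer to ever more pending
-- labels and ever longer queues, so they are not solved by elimination: the geometric closed forms
-- are guessed, and checked by induction on the number of letters left. The series K, μ and V are
-- used only through the equations that define them. Every identity between them is a polynomial
-- identity modulo these equations, stated with explicit multipliers and then left to a ring solver
-- over ℤ[z]. Equality of power series is not decidable, and so the case distinction in the
-- independence proof takes place under a double negation.

-- A record, so that both series can be inferred from an equality between them.
infix 4 _≋_
record _≋_ (f g : PowerSeries) : Set where
  constructor pointwise
  field coefficients≡ : f ≈ g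
open _≋_

-- The ring of formal power series

tail : PowerSeries → PowerSeries
tail f n = f (suc n)

⊖_ : PowerSeries → PowerSeries
(⊖ f) n = ℚ.- f n

infix 8 ⊖_

module ℚ-+ = Algebra.Properties.CommutativeSemigroup (CommutativeRing.+-commutativeSemigroup ℚ.+-*-commutativeRing)

⊛-cong : ∀ {f f′ g g′} → f ≋ f′ → g ≋ g′ → f ⊛ g ≋ f′ ⊛ g′
⊛-cong {f} {f′} {g} {g′} (pointwise p) (pointwise q) = pointwise λ n →
  sum-cong-≗ {suc n} {λ i → f (toℕ i) ℚ.* g (n ℕ.∸ toℕ i)} {λ i → f′ (toℕ i) ℚ.* g′ (n ℕ.∸ toℕ i)} λ i → cong₂ ℚ._*_ (p (toℕ i)) (q (n ℕ.∸ toℕ i))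

⊛-distribʳ : ∀ f g h → (g ⊕ h) ⊛ f ≋ g ⊛ f ⊕ h ⊛ f
⊛-distribʳ f g h = pointwise (go g h)
  where
  open ≡-Reasoning
  go : ∀ g h n → ((g ⊕ h) ⊛ f) n ≡ (g ⊛ f) n ℚ.+ (h ⊛ f) n
  go g h zero    = begin
    (g 0 ℚ.+ h 0) ℚ.* f 0 ℚ.+ 0ℚ                       ≡⟨ ℚ.+-identityʳ _ ⟩
    (g 0 ℚ.+ h 0) ℚ.* f 0                              ≡⟨ ℚ.*-distribʳ-+ (f 0) (g 0) (h 0) ⟩
    g 0 ℚ.* f 0 ℚ.+ h 0 ℚ.* f 0                        ≡⟨ cong₂ ℚ._+_ (ℚ.+-identityʳ (g 0 ℚ.* f 0)) (ℚ.+-identityʳ (h 0 ℚ.* f 0)) ⟨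
    (g 0 ℚ.* f 0 ℚ.+ 0ℚ) ℚ.+ (h 0 ℚ.* f 0 ℚ.+ 0ℚ)      ∎
  go g h (suc n) = begin
    (g 0 ℚ.+ h 0) ℚ.* f (suc n) ℚ.+ ((tail g ⊕ tail h) ⊛ f) n
      ≡⟨ cong₂ ℚ._+_ (ℚ.*-distribʳ-+ (f (suc n)) (g 0) (h 0)) (go (tail g) (tail h) n) ⟩
    (g 0 ℚ.* f (suc n) ℚ.+ h 0 ℚ.* f (suc n)) ℚ.+ ((tail g ⊛ f) n ℚ.+ (tail h ⊛ f) n)
      ≡⟨ ℚ-+.interchange (g 0 ℚ.* f (suc n)) _ _ _ ⟩
    (g ⊛ f) (suc n) ℚ.+ (h ⊛ f) (suc n) ∎

-- The sum unfolds by itself at the coefficient `f 0`. Splitting off its other end makes the two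
-- factors symmetric, which gives commutativity by induction.
⊛-suc : ∀ f g n → (f ⊛ g) (suc n) ≡ (f ⊛ tail g) n ℚ.+ f (suc n) ℚ.* g 0
⊛-suc f g zero    = begin
  f 0 ℚ.* g 1 ℚ.+ (f 1 ℚ.* g 0 ℚ.+ 0ℚ)    ≡⟨ cong₂ ℚ._+_ (ℚ.+-identityʳ (f 0 ℚ.* g 1)) (sym (ℚ.+-identityʳ (f 1 ℚ.* g 0))) ⟨
  (f 0 ℚ.* g 1 ℚ.+ 0ℚ) ℚ.+ f 1 ℚ.* g 0    ∎
  where open ≡-Reasoning
⊛-suc f g (suc n) = begin
  f 0 ℚ.* g (2 ℕ.+ n) ℚ.+ (tail f ⊛ g) (suc n)                           ≡⟨ cong (f 0 ℚ.* g (2 ℕ.+ n) ℚ.+_) (⊛-suc (tail f) g n) ⟩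
  f 0 ℚ.* g (2 ℕ.+ n) ℚ.+ ((tail f ⊛ tail g) n ℚ.+ f (2 ℕ.+ n) ℚ.* g 0)  ≡⟨ ℚ.+-assoc (f 0 ℚ.* g (2 ℕ.+ n)) _ _ ⟨
  (f ⊛ tail g) (suc n) ℚ.+ f (2 ℕ.+ n) ℚ.* g 0                           ∎
  where open ≡-Reasoning

⊛-comm : ∀ f g → f ⊛ g ≋ g ⊛ f
⊛-comm f g = pointwise (go f)
  where
  open ≡-Reasoning
  go : ∀ f n → (f ⊛ g) n ≡ (g ⊛ f) n
  go f zero    = cong (ℚ._+ 0ℚ) (ℚ.*-comm (f 0) (g 0))
  go f (suc n) = begin
    f 0 ℚ.* g (suc n) ℚ.+ (tail f ⊛ g) n    ≡⟨ cong₂ ℚ._+_ (ℚ.*-comm (f 0) _) (go (tail f) n) ⟩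
    g (suc n) ℚ.* f 0 ℚ.+ (g ⊛ tail f) n    ≡⟨ ℚ.+-comm (g (suc n) ℚ.* f 0) _ ⟩
    (g ⊛ tail f) n ℚ.+ g (suc n) ℚ.* f 0    ≡⟨ ⊛-suc g f n ⟨
    (g ⊛ f) (suc n)                         ∎

⊛-scale : ∀ (a : ℚ) f g n → ((λ k → a ℚ.* f k) ⊛ g) n ≡ a ℚ.* (f ⊛ g) n
⊛-scale a f g zero    = begin
  a ℚ.* f 0 ℚ.* g 0 ℚ.+ 0ℚ      ≡⟨ cong₂ ℚ._+_ (ℚ.*-assoc a (f 0) (g 0)) (sym (ℚ.*-zeroʳ a)) ⟩
  a ℚ.* (f 0 ℚ.* g 0) ℚ.+ a ℚ.* 0ℚ  ≡⟨ ℚ.*-distribˡ-+ a (f 0 ℚ.* g 0) 0ℚ ⟨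
  a ℚ.* (f 0 ℚ.* g 0 ℚ.+ 0ℚ)    ∎
  where open ≡-Reasoning
⊛-scale a f g (suc n) = begin
  a ℚ.* f 0 ℚ.* g (suc n) ℚ.+ ((λ k → a ℚ.* f (suc k)) ⊛ g) n
    ≡⟨ cong₂ ℚ._+_ (ℚ.*-assoc a (f 0) (g (suc n))) (⊛-scale a (tail f) g n) ⟩
  a ℚ.* (f 0 ℚ.* g (suc n)) ℚ.+ a ℚ.* (tail f ⊛ g) n
    ≡⟨ ℚ.*-distribˡ-+ a (f 0 ℚ.* g (suc n)) _ ⟨
  a ℚ.* (f ⊛ g) (suc n) ∎
  where open ≡-Reasoning

⊛-assoc : ∀ f g h → (f ⊛ g) ⊛ h ≋ f ⊛ (g ⊛ h)
⊛-assoc f g h = pointwise (go f)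
  where
  open ≡-Reasoning
  go : ∀ f n → ((f ⊛ g) ⊛ h) n ≡ (f ⊛ (g ⊛ h)) n
  go f zero    = cong (ℚ._+ 0ℚ) (begin
    (f 0 ℚ.* g 0 ℚ.+ 0ℚ) ℚ.* h 0      ≡⟨ cong (ℚ._* h 0) (ℚ.+-identityʳ (f 0 ℚ.* g 0)) ⟩
    f 0 ℚ.* g 0 ℚ.* h 0               ≡⟨ ℚ.*-assoc (f 0) (g 0) (h 0) ⟩
    f 0 ℚ.* (g 0 ℚ.* h 0)             ≡⟨ cong (f 0 ℚ.*_) (ℚ.+-identityʳ (g 0 ℚ.* h 0)) ⟨
    f 0 ℚ.* (g 0 ℚ.* h 0 ℚ.+ 0ℚ)      ∎)
  go f (suc n) = begin
    (f 0 ℚ.* g 0 ℚ.+ 0ℚ) ℚ.* h (suc n) ℚ.+ (tail (f ⊛ g) ⊛ h) n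
      ≡⟨ cong₂ ℚ._+_ (trans (cong (ℚ._* h (suc n)) (ℚ.+-identityʳ (f 0 ℚ.* g 0))) (ℚ.*-assoc (f 0) (g 0) (h (suc n))))
           (trans (coefficients≡ (⊛-distribʳ h (λ k → f 0 ℚ.* tail g k) (tail f ⊛ g)) n)
             (cong₂ ℚ._+_ (⊛-scale (f 0) (tail g) h n) (go (tail f) n))) ⟩
    f 0 ℚ.* (g 0 ℚ.* h (suc n)) ℚ.+ (f 0 ℚ.* (tail g ⊛ h) n ℚ.+ (tail f ⊛ (g ⊛ h)) n)
      ≡⟨ ℚ.+-assoc (f 0 ℚ.* (g 0 ℚ.* h (suc n))) _ _ ⟨
    (f 0 ℚ.* (g 0 ℚ.* h (suc n)) ℚ.+ f 0 ℚ.* (tail g ⊛ h) n) ℚ.+ (tail f ⊛ (g ⊛ h)) n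
      ≡⟨ cong (ℚ._+ (tail f ⊛ (g ⊛ h)) n) (ℚ.*-distribˡ-+ (f 0) (g 0 ℚ.* h (suc n)) _) ⟨
    (f ⊛ (g ⊛ h)) (suc n) ∎

⊛-zeroˡ : ∀ f → 0# ⊛ f ≋ 0#
⊛-zeroˡ f = pointwise go
  where
  go : ∀ n → (0# ⊛ f) n ≡ 0ℚ
  go zero    = trans (ℚ.+-identityʳ _) (ℚ.*-zeroˡ (f 0))
  go (suc n) = trans (cong₂ ℚ._+_ (ℚ.*-zeroˡ (f (suc n))) (go n)) (ℚ.+-identityʳ 0ℚ)

⊛-identityˡ : ∀ f → 1# ⊛ f ≋ f
⊛-identityˡ f = pointwise go
  where
  go : ∀ n → (1# ⊛ f) n ≡ f n
  go zero    = trans (ℚ.+-identityʳ _) (ℚ.*-identityˡ (f 0))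
  go (suc n) = trans (cong₂ ℚ._+_ (ℚ.*-identityˡ (f (suc n))) (coefficients≡ (⊛-zeroˡ f) n)) (ℚ.+-identityʳ _)

powerSeriesRing₀ : CommutativeRing 0ℓ 0ℓ
powerSeriesRing₀ = record
  { Carrier = PowerSeries ; _≈_ = _≋_ ; _+_ = _⊕_ ; _*_ = _⊛_ ; -_ = ⊖_ ; 0# = 0# ; 1# = 1#
  ; isCommutativeRing = record
    { isRing = record
      { +-isAbelianGroup = record
        { isGroup = record
          { isMonoid = record
            { isSemigroup = record
              { isMagma = record
                { isEquivalence = record
                  { refl  = pointwise λ _ → refl
                  ; sym   = λ p → pointwise λ n → sym (coefficients≡ p n)
                  ; trans = λ p q → pointwise λ n → trans (coefficients≡ p n) (coefficients≡ q n)
                  }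
                ; ∙-cong = λ p q → pointwise λ n → cong₂ ℚ._+_ (coefficients≡ p n) (coefficients≡ q n)
                }
              ; assoc = λ f g h → pointwise λ n → ℚ.+-assoc (f n) (g n) (h n)
              }
            ; identity = (λ f → pointwise λ n → ℚ.+-identityˡ (f n)) , (λ f → pointwise λ n → ℚ.+-identityʳ (f n))
            }
          ; inverse = (λ f → pointwise λ n → ℚ.+-inverseˡ (f n)) , (λ f → pointwise λ n → ℚ.+-inverseʳ (f n))
          ; ⁻¹-cong = λ p → pointwise λ n → cong ℚ.-_ (coefficients≡ p n)
          }
        ; comm = λ f g → pointwise λ n → ℚ.+-comm (f n) (g n)
        }
      ; *-cong = ⊛-cong
      ; *-assoc = ⊛-assoc
      ; *-identity = ⊛-identityˡ , (λ f → ≋-trans (⊛-comm f 1#) (⊛-identityˡ f))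
      ; distrib = (λ f g h → ≋-trans (⊛-comm f (g ⊕ h)) (≋-trans (⊛-distribʳ f g h)
                      (pointwise λ n → cong₂ ℚ._+_ (coefficients≡ (⊛-comm g f) n) (coefficients≡ (⊛-comm h f) n))))
                , ⊛-distribʳ
      }
    ; *-comm = ⊛-comm
    }
  }
  where
  ≋-trans : ∀ {f g h} → f ≋ g → g ≋ h → f ≋ h
  ≋-trans p q = pointwise λ n → trans (coefficients≡ p n) (coefficients≡ q n)

infixl 6 _⊞_
infixl 7 _⊠_
infix  8 ⊟_

-- The operations and the embedding of ℤ[z] once more, but opaque: series are functions, and
-- comparing transparent sums and products of them would unfold every coefficient.
opaque
  _⊞_ _⊠_ : PowerSeries → PowerSeries → PowerSeries
  _⊞_ = _⊕_
  _⊠_ = _⊛_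

  ⊟_ : PowerSeries → PowerSeries
  ⊟_ = ⊖_

  ⌜_⌝ : List ℤ → PowerSeries
  ⌜_⌝ = integral

-- Images of constant polynomials, so that the embedding of ℤ[z] used by the solver preserves 0 and
-- 1 by reflexivity.
𝟘 𝟙 : PowerSeries
𝟘 = ⌜ [] ⌝
𝟙 = ⌜ + 1 ∷ [] ⌝

opaque
  unfolding _⊞_ ⌜_⌝

  isPowerSeriesRing : IsCommutativeRing _≋_ _⊞_ _⊠_ ⊟_ 𝟘 𝟙
  isPowerSeriesRing = CommutativeRing.isCommutativeRing powerSeriesRing₀

powerSeriesRing : CommutativeRing 0ℓ 0ℓ
powerSeriesRing = record { isCommutativeRing = isPowerSeriesRing }

open CommutativeRing powerSeriesRing
  using ()
  renaming ( refl to ≋-refl; sym to ≋-sym; trans to ≋-trans; setoid to ≋-setoid; reflexive to ≋-reflexive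
           ; +-cong to ⊞-cong; +-congˡ to ⊞-congˡ; +-congʳ to ⊞-congʳ; -‿cong to ⊟-cong
           ; *-cong to ⊠-cong; *-congˡ to ⊠-congˡ; *-congʳ to ⊠-congʳ
           ; zeroʳ to ⊠-zeroʳ; zeroˡ to ⊠-zeroˡ; *-identityˡ to ⊠-identityˡ; *-identityʳ to ⊠-identityʳ
           ; +-identityˡ to ⊞-identityˡ; +-identityʳ to ⊞-identityʳ; +-assoc to ⊞-assoc
           ; *-assoc to ⊠-assoc; *-comm to ⊠-comm
           ; -‿inverseˡ to ⊟-inverseˡ; -‿inverseʳ to ⊟-inverseʳ)

open import Algebra.Properties.Semiring.Exp (CommutativeRing.semiring powerSeriesRing)
  using () renaming (_^_ to _↑_)

-- Integer polynomials as coefficients of a ring solver for power series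

ι : ℤ → ℚ
ι i = i ℚ./ 1

ι-+ : ∀ i j → ι (i ℤ.+ j) ≡ ι i ℚ.+ ι j
ι-+ i j = ℚ.toℚᵘ-injective (begin
  ℚ.toℚᵘ (ι (i ℤ.+ j))               ≈⟨ ℚ.toℚᵘ-fromℚᵘ (ℚᵘ.mkℚᵘ (i ℤ.+ j) 0) ⟩
  ℚᵘ.mkℚᵘ (i ℤ.+ j) 0                ≈⟨ ℚᵘ.*≡* (cong (ℤ._* + 1) (cong₂ ℤ._+_ (ℤ.*-identityʳ i) (ℤ.*-identityʳ j))) ⟨
  ℚᵘ.mkℚᵘ i 0 ℚᵘ.+ ℚᵘ.mkℚᵘ j 0       ≈⟨ ℚᵘ.+-cong (ℚ.toℚᵘ-fromℚᵘ (ℚᵘ.mkℚᵘ i 0)) (ℚ.toℚᵘ-fromℚᵘ (ℚᵘ.mkℚᵘ j 0)) ⟨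
  ℚ.toℚᵘ (ι i) ℚᵘ.+ ℚ.toℚᵘ (ι j)     ≈⟨ ℚ.toℚᵘ-homo-+ (ι i) (ι j) ⟨
  ℚ.toℚᵘ (ι i ℚ.+ ι j)               ∎)
  where open ℚᵘ.≃-Reasoning

ι-* : ∀ i j → ι (i ℤ.* j) ≡ ι i ℚ.* ι j
ι-* i j = ℚ.toℚᵘ-injective (begin
  ℚ.toℚᵘ (ι (i ℤ.* j))               ≈⟨ ℚ.toℚᵘ-fromℚᵘ (ℚᵘ.mkℚᵘ (i ℤ.* j) 0) ⟩
  ℚᵘ.mkℚᵘ i 0 ℚᵘ.* ℚᵘ.mkℚᵘ j 0       ≈⟨ ℚᵘ.*-cong (ℚ.toℚᵘ-fromℚᵘ (ℚᵘ.mkℚᵘ i 0)) (ℚ.toℚᵘ-fromℚᵘ (ℚᵘ.mkℚᵘ j 0)) ⟨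
  ℚ.toℚᵘ (ι i) ℚᵘ.* ℚ.toℚᵘ (ι j)     ≈⟨ ℚ.toℚᵘ-homo-* (ι i) (ι j) ⟨
  ℚ.toℚᵘ (ι i ℚ.* ι j)               ∎)
  where open ℚᵘ.≃-Reasoning

ι-neg : ∀ i → ι (- i) ≡ ℚ.- ι i
ι-neg (+ zero)    = refl
ι-neg (+ suc n)   = refl
ι-neg ℤ.-[1+ n ]  = sym (ℚ-involutive (+ suc n ℚ./ 1))

ι-injective : ∀ {i j} → ι i ≡ ι j → i ≡ j
ι-injective {i} {j} eq with ℚ.fromℚᵘ-injective {ℚᵘ.mkℚᵘ i 0} {ℚᵘ.mkℚᵘ j 0} eq
... | ℚᵘ.*≡* e = trans (sym (ℤ.*-identityʳ i)) (trans e (ℤ.*-identityʳ j))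

-- Instantiated twice: over ℤ, where identities are checked by computation, and over ℚ, where
-- polynomials are evaluated and divided.
module PolynomialArithmetic {A : Set} (_+_ _*_ : A → A → A) (0A : A) where

  infixl 6 _+ᴾ_
  infixl 7 _*ᴾ_ _·ᴾ_

  _+ᴾ_ : List A → List A → List A
  []      +ᴾ q       = q
  (a ∷ p) +ᴾ []      = a ∷ p
  (a ∷ p) +ᴾ (b ∷ q) = a + b ∷ p +ᴾ q

  _·ᴾ_ : A → List A → List A
  a ·ᴾ p = List.map (a *_) p

  _*ᴾ_ : List A → List A → List A
  []      *ᴾ q = []
  (a ∷ p) *ᴾ q = a ·ᴾ q +ᴾ (0A ∷ p *ᴾ q)

  module Homomorphism (φ : A → ℚ) (φ0 : φ 0A ≡ 0ℚ)
    (φ+ : ∀ a b → φ (a + b) ≡ φ a ℚ.+ φ b) (φ* : ∀ a b → φ (a * b) ≡ φ a ℚ.* φ b) where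
    open ≡-Reasoning

    ⟪_⟫ : List A → PowerSeries
    ⟪ p ⟫ = ⟦ List.map φ p ⟧

    +ᴾ-homo : ∀ p q → ⟪ p +ᴾ q ⟫ ≋ ⟪ p ⟫ ⊕ ⟪ q ⟫
    +ᴾ-homo p q = pointwise (go p q)
      where
      go : ∀ p q n → ⟪ p +ᴾ q ⟫ n ≡ ⟪ p ⟫ n ℚ.+ ⟪ q ⟫ n
      go []      q       n       = sym (ℚ.+-identityˡ _)
      go (a ∷ p) []      n       = sym (ℚ.+-identityʳ _)
      go (a ∷ p) (b ∷ q) zero    = φ+ a b
      go (a ∷ p) (b ∷ q) (suc n) = go p q n

    ·ᴾ-homo : ∀ a p n → ⟪ a ·ᴾ p ⟫ n ≡ φ a ℚ.* ⟪ p ⟫ n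
    ·ᴾ-homo a []      n       = sym (ℚ.*-zeroʳ (φ a))
    ·ᴾ-homo a (b ∷ p) zero    = φ* a b
    ·ᴾ-homo a (b ∷ p) (suc n) = ·ᴾ-homo a p n

    *ᴾ-homo : ∀ p q → ⟪ p *ᴾ q ⟫ ≋ ⟪ p ⟫ ⊛ ⟪ q ⟫
    *ᴾ-homo p q = pointwise (go p)
      where
      go : ∀ p n → ⟪ p *ᴾ q ⟫ n ≡ (⟪ p ⟫ ⊛ ⟪ q ⟫) n
      go []      n       = sym (coefficients≡ (⊛-zeroˡ ⟪ q ⟫) n)
      go (a ∷ p) zero    = begin
        ⟪ a ·ᴾ q +ᴾ (0A ∷ p *ᴾ q) ⟫ 0      ≡⟨ coefficients≡ (+ᴾ-homo (a ·ᴾ q) (0A ∷ p *ᴾ q)) 0 ⟩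
        ⟪ a ·ᴾ q ⟫ 0 ℚ.+ φ 0A              ≡⟨ cong₂ ℚ._+_ (·ᴾ-homo a q 0) φ0 ⟩
        φ a ℚ.* ⟪ q ⟫ 0 ℚ.+ 0ℚ             ∎
      go (a ∷ p) (suc n) = begin
        ⟪ a ·ᴾ q +ᴾ (0A ∷ p *ᴾ q) ⟫ (suc n)        ≡⟨ coefficients≡ (+ᴾ-homo (a ·ᴾ q) (0A ∷ p *ᴾ q)) (suc n) ⟩
        ⟪ a ·ᴾ q ⟫ (suc n) ℚ.+ ⟪ p *ᴾ q ⟫ n        ≡⟨ cong₂ ℚ._+_ (·ᴾ-homo a q (suc n)) (go p n) ⟩
        (⟪ a ∷ p ⟫ ⊛ ⟪ q ⟫) (suc n)                ∎

open PolynomialArithmetic ℤ._+_ ℤ._*_ (+ 0)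
module ℤ-Homomorphism = PolynomialArithmetic.Homomorphism ℤ._+_ ℤ._*_ (+ 0) ι refl ι-+ ι-*

infix 8 -ᴾ_
-ᴾ_ : List ℤ → List ℤ
-ᴾ_ = List.map -_

IsZero : List ℤ → Set
IsZero = All (_≡ + 0)

-- Forcing the coefficients keeps later computations with concrete polynomials from growing.
strictly : {A : Set} → ℤ → (ℤ → A) → A
strictly (+ n)    f = force n λ n → f (+ n)
strictly -[1+ n ] f = force n λ n → f -[1+ n ]

strictly-≡ : {A : Set} (a : ℤ) (f : ℤ → A) → strictly a f ≡ f a
strictly-≡ (+ n)    f = force-≡ n (λ n → f (+ n))
strictly-≡ -[1+ n ] f = force-≡ n (λ n → f -[1+ n ])

_∷ᵗ_ : ℤ → List ℤ → List ℤ
+0 ∷ᵗ [] = []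
a  ∷ᵗ p  = a ∷ p

trim : List ℤ → List ℤ
trim []      = []
trim (a ∷ p) = strictly a (_∷ᵗ trim p)

opaque
  unfolding _⊞_ _⊠_ ⊟_ ⌜_⌝

  +ᴾ-homo : ∀ p q → ⌜ p +ᴾ q ⌝ ≋ ⌜ p ⌝ ⊞ ⌜ q ⌝
  +ᴾ-homo = ℤ-Homomorphism.+ᴾ-homo

  *ᴾ-homo : ∀ p q → ⌜ p *ᴾ q ⌝ ≋ ⌜ p ⌝ ⊠ ⌜ q ⌝
  *ᴾ-homo = ℤ-Homomorphism.*ᴾ-homo

  -ᴾ-homo : ∀ p → ⌜ -ᴾ p ⌝ ≋ ⊟ ⌜ p ⌝
  -ᴾ-homo p = pointwise (go p)
    where
    go : ∀ p n → integral (-ᴾ p) n ≡ ℚ.- integral p n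
    go []      n       = refl
    go (a ∷ p) zero    = ι-neg a
    go (a ∷ p) (suc n) = go p n

  isZero⇒≋𝟘 : ∀ {p} → IsZero p → ⌜ p ⌝ ≋ 𝟘
  isZero⇒≋𝟘 z = pointwise (go z)
    where
    go : ∀ {p} → IsZero p → ∀ n → integral p n ≡ 0ℚ
    go []         n       = refl
    go (refl ∷ z) zero    = refl
    go (refl ∷ z) (suc n) = go z n

  ∷ᵗ-homo : ∀ a p n → integral (a ∷ᵗ p) n ≡ integral (a ∷ p) n
  ∷ᵗ-homo +0       []      zero    = refl
  ∷ᵗ-homo +0       []      (suc n) = refl
  ∷ᵗ-homo +0       (_ ∷ _) n       = refl
  ∷ᵗ-homo +[1+ _ ] _       n       = refl
  ∷ᵗ-homo -[1+ _ ] _       n       = refl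

  trim-homo : ∀ p → ⌜ trim p ⌝ ≋ ⌜ p ⌝
  trim-homo p = pointwise (go p)
    where
    go : ∀ p n → integral (trim p) n ≡ integral p n
    go []      n       = refl
    go (a ∷ p) n       = trans (cong (λ q → integral q n) (strictly-≡ a (_∷ᵗ trim p))) (trans (∷ᵗ-homo a (trim p) n) (step n))
      where
      step : ∀ n → integral (a ∷ trim p) n ≡ integral (a ∷ p) n
      step zero    = refl
      step (suc n) = go p n

-- Trimming makes equal polynomials equal as lists, as the solver needs.
ℤ[z] : RawRing 0ℓ 0ℓ
ℤ[z] = record
  { Carrier = List ℤ ; _≈_ = _≡_ ; _+_ = λ p q → trim (p +ᴾ q) ; _*_ = λ p q → trim (p *ᴾ q)
  ; -_ = -ᴾ_ ; 0# = [] ; 1# = + 1 ∷ [] }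

ℤ[z]⟶powerSeries : ℤ[z] -Raw-AlmostCommutative⟶ fromCommutativeRing powerSeriesRing
ℤ[z]⟶powerSeries = record
  { ⟦_⟧    = ⌜_⌝
  ; +-homo = λ p q → ≋-trans (trim-homo (p +ᴾ q)) (+ᴾ-homo p q)
  ; *-homo = λ p q → ≋-trans (trim-homo (p *ᴾ q)) (*ᴾ-homo p q)
  ; -‿homo = -ᴾ-homo
  ; 0-homo = ≋-refl
  ; 1-homo = ≋-refl
  }

module ≋-Reasoning = Relation.Binary.Reasoning.Setoid ≋-setoid

-- All coefficients of the difference are tested for zero, which also identifies lists that differ
-- in trailing zeros.
⌜⌝≟ : ∀ p q → Maybe (⌜ p ⌝ ≋ ⌜ q ⌝)
⌜⌝≟ p q with All.all? (ℤ._≟ + 0) (p +ᴾ -ᴾ q)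
... | no _  = nothing
... | yes d = just (begin
  ⌜ p ⌝                          ≈⟨ ⊞-identityʳ ⌜ p ⌝ ⟨
  ⌜ p ⌝ ⊞ 𝟘                      ≈⟨ ⊞-congˡ (⊟-inverseˡ ⌜ q ⌝) ⟨
  ⌜ p ⌝ ⊞ (⊟ ⌜ q ⌝ ⊞ ⌜ q ⌝)      ≈⟨ ⊞-assoc ⌜ p ⌝ (⊟ ⌜ q ⌝) ⌜ q ⌝ ⟨
  (⌜ p ⌝ ⊞ ⊟ ⌜ q ⌝) ⊞ ⌜ q ⌝      ≈⟨ ⊞-congʳ (⊞-congˡ (-ᴾ-homo q)) ⟨
  (⌜ p ⌝ ⊞ ⌜ -ᴾ q ⌝) ⊞ ⌜ q ⌝     ≈⟨ ⊞-congʳ (+ᴾ-homo p (-ᴾ q)) ⟨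
  ⌜ p +ᴾ -ᴾ q ⌝ ⊞ ⌜ q ⌝          ≈⟨ ⊞-congʳ (isZero⇒≋𝟘 d) ⟩
  𝟘 ⊞ ⌜ q ⌝                      ≈⟨ ⊞-identityˡ ⌜ q ⌝ ⟩
  ⌜ q ⌝                          ∎)
  where open ≋-Reasoning

seriesRing : AlmostCommutativeRing 0ℓ 0ℓ
seriesRing = fromCommutativeRing powerSeriesRing

import Algebra.Solver.Ring ℤ[z] seriesRing ℤ[z]⟶powerSeries ⌜⌝≟ as Solver

open Solver using (solve; _:=_; _:+_; _:*_; _:-_; :-_; con) renaming (Polynomial to Expression)

z : PowerSeries
z = ⌜ + 0 ∷ + 1 ∷ [] ⌝

-- A certificate of ideal membership: `h` is the multiplier of the relation `u ≋ v`, and the last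
-- argument becomes a polynomial identity for the solver. Nested uses give each relation its own
-- multiplier.
≋-modulo : ∀ {f g h u v} → u ≋ v → f ≋ g ⊞ h ⊠ (u ⊞ ⊟ v) → f ≋ g
≋-modulo {f} {g} {h} {u} {v} u≋v f≋ = begin
  f                       ≈⟨ f≋ ⟩
  g ⊞ h ⊠ (u ⊞ ⊟ v)       ≈⟨ ⊞-congˡ (⊠-congˡ (⊞-congʳ u≋v)) ⟩
  g ⊞ h ⊠ (v ⊞ ⊟ v)       ≈⟨ ⊞-congˡ (⊠-congˡ (⊟-inverseʳ v)) ⟩
  g ⊞ h ⊠ 𝟘              ≈⟨ ⊞-congˡ (⊠-zeroʳ h) ⟩
  g ⊞ 𝟘                  ≈⟨ ⊞-identityʳ g ⟩
  g                       ∎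
  where open ≋-Reasoning

-- Series defined by fixed point equations

AgreeBelow : ℕ → PowerSeries → PowerSeries → Set
AgreeBelow n f g = ∀ {i} → i ℕ.< n → f i ≡ g i

opaque
  unfolding _⊞_ _⊠_ ⊟_ ⌜_⌝

  ⊞-coefficient : ∀ f g n → (f ⊞ g) n ≡ f n ℚ.+ g n
  ⊞-coefficient f g n = refl

  z⊠-zero : ∀ f → (z ⊠ f) 0 ≡ 0ℚ
  z⊠-zero f = trans (ℚ.+-identityʳ (ι (+ 0) ℚ.* f 0)) (ℚ.*-zeroˡ (f 0))

  z⊠-suc : ∀ f n → (z ⊠ f) (suc n) ≡ f n
  z⊠-suc f n = begin
    0ℚ ℚ.* f (suc n) ℚ.+ (tail z ⊠ f) n    ≡⟨ cong₂ ℚ._+_ (ℚ.*-zeroˡ (f (suc n))) (coefficients≡ (⊠-congʳ {f} {tail z} {𝟙} tail-z) n) ⟩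
    0ℚ ℚ.+ (𝟙 ⊠ f) n                       ≡⟨ ℚ.+-identityˡ _ ⟩
    (𝟙 ⊠ f) n                              ≡⟨ coefficients≡ (⊠-identityˡ f) n ⟩
    f n                                    ∎
    where
    open ≡-Reasoning
    tail-z : tail z ≋ 𝟙
    tail-z = pointwise λ { zero → refl ; (suc n) → refl }

  𝟙-zero : 𝟙 0 ≡ 1ℚ
  𝟙-zero = refl

  𝟙-suc : ∀ n → 𝟙 (suc n) ≡ 0ℚ
  𝟙-suc n = refl

  ⊠-agreeBelow : ∀ {n f f′ g g′} → AgreeBelow n f f′ → AgreeBelow n g g′ → AgreeBelow n (f ⊠ g) (f′ ⊠ g′)
  ⊠-agreeBelow {n} {f} {f′} {g} {g′} p q {i} i<n =
    sum-cong-≗ {suc i} {λ k → f (toℕ k) ℚ.* g (i ℕ.∸ toℕ k)} {λ k → f′ (toℕ k) ℚ.* g′ (i ℕ.∸ toℕ k)} λ k →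
      cong₂ ℚ._*_ (p (ℕ.≤-trans (Fin.toℕ<n k) i<n)) (q (ℕ.≤-trans (ℕ.s≤s (ℕ.m∸n≤m i (toℕ k))) i<n))

⊞-agreeBelow : ∀ {n f f′ g g′} → AgreeBelow n f f′ → AgreeBelow n g g′ → AgreeBelow n (f ⊞ g) (f′ ⊞ g′)
⊞-agreeBelow {f = f} {f′} {g} {g′} p q {i} i<n =
  trans (⊞-coefficient f g i) (trans (cong₂ ℚ._+_ (p i<n) (q i<n)) (sym (⊞-coefficient f′ g′ i)))

z⊠-agreeBelow : ∀ {n f g} → AgreeBelow n f g → AgreeBelow (suc n) (z ⊠ f) (z ⊠ g)
z⊠-agreeBelow {f = f} {g} p {zero}  _         = trans (z⊠-zero f) (sym (z⊠-zero g))
z⊠-agreeBelow {f = f} {g} p {suc i} (ℕ.s≤s i<n) = trans (z⊠-suc f i) (trans (p i<n) (sym (z⊠-suc g i)))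

-- The factor `z` makes `step` a contraction: each application settles one more coefficient, so
-- coefficient n of the fixed point is already right after n + 1 iterations from 0.
module QuadraticEquation (a b c : PowerSeries) where

  step : PowerSeries → PowerSeries
  step f = a ⊞ z ⊠ (b ⊠ f ⊞ c ⊠ (f ⊠ f))

  iterate : ℕ → PowerSeries → PowerSeries
  iterate zero    f = f
  iterate (suc n) f = step (iterate n f)

  root : PowerSeries
  root n = iterate (suc n) 𝟘 n

  step-agreeBelow : ∀ {n f g} → AgreeBelow n f g → AgreeBelow (suc n) (step f) (step g)
  step-agreeBelow p = ⊞-agreeBelow {f = a} (λ _ → refl)
    (z⊠-agreeBelow (⊞-agreeBelow (⊠-agreeBelow {f = b} (λ _ → refl) p)
                                 (⊠-agreeBelow {f = c} (λ _ → refl) (⊠-agreeBelow p p))))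

  iterate-agreeBelow : ∀ m n → AgreeBelow m (iterate m 𝟘) (iterate (n ℕ.+ m) 𝟘)
  iterate-agreeBelow zero    n ()
  iterate-agreeBelow (suc m) n {i} i<1+m rewrite ℕ.+-suc n m = step-agreeBelow (iterate-agreeBelow m n) i<1+m

  root-equation : root ≋ a ⊞ z ⊠ (b ⊠ root ⊞ c ⊠ (root ⊠ root))
  root-equation = pointwise λ n → step-agreeBelow (λ {i} → agree n {i}) (ℕ.n<1+n n)
    where
    agree : ∀ n → AgreeBelow n (iterate n 𝟘) root
    agree n {i} i<n = sym (begin
      iterate (suc i) 𝟘 i                          ≡⟨ iterate-agreeBelow (suc i) (n ℕ.∸ suc i) (ℕ.n<1+n i) ⟩
      iterate (n ℕ.∸ suc i ℕ.+ suc i) 𝟘 i          ≡⟨ cong (λ k → iterate k 𝟘 i) (ℕ.m∸n+n≡m i<n) ⟩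
      iterate n 𝟘 i                                ∎)
      where open ≡-Reasoning

-- The series K, μ, V and the generating functions of the states

two : PowerSeries
two = ⌜ + 2 ∷ [] ⌝

-- The Catalan series, counting the ways the queue can grow and return to its present length.
K : PowerSeries
K = QuadraticEquation.root 𝟙 𝟘 𝟙

K-equation : K ≋ 𝟙 ⊞ z ⊠ (K ⊠ K)
K-equation = ≋-trans (QuadraticEquation.root-equation 𝟙 𝟘 𝟙)
  (solve 1 (λ k → con (+ 1 ∷ []) :+ ζ :* (con [] :* k :+ con (+ 1 ∷ []) :* (k :* k)) :=
                  con (+ 1 ∷ []) :+ ζ :* (k :* k)) ≋-refl K)
  where ζ = con (+ 0 ∷ + 1 ∷ [])

one′ two′ ζ : ∀ {n} → Expression n
one′  = con (+ 1 ∷ [])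
two′  = con (+ 2 ∷ [])
ζ     = con (+ 0 ∷ + 1 ∷ [])

μ : PowerSeries
μ = QuadraticEquation.root (two ⊠ z) two two

μ-equation : μ ≋ z ⊠ (two ⊠ (𝟙 ⊞ μ ⊞ μ ⊠ μ))
μ-equation = ≋-trans (QuadraticEquation.root-equation (two ⊠ z) two two)
  (solve 1 (λ m → two′ :* ζ :+ ζ :* (two′ :* m :+ two′ :* (m :* m)) :=
                  ζ :* (two′ :* (one′ :+ m :+ m :* m))) ≋-refl μ)

ν : PowerSeries
ν = two ⊠ (𝟙 ⊞ μ ⊞ μ ⊠ μ)

-- Found from the requirement W 0 = V, that is (G + μV)K - μV = V with G = 1 + z(1 + μ)V. Multiplied
-- by K, where K(1 - zK) = 1, it reads (1 + μ - μK²)V = K². Writing μ as zν exposes the factor z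
-- that the fixed point construction requires.
V : PowerSeries
V = QuadraticEquation.root (K ⊠ K) (ν ⊠ (K ⊠ K ⊞ ⊟ 𝟙)) 𝟘

V-equation : V ≋ K ⊠ K ⊞ μ ⊠ (K ⊠ K ⊞ ⊟ 𝟙) ⊠ V
V-equation = ≋-trans (QuadraticEquation.root-equation (K ⊠ K) (ν ⊠ (K ⊠ K ⊞ ⊟ 𝟙)) 𝟘)
  (≋-modulo {h = ⊟ ((K ⊠ K ⊞ ⊟ 𝟙) ⊠ V)} μ-equation
    (solve 4 (λ k m n v → k :* k :+ ζ :* (n :* (k :* k :- one′) :* v :+ con [] :* (v :* v)) :=
      k :* k :+ m :* (k :* k :- one′) :* v :+ :- ((k :* k :- one′) :* v) :* (m :- ζ :* n)) ≋-refl K μ ν V))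

-- The ansatz Y⁺ = μX turns X⁺ = E⁺ + Y⁺ = X + 2Y⁺ into a ratio 1 + 2μ. Put into the recurrence of
-- Y⁺ it gives μ = z(2 + μ + μ(1 + 2μ)), which is the equation of μ.
Λ : PowerSeries
Λ = 𝟙 ⊞ two ⊠ μ

-- The generating functions, by the number of labels below the current minimum, of the completions
-- of a state with suc p pending labels; X p is for p of them.
X X⁺ Y⁺ E⁺ S⁺ : ℕ → PowerSeries
X  p = V ⊠ Λ ↑ p
X⁺ p = X (suc p)
Y⁺ p = μ ⊠ X p
E⁺ p = (𝟙 ⊞ μ) ⊠ X p
S⁺ p = (two ⊞ μ) ⊠ X p

-- `Y⁺` counts the choices of a new minimum while labels are pending: m - 1 is taken, or it is
-- passed over and becomes one more pending label.
Y⁺-equation : ∀ p → Y⁺ p ≋ z ⊠ (S⁺ p ⊞ Y⁺ (suc p))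
Y⁺-equation p = ≋-modulo {h = V ⊠ Λ ↑ p} μ-equation
  (solve 3 (λ m v l → m :* (v :* l) :=
    ζ :* ((two′ :+ m) :* (v :* l) :+ m :* (v :* ((one′ :+ two′ :* m) :* l))) :+
    v :* l :* (m :- ζ :* (two′ :* (one′ :+ m :+ m :* m)))) ≋-refl μ V (Λ ↑ p))

-- With an empty queue, either the largest pending label or a new minimum comes next.
E⁺-equation : ∀ p → E⁺ p ≋ X p ⊞ Y⁺ p
E⁺-equation p = solve 2 (λ m x → (one′ :+ m) :* x := x :+ m :* x) ≋-refl μ (X p)

-- A single waiting label leaves, or the largest pending label joins it, after which its leaving is
-- forced. A longer queue must first shrink to one label, so its length does not enter.
S⁺-equation : ∀ p → S⁺ p ≋ E⁺ p ⊞ X p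
S⁺-equation p = solve 2 (λ m x → (two′ :+ m) :* x := (one′ :+ m) :* x :+ x) ≋-refl μ (X p)

X⁺-equation : ∀ p → X⁺ p ≋ E⁺ p ⊞ Y⁺ p
X⁺-equation p = solve 3 (λ m v l → v :* ((one′ :+ two′ :* m) :* l) :=
  (one′ :+ m) :* (v :* l) :+ m :* (v :* l)) ≋-refl μ V (Λ ↑ p)

G : PowerSeries
G = 𝟙 ⊞ z ⊠ (𝟙 ⊞ μ) ⊠ V

-- Completions of a state with no pending label and j lower labels in the queue, behind
-- an upper one in the case of W.
Q W : ℕ → PowerSeries
Q j = (G ⊞ Y⁺ 0) ⊠ K ↑ j ⊞ ⊟ Y⁺ 0
W j = Q (suc j)

Q-zero : Q 0 ≋ G
Q-zero = solve 2 (λ g y → (g :+ y) :* one′ :- y := g) ≋-refl G (Y⁺ 0)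

-- Adding `Y⁺ 0` absorbs the inhomogeneous term: u j = Q j + Y⁺ 0 satisfies u (j + 1) = u j + z u (j
-- + 2), and powers of K solve this.
Q-suc : ∀ j → Q (suc j) ≋ Q j ⊞ z ⊠ (Q (2 ℕ.+ j) ⊞ Y⁺ 0)
Q-suc j = ≋-modulo {h = (G ⊞ Y⁺ 0) ⊠ K ↑ j} K-equation
  (solve 4 (λ g y k l → (g :+ y) :* (k :* l) :- y :=
    (g :+ y) :* l :- y :+ ζ :* ((g :+ y) :* (k :* (k :* l)) :- y :+ y) :+
    (g :+ y) :* l :* (k :- (one′ :+ ζ :* (k :* k)))) ≋-refl G (Y⁺ 0) K (K ↑ j))

-- The condition that determined V. The multiplier -1 + zK of its equation is -1/K and undoes the
-- multiplication by K.
W-zero : W 0 ≋ V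
W-zero = ≋-modulo {h = ⊟ 𝟙 ⊞ z ⊠ K} V-equation
  (≋-modulo {h = ⊟ ((𝟙 ⊞ ⊟ (z ⊠ K)) ⊠ (𝟙 ⊞ μ) ⊠ V) ⊞ (V ⊞ ⊟ W 0)} K-equation
    (solve 3 (λ k m v →
      let y = m :* (v :* one′)
          w = (one′ :+ ζ :* (one′ :+ m) :* v :+ y) :* (k :* one′) :- y
      in w := v :+ (:- one′ :+ ζ :* k) :* (v :- (k :* k :+ m :* (k :* k :- one′) :* v)) :+
              (:- ((one′ :- ζ :* k) :* (one′ :+ m) :* v) :+ (v :- w)) :* (k :- (one′ :+ ζ :* (k :* k))))
      ≋-refl K μ V))

-- With nothing pending, an upper label at the front behaves like one more lower label, whence
-- `W j = Q (suc j)`.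
W-suc : ∀ j → W j ≋ Q j ⊞ z ⊠ (W (suc j) ⊞ Y⁺ 0)
W-suc = Q-suc

G-equation : G ≋ 𝟙 ⊞ z ⊠ (Q 1 ⊞ Y⁺ 0)
G-equation = ≋-modulo {h = ⊟ z} W-zero
  (solve 3 (λ m v q → one′ :+ ζ :* (one′ :+ m) :* v :=
    one′ :+ ζ :* (q :+ m :* (v :* one′)) :+ :- ζ :* (q :- v)) ≋-refl μ V (Q 1))

-- Cancellation, and computation in ℤ[z][A, B]

open import Algebra.Properties.CommutativeSemiring.Exp (CommutativeRing.commutativeSemiring powerSeriesRing)
  using (^-homo-*; ^-congˡ; ^-distrib-*)

_≉𝟘 : PowerSeries → Set
f ≉𝟘 = ¬ f ≋ 𝟘

opaque
  unfolding _⊠_ _⊞_ ⌜_⌝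

  𝟘-coefficient : ∀ n → 𝟘 n ≡ 0ℚ
  𝟘-coefficient n = refl

  ⊠-≉𝟘 : ∀ {f g} → f ≉𝟘 → g ≉𝟘 → (f ⊠ g) ≉𝟘
  ⊠-≉𝟘 f≉𝟘 g≉𝟘 fg≋𝟘 = ⊛-nonzero (λ p → f≉𝟘 (pointwise p)) (λ p → g≉𝟘 (pointwise p)) (coefficients≡ fg≋𝟘)

  constant : ∀ f g → (f ⊞ z ⊠ g) 0 ≡ f 0
  constant f g = trans (cong (f 0 ℚ.+_) (z⊠-zero g)) (ℚ.+-identityʳ (f 0))

coefficient≢0⇒≉𝟘 : ∀ {f} n → ¬ f n ≡ 0ℚ → f ≉𝟘
coefficient≢0⇒≉𝟘 n fn≢0 f≋𝟘 = fn≢0 (trans (coefficients≡ f≋𝟘 n) (𝟘-coefficient n))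

-- Equality in ℚ is decidable, so each coefficient of `g` is either zero or a witness that `g`, and
-- hence the product, is nonzero.
⊠-cancel : ∀ {f g} → f ≉𝟘 → f ⊠ g ≋ 𝟘 → g ≋ 𝟘
⊠-cancel {f} {g} f≉𝟘 fg≋𝟘 = pointwise λ n → decide n
  where
  decide : ∀ n → g n ≡ 𝟘 n
  decide n with g n ℚ.≟ 0ℚ
  ... | yes gn≡0 = trans gn≡0 (sym (𝟘-coefficient n))
  ... | no  gn≢0 = ⊥-elim (⊠-≉𝟘 f≉𝟘 (coefficient≢0⇒≉𝟘 n gn≢0) fg≋𝟘)

-- (a , b) stands for a + b √γ.
module QuadraticExtension {R : Set} (_+_ _*_ : R → R → R) (γ : R) where

  infixl 6 _+√_
  infixl 7 _*√_

  _+√_ _*√_ : R × R → R × R → R × R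
  (a , b) +√ (c , d) = a + c , b + d
  (a , b) *√ (c , d) = (a * c) + (γ * (b * d)) , (a * d) + (b * c)

  module Evaluation (φ : R → PowerSeries) (φ+ : ∀ a b → φ (a + b) ≋ φ a ⊞ φ b)
    (φ* : ∀ a b → φ (a * b) ≋ φ a ⊠ φ b) (root : PowerSeries) (root² : root ⊠ root ≋ φ γ) where
    open ≋-Reasoning

    ⟪_⟫ : R × R → PowerSeries
    ⟪ a , b ⟫ = φ a ⊞ φ b ⊠ root

    +√-homo : ∀ x y → ⟪ x +√ y ⟫ ≋ ⟪ x ⟫ ⊞ ⟪ y ⟫
    +√-homo (a , b) (c , d) = begin
      φ (a + c) ⊞ φ (b + d) ⊠ root                  ≈⟨ ⊞-cong (φ+ a c) (⊠-congʳ (φ+ b d)) ⟩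
      (φ a ⊞ φ c) ⊞ (φ b ⊞ φ d) ⊠ root              ≈⟨ solve 5 (λ a b c d r → a :+ c :+ (b :+ d) :* r := a :+ b :* r :+ (c :+ d :* r))
                                                         ≋-refl (φ a) (φ b) (φ c) (φ d) root ⟩
      (φ a ⊞ φ b ⊠ root) ⊞ (φ c ⊞ φ d ⊠ root)       ∎

    *√-homo : ∀ x y → ⟪ x *√ y ⟫ ≋ ⟪ x ⟫ ⊠ ⟪ y ⟫
    *√-homo (a , b) (c , d) = begin
      φ ((a * c) + (γ * (b * d))) ⊞ φ ((a * d) + (b * c)) ⊠ root
        ≈⟨ ⊞-cong (≋-trans (φ+ _ _) (⊞-cong (φ* a c) (≋-trans (φ* γ _) (⊠-congˡ (φ* b d)))))
                  (⊠-congʳ (≋-trans (φ+ _ _) (⊞-cong (φ* a d) (φ* b c)))) ⟩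
      (φ a ⊠ φ c ⊞ φ γ ⊠ (φ b ⊠ φ d)) ⊞ (φ a ⊠ φ d ⊞ φ b ⊠ φ c) ⊠ root
        ≈⟨ ≋-modulo {h = ⊟ (φ b ⊠ φ d)} root² (solve 6 (λ a b c d r γ →
             a :* c :+ γ :* (b :* d) :+ (a :* d :+ b :* c) :* r :=
             (a :+ b :* r) :* (c :+ d :* r) :+ :- (b :* d) :* (r :* r :- γ))
             ≋-refl (φ a) (φ b) (φ c) (φ d) root (φ γ)) ⟩
      (φ a ⊞ φ b ⊠ root) ⊠ (φ c ⊞ φ d ⊠ root) ∎

A B : PowerSeries
A = 𝟙 ⊞ ⊟ (two ⊠ z ⊠ K)
B = 𝟙 ⊞ ⊟ (two ⊠ z) ⊞ ⊟ (two ⊠ two ⊠ z ⊠ μ)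

α β : List ℤ
α = + 1 ∷ - (+ 4) ∷ []
β = + 1 ∷ - (+ 4) ∷ - (+ 12) ∷ []

A² : A ⊠ A ≋ ⌜ α ⌝
A² = ≋-modulo {h = ⊟ (two ⊠ two ⊠ z)} K-equation
  (solve 1 (λ k → let a = one′ :- two′ :* ζ :* k in
    a :* a := con α :+ :- (two′ :* two′ :* ζ) :* (k :- (one′ :+ ζ :* (k :* k)))) ≋-refl K)

B² : B ⊠ B ≋ ⌜ β ⌝
B² = ≋-modulo {h = ⊟ (two ⊠ two ⊠ two ⊠ z)} μ-equation
  (solve 1 (λ m → let b = one′ :- two′ :* ζ :- two′ :* two′ :* ζ :* m in
    b :* b := con β :+ :- (two′ :* two′ :* two′ :* ζ) :* (m :- ζ :* (two′ :* (one′ :+ m :+ m :* m)))) ≋-refl μ)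

infixl 6 _+ᵗ_
infixl 7 _*ᵗ_

_+ᵗ_ _*ᵗ_ : List ℤ → List ℤ → List ℤ
p +ᵗ q = trim (p +ᴾ q)
p *ᵗ q = trim (p *ᴾ q)

+ᵗ-homo : ∀ p q → ⌜ p +ᵗ q ⌝ ≋ ⌜ p ⌝ ⊞ ⌜ q ⌝
+ᵗ-homo p q = ≋-trans (trim-homo (p +ᴾ q)) (+ᴾ-homo p q)

*ᵗ-homo : ∀ p q → ⌜ p *ᵗ q ⌝ ≋ ⌜ p ⌝ ⊠ ⌜ q ⌝
*ᵗ-homo p q = ≋-trans (trim-homo (p *ᴾ q)) (*ᴾ-homo p q)

module ℤ[z,A] = QuadraticExtension _+ᵗ_ _*ᵗ_ α
module ℤ[z,A]-Evaluation = ℤ[z,A].Evaluation ⌜_⌝ +ᵗ-homo *ᵗ-homo A A²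

β′ : List ℤ × List ℤ
β′ = β , []

B²′ : B ⊠ B ≋ ℤ[z,A]-Evaluation.⟪ β′ ⟫
B²′ = ≋-trans B² (solve 1 (λ a → con β := con β :+ con [] :* a) ≋-refl A)

module ℤ[z,A,B] = QuadraticExtension ℤ[z,A]._+√_ ℤ[z,A]._*√_ β′
module ℤ[z,A,B]-Evaluation = ℤ[z,A,B].Evaluation
  ℤ[z,A]-Evaluation.⟪_⟫ ℤ[z,A]-Evaluation.+√-homo ℤ[z,A]-Evaluation.*√-homo B B²′

open ℤ[z,A,B] using () renaming (_+√_ to _+ᴱ_; _*√_ to _*ᴱ_)
Element : Set
Element = (List ℤ × List ℤ) × (List ℤ × List ℤ)

fromℤ[z] : List ℤ → Element
fromℤ[z] p = (p , []) , ([] , [])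

-- Opaque, so that comparing two values does not compute the elements.
opaque
  ⟦_⟧ᴱ : Element → PowerSeries
  ⟦_⟧ᴱ = ℤ[z,A,B]-Evaluation.⟪_⟫

  +ᴱ-homo : ∀ x y → ⟦ x +ᴱ y ⟧ᴱ ≋ ⟦ x ⟧ᴱ ⊞ ⟦ y ⟧ᴱ
  +ᴱ-homo = ℤ[z,A,B]-Evaluation.+√-homo

  *ᴱ-homo : ∀ x y → ⟦ x *ᴱ y ⟧ᴱ ≋ ⟦ x ⟧ᴱ ⊠ ⟦ y ⟧ᴱ
  *ᴱ-homo = ℤ[z,A,B]-Evaluation.*√-homo

  fromℤ[z]-homo : ∀ p → ⟦ fromℤ[z] p ⟧ᴱ ≋ ⌜ p ⌝
  fromℤ[z]-homo p = solve 3 (λ a b p → p :+ con [] :* a :+ (con [] :+ con [] :* a) :* b := p) ≋-refl A B ⌜ p ⌝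

  ⟦⟧ᴱ-coordinates : ∀ p q r s → ⟦ (p , q) , (r , s) ⟧ᴱ ≋ ⌜ p ⌝ ⊞ ⌜ q ⌝ ⊠ A ⊞ (⌜ r ⌝ ⊞ ⌜ s ⌝ ⊠ A) ⊠ B
  ⟦⟧ᴱ-coordinates p q r s = ≋-refl

-- G = numerator / denominator, found by solving the equations for K, μ and V in terms of A and B.
denominator numerator : Element
denominator = ((- (+ 1) ∷ + 4 ∷ - (+ 2) ∷ + 4 ∷ [] , + 1 ∷ - (+ 2) ∷ []) , (+ 1 ∷ - (+ 2) ∷ - (+ 2) ∷ [] , - (+ 1) ∷ []))
numerator   = ((- (+ 1) ∷ + 5 ∷ - (+ 2) ∷ [] , + 1 ∷ - (+ 3) ∷ - (+ 2) ∷ []) , (+ 1 ∷ - (+ 3) ∷ [] , - (+ 1) ∷ + 1 ∷ []))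

eight-z³ : List ℤ
eight-z³ = + 0 ∷ + 0 ∷ + 0 ∷ + 8 ∷ []

conᴱ : ∀ {n} → Element → Expression n → Expression n → Expression n
conᴱ ((p , q) , (r , s)) a b = con p :+ con q :* a :+ (con r :+ con s :* a) :* b

opaque
  unfolding ⟦_⟧ᴱ

  -- Up to 8z³ this is the factor 1 - μ(K² - 1) of V in its equation, with μ written as zν so that
  -- its constant term is visibly 1. The factor 8z³ clears the denominators of μ = (1 - 2z - B)/(4z)
  -- and K² = (1 - 2z - A)/(2z²).
  denominator≋ : ⟦ denominator ⟧ᴱ ≋ ⌜ eight-z³ ⌝ ⊠ (𝟙 ⊞ z ⊠ (ν ⊠ (𝟙 ⊞ ⊟ (K ⊠ K))))
  denominator≋ = ≋-modulo {h = ⌜ eight-z³ ⌝ ⊠ (𝟙 ⊞ ⊟ (K ⊠ K))} μ-equation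
    (≋-modulo {h = ⊟ (⌜ + 0 ∷ + 0 ∷ + 8 ∷ [] ⌝ ⊠ μ)} K-equation
      (solve 2 (λ k m →
        let a = one′ :- two′ :* ζ :* k
            b = one′ :- two′ :* ζ :- two′ :* two′ :* ζ :* m
            n = two′ :* (one′ :+ m :+ m :* m)
        in conᴱ denominator a b :=
           con eight-z³ :* (one′ :+ ζ :* (n :* (one′ :- k :* k))) :+
           con eight-z³ :* (one′ :- k :* k) :* (m :- ζ :* n) :+
           :- (con (+ 0 ∷ + 0 ∷ + 8 ∷ []) :* m) :* (k :- (one′ :+ ζ :* (k :* k))))
        ≋-refl K μ))

  denominator⊠G : ⟦ denominator ⟧ᴱ ⊠ G ≋ ⟦ numerator ⟧ᴱ
  denominator⊠G = ≋-modulo {h = ⌜ eight-z³ ⌝ ⊠ z ⊠ (𝟙 ⊞ μ)} V-equation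
    (≋-modulo {h = ⊟ (⌜ eight-z³ ⌝ ⊠ (𝟙 ⊞ μ) ⊠ (𝟙 ⊞ μ ⊠ V))} K-equation
      (solve 3 (λ k m v →
        let a = one′ :- two′ :* ζ :* k
            b = one′ :- two′ :* ζ :- two′ :* two′ :* ζ :* m
        in conᴱ denominator a b :* (one′ :+ ζ :* (one′ :+ m) :* v) := conᴱ numerator a b :+
           con eight-z³ :* ζ :* (one′ :+ m) :* (v :- (k :* k :+ m :* (k :* k :- one′) :* v)) :+
           :- (con eight-z³ :* (one′ :+ m) :* (one′ :+ m :* v)) :* (k :- (one′ :+ ζ :* (k :* k))))
        ≋-refl K μ V))

opaque
  unfolding ⌜_⌝

  eight-z³≉𝟘 : ⌜ eight-z³ ⌝ ≉𝟘
  eight-z³≉𝟘 = coefficient≢0⇒≉𝟘 3 λ ()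

  two≉𝟘 : two ≉𝟘
  two≉𝟘 = coefficient≢0⇒≉𝟘 0 λ ()

  α≉𝟘 : ⌜ α ⌝ ≉𝟘
  α≉𝟘 = coefficient≢0⇒≉𝟘 0 λ ()

  𝟙≢0 : ¬ 𝟙 0 ≡ 0ℚ
  𝟙≢0 ()

denominator≉𝟘 : ⟦ denominator ⟧ᴱ ≉𝟘
denominator≉𝟘 d≋𝟘 = ⊠-≉𝟘 eight-z³≉𝟘
  (coefficient≢0⇒≉𝟘 0 (λ eq → 𝟙≢0 (trans (sym (constant 𝟙 (ν ⊠ (𝟙 ⊞ ⊟ (K ⊠ K))))) eq)))
  (≋-trans (≋-sym denominator≋) d≋𝟘)

_^ᴱ_ : Element → ℕ → Element
x ^ᴱ zero  = fromℤ[z] (+ 1 ∷ [])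
x ^ᴱ suc k = x *ᴱ x ^ᴱ k

infixr 8 _^ᴱ_

-- Represents denominator^(i + j) G^j, so that polynomials of degree i + j in G can be tested
-- without division.
homogenized : ℕ → ℕ → Element
homogenized i j = denominator ^ᴱ i *ᴱ numerator ^ᴱ j

^ᴱ-homo : ∀ x k → ⟦ x ^ᴱ k ⟧ᴱ ≋ ⟦ x ⟧ᴱ ↑ k
^ᴱ-homo x zero    = fromℤ[z]-homo (+ 1 ∷ [])
^ᴱ-homo x (suc k) = ≋-trans (*ᴱ-homo x (x ^ᴱ k)) (⊠-congˡ (^ᴱ-homo x k))

homogenized-homo : ∀ i j → ⟦ homogenized i j ⟧ᴱ ≋ ⟦ denominator ⟧ᴱ ↑ (i ℕ.+ j) ⊠ G ↑ j
homogenized-homo i j = begin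
  ⟦ homogenized i j ⟧ᴱ                         ≈⟨ *ᴱ-homo (denominator ^ᴱ i) (numerator ^ᴱ j) ⟩
  ⟦ denominator ^ᴱ i ⟧ᴱ ⊠ ⟦ numerator ^ᴱ j ⟧ᴱ  ≈⟨ ⊠-cong (^ᴱ-homo denominator i) (^ᴱ-homo numerator j) ⟩
  D ↑ i ⊠ ⟦ numerator ⟧ᴱ ↑ j                   ≈⟨ ⊠-congˡ (^-congˡ j denominator⊠G) ⟨
  D ↑ i ⊠ (D ⊠ G) ↑ j                          ≈⟨ ⊠-congˡ (^-distrib-* D G j) ⟩
  D ↑ i ⊠ (D ↑ j ⊠ G ↑ j)                      ≈⟨ ⊠-assoc (D ↑ i) (D ↑ j) (G ↑ j) ⟨
  (D ↑ i ⊠ D ↑ j) ⊠ G ↑ j                      ≈⟨ ⊠-congʳ (^-homo-* D i j) ⟨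
  D ↑ (i ℕ.+ j) ⊠ G ↑ j                        ∎
  where
  open ≋-Reasoning
  D = ⟦ denominator ⟧ᴱ

-- The quartic equation and the uniqueness of its solution

q₀ q₁ q₂ q₃ q₄ : List ℤ
q₀ = + 1     ∷ - (+ 4)  ∷ + 4      ∷ []
q₁ = - (+ 4) ∷ + 16     ∷ - (+ 16) ∷ []
q₂ = + 5     ∷ - (+ 22) ∷ + 36     ∷ + 8      ∷ []
q₃ = - (+ 2) ∷ + 12     ∷ - (+ 40) ∷ - (+ 16) ∷ []
q₄ = + 0     ∷ - (+ 2)  ∷ + 17     ∷ + 12     ∷ + 4 ∷ []

Quartic : PowerSeries → PowerSeries
Quartic F = ⌜ q₀ ⌝ ⊞ ⌜ q₁ ⌝ ⊠ F ⊞ ⌜ q₂ ⌝ ⊠ F ↑ 2 ⊞ ⌜ q₃ ⌝ ⊠ F ↑ 3 ⊞ ⌜ q₄ ⌝ ⊠ F ↑ 4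

opaque
  unfolding _⊞_ _⊠_ ⌜_⌝

  Quartic≈quartic : ∀ F → Quartic F ≈ quartic F
  Quartic≈quartic F n = refl

homogenizedQuartic : Element
homogenizedQuartic =
  fromℤ[z] q₀ *ᴱ homogenized 4 0 +ᴱ fromℤ[z] q₁ *ᴱ homogenized 3 1 +ᴱ fromℤ[z] q₂ *ᴱ homogenized 2 2 +ᴱ
  fromℤ[z] q₃ *ᴱ homogenized 1 3 +ᴱ fromℤ[z] q₄ *ᴱ homogenized 0 4

-- Trimmed arithmetic gives zero only one representation, empty coordinate lists, so evaluation
-- alone verifies the quartic.
homogenizedQuartic≡0 : homogenizedQuartic ≡ fromℤ[z] []
homogenizedQuartic≡0 = refl

Quartic-scale : ∀ d F → d ⊠ Quartic F ≋
  ⌜ q₀ ⌝ ⊠ (d ⊠ F ↑ 0) ⊞ ⌜ q₁ ⌝ ⊠ (d ⊠ F ↑ 1) ⊞ ⌜ q₂ ⌝ ⊠ (d ⊠ F ↑ 2) ⊞ ⌜ q₃ ⌝ ⊠ (d ⊠ F ↑ 3) ⊞ ⌜ q₄ ⌝ ⊠ (d ⊠ F ↑ 4)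
Quartic-scale d F = solve 5 (λ d f f² f³ f⁴ →
  d :* (con q₀ :+ con q₁ :* f :+ con q₂ :* f² :+ con q₃ :* f³ :+ con q₄ :* f⁴) :=
  con q₀ :* (d :* one′) :+ con q₁ :* (d :* (f :* one′)) :+ con q₂ :* (d :* f²) :+ con q₃ :* (d :* f³) :+ con q₄ :* (d :* f⁴))
  ≋-refl d F (F ↑ 2) (F ↑ 3) (F ↑ 4)

sum-homo : ∀ a b c d e → ⟦ a +ᴱ b +ᴱ c +ᴱ d +ᴱ e ⟧ᴱ ≋ ⟦ a ⟧ᴱ ⊞ ⟦ b ⟧ᴱ ⊞ ⟦ c ⟧ᴱ ⊞ ⟦ d ⟧ᴱ ⊞ ⟦ e ⟧ᴱ
sum-homo a b c d e = ≋-trans (+ᴱ-homo (a +ᴱ b +ᴱ c +ᴱ d) e) (⊞-congʳ (≋-trans (+ᴱ-homo (a +ᴱ b +ᴱ c) d)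
  (⊞-congʳ (≋-trans (+ᴱ-homo (a +ᴱ b) c) (⊞-congʳ (+ᴱ-homo a b))))))

term-homo : ∀ q i j → ⟦ fromℤ[z] q *ᴱ homogenized i j ⟧ᴱ ≋ ⌜ q ⌝ ⊠ (⟦ denominator ⟧ᴱ ↑ (i ℕ.+ j) ⊠ G ↑ j)
term-homo q i j = ≋-trans (*ᴱ-homo (fromℤ[z] q) (homogenized i j)) (⊠-cong (fromℤ[z]-homo q) (homogenized-homo i j))

homogenizedQuartic-homo : ⟦ homogenizedQuartic ⟧ᴱ ≋ ⟦ denominator ⟧ᴱ ↑ 4 ⊠ Quartic G
homogenizedQuartic-homo = ≋-trans
  (sum-homo (fromℤ[z] q₀ *ᴱ homogenized 4 0) (fromℤ[z] q₁ *ᴱ homogenized 3 1) (fromℤ[z] q₂ *ᴱ homogenized 2 2)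
            (fromℤ[z] q₃ *ᴱ homogenized 1 3) (fromℤ[z] q₄ *ᴱ homogenized 0 4))
  (≋-trans (⊞-cong (⊞-cong (⊞-cong (⊞-cong (term-homo q₀ 4 0) (term-homo q₁ 3 1)) (term-homo q₂ 2 2)) (term-homo q₃ 1 3)) (term-homo q₄ 0 4))
           (≋-sym (Quartic-scale (⟦ denominator ⟧ᴱ ↑ 4) G)))

denominator↑4≉𝟘 : (⟦ denominator ⟧ᴱ ↑ 4) ≉𝟘
denominator↑4≉𝟘 = ⊠-≉𝟘 denominator≉𝟘 (⊠-≉𝟘 denominator≉𝟘 (⊠-≉𝟘 denominator≉𝟘 (⊠-≉𝟘 denominator≉𝟘 (coefficient≢0⇒≉𝟘 0 𝟙≢0))))

Quartic-G : Quartic G ≋ 𝟘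
Quartic-G = ⊠-cancel denominator↑4≉𝟘 (≋-trans (≋-sym homogenizedQuartic-homo)
  (≋-trans (≋-reflexive (cong ⟦_⟧ᴱ homogenizedQuartic≡0)) (fromℤ[z]-homo [])))

dividedDifference : PowerSeries → PowerSeries → PowerSeries
dividedDifference F F′ =
  ⌜ q₁ ⌝ ⊞ ⌜ q₂ ⌝ ⊠ (F ⊞ F′) ⊞ ⌜ q₃ ⌝ ⊠ (F ⊠ F ⊞ F ⊠ F′ ⊞ F′ ⊠ F′) ⊞
  ⌜ q₄ ⌝ ⊠ (F ⊠ F ⊠ F ⊞ F ⊠ F ⊠ F′ ⊞ F ⊠ F′ ⊠ F′ ⊞ F′ ⊠ F′ ⊠ F′)

dividedDifference-correct : ∀ F F′ → (F ⊞ ⊟ F′) ⊠ dividedDifference F F′ ≋ Quartic F ⊞ ⊟ Quartic F′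
dividedDifference-correct = solve 2 (λ f g →
  let quartic′ = λ f → con q₀ :+ con q₁ :* f :+ con q₂ :* (f :* (f :* one′)) :+
                       con q₃ :* (f :* (f :* (f :* one′))) :+ con q₄ :* (f :* (f :* (f :* (f :* one′))))
  in (f :- g) :* (con q₁ :+ con q₂ :* (f :+ g) :+ con q₃ :* (f :* f :+ f :* g :+ g :* g) :+
       con q₄ :* (f :* f :* f :+ f :* f :* g :+ f :* g :* g :+ g :* g :* g)) := quartic′ f :- quartic′ g) ≋-refl

dividedDifference-agreeBelow : ∀ {n f f′ g g′} → AgreeBelow n f f′ → AgreeBelow n g g′ →
  AgreeBelow n (dividedDifference f g) (dividedDifference f′ g′)
dividedDifference-agreeBelow {n} {f} {f′} {g} {g′} p q = (same q₁ ⊞ᵃ same q₂ ⊠ᵃ (p ⊞ᵃ q)) ⊞ᵃ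
  same q₃ ⊠ᵃ ((p ⊠ᵃ p ⊞ᵃ p ⊠ᵃ q) ⊞ᵃ q ⊠ᵃ q) ⊞ᵃ
  same q₄ ⊠ᵃ (((p ⊠ᵃ p ⊠ᵃ p ⊞ᵃ p ⊠ᵃ p ⊠ᵃ q) ⊞ᵃ p ⊠ᵃ q ⊠ᵃ q) ⊞ᵃ q ⊠ᵃ q ⊠ᵃ q)
  where
  infixl 6 _⊞ᵃ_
  infixl 7 _⊠ᵃ_
  _⊞ᵃ_ : ∀ {f f′ g g′} → AgreeBelow n f f′ → AgreeBelow n g g′ → AgreeBelow n (f ⊞ g) (f′ ⊞ g′)
  (p ⊞ᵃ q) {i} = ⊞-agreeBelow p q {i}
  _⊠ᵃ_ : ∀ {f f′ g g′} → AgreeBelow n f f′ → AgreeBelow n g g′ → AgreeBelow n (f ⊠ g) (f′ ⊠ g′)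
  (p ⊠ᵃ q) {i} = ⊠-agreeBelow p q {i}
  same : ∀ p → AgreeBelow n ⌜ p ⌝ ⌜ p ⌝
  same p _ = refl

1+z : List ℤ
1+z = + 1 ∷ + 1 ∷ []

-- The derivative of the quartic at 1 + z; it vanishes at z = 0, where the quartic has a double root.
derivative : List ℤ
derivative = + 0 ∷ - (+ 2) ∷ + 2 ∷ + 64 ∷ + 156 ∷ + 212 ∷ + 96 ∷ + 16 ∷ []

dividedDifference-1+z : dividedDifference ⌜ 1+z ⌝ ⌜ 1+z ⌝ ≋ ⌜ derivative ⌝
dividedDifference-1+z = solve 0 (let f = con 1+z in
  con q₁ :+ con q₂ :* (f :+ f) :+ con q₃ :* (f :* f :+ f :* f :+ f :* f) :+
  con q₄ :* (f :* f :* f :+ f :* f :* f :+ f :* f :* f :+ f :* f :* f) := con derivative) ≋-refl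

opaque
  unfolding ⌜_⌝

  agree-1+z : ∀ F → F 0 ≡ 1ℚ → F 1 ≡ 1ℚ → AgreeBelow 2 F ⌜ 1+z ⌝
  agree-1+z F F0 F1 {0} _ = F0
  agree-1+z F F0 F1 {1} _ = F1
  agree-1+z F F0 F1 {suc (suc _)} (ℕ.s≤s (ℕ.s≤s ()))

  derivative₁≢0 : ¬ ⌜ derivative ⌝ 1 ≡ 0ℚ
  derivative₁≢0 ()

unique : ∀ {F F′} → F 0 ≡ 1ℚ → F 1 ≡ 1ℚ → Quartic F ≋ 𝟘 → F′ 0 ≡ 1ℚ → F′ 1 ≡ 1ℚ → Quartic F′ ≋ 𝟘 → F ≋ F′
unique {F} {F′} F0 F1 qF F′0 F′1 qF′ = begin
  F                     ≈⟨ solve 2 (λ f f′ → f := f :- f′ :+ f′) ≋-refl F F′ ⟩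
  (F ⊞ ⊟ F′) ⊞ F′       ≈⟨ ⊞-congʳ (⊠-cancel δ≉𝟘 (≋-trans (⊠-comm δ (F ⊞ ⊟ F′)) F-F′≋𝟘)) ⟩
  𝟘 ⊞ F′                ≈⟨ ⊞-identityˡ F′ ⟩
  F′                    ∎
  where
  open ≋-Reasoning
  δ = dividedDifference F F′
  F-F′≋𝟘 : (F ⊞ ⊟ F′) ⊠ δ ≋ 𝟘
  F-F′≋𝟘 = begin
    (F ⊞ ⊟ F′) ⊠ δ                ≈⟨ dividedDifference-correct F F′ ⟩
    Quartic F ⊞ ⊟ Quartic F′      ≈⟨ ⊞-cong qF (⊟-cong qF′) ⟩
    𝟘 ⊞ ⊟ 𝟘                       ≈⟨ ⊟-inverseʳ 𝟘 ⟩
    𝟘                             ∎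
  δ≉𝟘 : δ ≉𝟘
  -- Both arguments agree with 1 + z below z², so this coefficient is the one of `derivative`, which
  -- is -2.
  δ≉𝟘 = coefficient≢0⇒≉𝟘 1 λ δ1≡0 → derivative₁≢0
    (trans (sym (coefficients≡ dividedDifference-1+z 1))
      (trans (sym (dividedDifference-agreeBelow {f = F} {g = F′} (agree-1+z F F0 F1) (agree-1+z F′ F′0 F′1) (ℕ.s≤s (ℕ.s≤s ℕ.z≤n)))) δ1≡0))

-- Polynomials over ℚ and their values

module ℚ[z] = PolynomialArithmetic ℚ._+_ ℚ._*_ 0ℚ
open ℚ[z] using () renaming (_+ᴾ_ to _+ℚ_; _·ᴾ_ to _·ℚ_; _*ᴾ_ to _*ℚ_)
module ℚ[z]-Homomorphism = ℚ[z].Homomorphism (λ a → a) refl (λ _ _ → refl) (λ _ _ → refl)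

value : Polynomial → ℚ → ℚ
value []      x = 0ℚ
value (a ∷ p) x = a ℚ.+ x ℚ.* value p x

value-+ : ∀ p q x → value (p +ℚ q) x ≡ value p x ℚ.+ value q x
value-+ []      q       x = sym (ℚ.+-identityˡ _)
value-+ (a ∷ p) []      x = sym (ℚ.+-identityʳ _)
value-+ (a ∷ p) (b ∷ q) x = trans (cong (λ v → a ℚ.+ b ℚ.+ x ℚ.* v) (value-+ p q x))
  (ℚ-solve 5 (λ a b x v w → a ⟨+⟩ b ⟨+⟩ x ⟨*⟩ (v ⟨+⟩ w) ⟨=⟩ a ⟨+⟩ x ⟨*⟩ v ⟨+⟩ (b ⟨+⟩ x ⟨*⟩ w)) refl
    a b x (value p x) (value q x))

value-· : ∀ a p x → value (a ·ℚ p) x ≡ a ℚ.* value p x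
value-· a []      x = sym (ℚ.*-zeroʳ a)
value-· a (b ∷ p) x = trans (cong (λ v → a ℚ.* b ℚ.+ x ℚ.* v) (value-· a p x))
  (ℚ-solve 4 (λ a b x v → a ⟨*⟩ b ⟨+⟩ x ⟨*⟩ (a ⟨*⟩ v) ⟨=⟩ a ⟨*⟩ (b ⟨+⟩ x ⟨*⟩ v)) refl a b x (value p x))

value-* : ∀ p q x → value (p *ℚ q) x ≡ value p x ℚ.* value q x
value-* []      q x = sym (ℚ.*-zeroˡ (value q x))
value-* (a ∷ p) q x = begin
  value (a ·ℚ q +ℚ (0ℚ ∷ p *ℚ q)) x                         ≡⟨ value-+ (a ·ℚ q) (0ℚ ∷ p *ℚ q) x ⟩
  value (a ·ℚ q) x ℚ.+ (0ℚ ℚ.+ x ℚ.* value (p *ℚ q) x)      ≡⟨ cong₂ (λ v w → v ℚ.+ (0ℚ ℚ.+ x ℚ.* w)) (value-· a q x) (value-* p q x) ⟩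
  a ℚ.* value q x ℚ.+ (0ℚ ℚ.+ x ℚ.* (value p x ℚ.* value q x))
    ≡⟨ ℚ-solve 4 (λ a x v w → a ⟨*⟩ w ⟨+⟩ (ℚ-con 0ℚ ⟨+⟩ x ⟨*⟩ (v ⟨*⟩ w)) ⟨=⟩ (a ⟨+⟩ x ⟨*⟩ v) ⟨*⟩ w) refl
         a x (value p x) (value q x) ⟩
  (a ℚ.+ x ℚ.* value p x) ℚ.* value q x                     ∎
  where open ≡-Reasoning

value-zero : ∀ p x → ⟦ p ⟧ ≈ 0# → value p x ≡ 0ℚ
value-zero []      x p≈0 = refl
value-zero (a ∷ p) x p≈0 = trans (cong₂ (λ b v → b ℚ.+ x ℚ.* v) (p≈0 0) (value-zero p x (λ n → p≈0 (suc n))))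
  (trans (ℚ.+-identityˡ _) (ℚ.*-zeroʳ x))

-- Synthetic division by the linear polynomial with root `x`; the remainder is `value p x`.
quotient : Polynomial → ℚ → Polynomial
quotient []      x = []
quotient (a ∷ p) x = p +ℚ (x ·ℚ quotient p x)

value-quotient : ∀ p x y → value p y ≡ value p x ℚ.+ (y ℚ.- x) ℚ.* value (quotient p x) y
value-quotient []      x y = sym (trans (ℚ.+-identityˡ _) (ℚ.*-zeroʳ (y ℚ.- x)))
value-quotient (a ∷ p) x y = sym (begin
  a ℚ.+ x ℚ.* value p x ℚ.+ (y ℚ.- x) ℚ.* value (p +ℚ (x ·ℚ q)) y
    ≡⟨ cong (λ v → a ℚ.+ x ℚ.* value p x ℚ.+ (y ℚ.- x) ℚ.* v)
         (trans (value-+ p (x ·ℚ q) y) (cong₂ ℚ._+_ (value-quotient p x y) (value-· x q y))) ⟩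
  a ℚ.+ x ℚ.* value p x ℚ.+ (y ℚ.- x) ℚ.* (value p x ℚ.+ (y ℚ.- x) ℚ.* value q y ℚ.+ x ℚ.* value q y)
    ≡⟨ ℚ-solve 5 (λ a x y v w → a ⟨+⟩ x ⟨*⟩ v ⟨+⟩ (y ⟨-⟩ x) ⟨*⟩ (v ⟨+⟩ (y ⟨-⟩ x) ⟨*⟩ w ⟨+⟩ x ⟨*⟩ w) ⟨=⟩
         a ⟨+⟩ y ⟨*⟩ (v ⟨+⟩ (y ⟨-⟩ x) ⟨*⟩ w)) refl a x y (value p x) (value q y) ⟩
  a ℚ.+ y ℚ.* (value p x ℚ.+ (y ℚ.- x) ℚ.* value q y)
    ≡⟨ cong (λ v → a ℚ.+ y ℚ.* v) (value-quotient p x y) ⟨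
  a ℚ.+ y ℚ.* value p y ∎)
  where
  open ≡-Reasoning
  q = quotient p x

+ℚ-coefficient : ∀ p q n → ⟦ p +ℚ q ⟧ n ≡ ⟦ p ⟧ n ℚ.+ ⟦ q ⟧ n
+ℚ-coefficient []      q       n       = sym (ℚ.+-identityˡ _)
+ℚ-coefficient (a ∷ p) []      n       = sym (ℚ.+-identityʳ _)
+ℚ-coefficient (a ∷ p) (b ∷ q) zero    = refl
+ℚ-coefficient (a ∷ p) (b ∷ q) (suc n) = +ℚ-coefficient p q n

·ℚ-coefficient : ∀ a p n → ⟦ a ·ℚ p ⟧ n ≡ a ℚ.* ⟦ p ⟧ n
·ℚ-coefficient a []      n       = sym (ℚ.*-zeroʳ a)
·ℚ-coefficient a (b ∷ p) zero    = refl
·ℚ-coefficient a (b ∷ p) (suc n) = ·ℚ-coefficient a p n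

quotient-coefficient : ∀ a p x n → ⟦ quotient (a ∷ p) x ⟧ n ≡ ⟦ p ⟧ n ℚ.+ x ℚ.* ⟦ quotient p x ⟧ n
quotient-coefficient a p x n = trans (+ℚ-coefficient p (x ·ℚ quotient p x) n) (cong (⟦ p ⟧ n ℚ.+_) (·ℚ-coefficient x (quotient p x) n))

quotient-tail : ∀ a p x n → ⟦ quotient p x ⟧ n ≡ ⟦ quotient (a ∷ p) x ⟧ (suc n)
quotient-tail a []      x n = refl
quotient-tail a (b ∷ p) x n = sym (begin
  ⟦ quotient (a ∷ b ∷ p) x ⟧ (suc n)                   ≡⟨ quotient-coefficient a (b ∷ p) x (suc n) ⟩
  ⟦ p ⟧ n ℚ.+ x ℚ.* ⟦ quotient (b ∷ p) x ⟧ (suc n)     ≡⟨ cong (λ v → ⟦ p ⟧ n ℚ.+ x ℚ.* v) (quotient-tail b p x n) ⟨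
  ⟦ p ⟧ n ℚ.+ x ℚ.* ⟦ quotient p x ⟧ n                 ≡⟨ quotient-coefficient b p x n ⟨
  ⟦ quotient (b ∷ p) x ⟧ n                             ∎)
  where open ≡-Reasoning

-- A dividend with zero quotient equals its remainder, a constant.
quotient≈0⇒≈0 : ∀ a p x → ⟦ quotient (a ∷ p) x ⟧ ≈ 0# → ⟦ p ⟧ ≈ 0#
quotient≈0⇒≈0 a p x q≈0 n = begin
  ⟦ p ⟧ n                                    ≡⟨ ℚ.+-identityʳ _ ⟨
  ⟦ p ⟧ n ℚ.+ 0ℚ                             ≡⟨ cong (⟦ p ⟧ n ℚ.+_) (ℚ.*-zeroʳ x) ⟨
  ⟦ p ⟧ n ℚ.+ x ℚ.* 0ℚ                       ≡⟨ cong (λ v → ⟦ p ⟧ n ℚ.+ x ℚ.* v) (trans (quotient-tail a p x n) (q≈0 (suc n))) ⟨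
  ⟦ p ⟧ n ℚ.+ x ℚ.* ⟦ quotient p x ⟧ n       ≡⟨ quotient-coefficient a p x n ⟨
  ⟦ quotient (a ∷ p) x ⟧ n                   ≡⟨ q≈0 n ⟩
  0ℚ                                         ∎
  where open ≡-Reasoning

length-+ℚ : ∀ p q → List.length q ℕ.≤ List.length p → List.length (p +ℚ q) ≡ List.length p
length-+ℚ []      []      _           = refl
length-+ℚ (a ∷ p) []      _           = refl
length-+ℚ (a ∷ p) (b ∷ q) (ℕ.s≤s q≤p) = cong suc (length-+ℚ p q q≤p)

length-quotient : ∀ a p x → List.length (quotient (a ∷ p) x) ≡ List.length p
length-quotient a []      x = refl
length-quotient a (b ∷ p) x = length-+ℚ (b ∷ p) (x ·ℚ quotient (b ∷ p) x)
  (ℕ.≤-trans (ℕ.≤-reflexive (trans (List.length-map (x ℚ.*_) (quotient (b ∷ p) x)) (length-quotient b p x))) (ℕ.n≤1+n _))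

ℚ-domain : ∀ {p q} → p ≢ 0ℚ → p ℚ.* q ≡ 0ℚ → q ≡ 0ℚ
ℚ-domain {p} {q} p≢0 pq≡0 = begin
  q                       ≡⟨ ℚ.*-identityˡ q ⟨
  1ℚ ℚ.* q                ≡⟨ cong (ℚ._* q) (ℚ.*-inverseˡ p) ⟨
  (ℚ.1/ p ℚ.* p) ℚ.* q    ≡⟨ ℚ.*-assoc (ℚ.1/ p) p q ⟩
  ℚ.1/ p ℚ.* (p ℚ.* q)    ≡⟨ cong (ℚ.1/ p ℚ.*_) pq≡0 ⟩
  ℚ.1/ p ℚ.* 0ℚ           ≡⟨ ℚ.*-zeroʳ (ℚ.1/ p) ⟩
  0ℚ                      ∎
  where
  open ≡-Reasoning
  instance _ = ℚ.≢-nonZero p≢0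

module _ (x : ℕ → ℚ) (x-injective : ∀ {i j} → x i ≡ x j → i ≡ j) where

  -- Induction on the length: dividing out the root `x N` leaves a shorter quotient, which vanishes
  -- at all later points because `x` is injective. The bound `N` lets each point be discarded after
  -- use.
  vanishing⇒≈0 : ∀ p N → (∀ k → N ℕ.≤ k → value p (x k) ≡ 0ℚ) → ⟦ p ⟧ ≈ 0#
  vanishing⇒≈0 p = go (List.length p) p refl
    where
    go : ∀ ℓ p → List.length p ≡ ℓ → ∀ N → (∀ k → N ℕ.≤ k → value p (x k) ≡ 0ℚ) → ⟦ p ⟧ ≈ 0#
    go ℓ       []      _    N p≡0 n = refl
    go (suc ℓ) (a ∷ p) len N p≡0 = λ { zero → a≡0 ; (suc n) → p≈0 n }
      where
      open ≡-Reasoning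
      q = quotient (a ∷ p) (x N)
      q≡0 : ∀ k → suc N ℕ.≤ k → value q (x k) ≡ 0ℚ
      q≡0 k N<k = ℚ-domain {x k ℚ.- x N} (λ xk-xN≡0 → ℕ.<⇒≢ N<k (sym (x-injective (begin
          x k                             ≡⟨ ℚ-solve 2 (λ a b → a ⟨=⟩ a ⟨-⟩ b ⟨+⟩ b) refl (x k) (x N) ⟩
          (x k ℚ.- x N) ℚ.+ x N           ≡⟨ cong (ℚ._+ x N) xk-xN≡0 ⟩
          0ℚ ℚ.+ x N                      ≡⟨ ℚ.+-identityˡ (x N) ⟩
          x N                             ∎)))) (begin
        (x k ℚ.- x N) ℚ.* value q (x k)                           ≡⟨ ℚ.+-identityˡ _ ⟨
        0ℚ ℚ.+ (x k ℚ.- x N) ℚ.* value q (x k)                    ≡⟨ cong (ℚ._+ (x k ℚ.- x N) ℚ.* value q (x k)) (p≡0 N ℕ.≤-refl) ⟨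
        value (a ∷ p) (x N) ℚ.+ (x k ℚ.- x N) ℚ.* value q (x k)   ≡⟨ value-quotient (a ∷ p) (x N) (x k) ⟨
        value (a ∷ p) (x k)                                       ≡⟨ p≡0 k (ℕ.<⇒≤ N<k) ⟩
        0ℚ                                                        ∎)
      p≈0 : ⟦ p ⟧ ≈ 0#
      p≈0 = quotient≈0⇒≈0 a p (x N) (go ℓ q (trans (length-quotient a p (x N)) (ℕ.suc-injective len)) (suc N) q≡0)
      a≡0 : a ≡ 0ℚ
      a≡0 = begin
        a                           ≡⟨ ℚ.+-identityʳ a ⟨
        a ℚ.+ 0ℚ                    ≡⟨ cong (a ℚ.+_) (trans (cong (x N ℚ.*_) (value-zero p (x N) p≈0)) (ℚ.*-zeroʳ (x N))) ⟨
        value (a ∷ p) (x N)         ≡⟨ p≡0 N ℕ.≤-refl ⟩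
        0ℚ                          ∎

square-positive : ∀ {s} → s ≢ 0ℚ → ℚ.Positive (s ℚ.* s)
square-positive {s@(ℚ.mkℚ (+ zero) _ _)}  s≢0 = ⊥-elim (s≢0 (ℚ.↥p≡0⇒p≡0 s refl))
square-positive {s@(ℚ.mkℚ (+ suc _) _ _)} s≢0 = ℚ.pos*pos⇒pos s s
square-positive {s@(ℚ.mkℚ -[1+ _ ] _ _)}  s≢0 = ℚ.neg*neg⇒pos s s

square-nonNegative : ∀ s → ℚ.NonNegative (s ℚ.* s)
square-nonNegative s with s ℚ.≟ 0ℚ
... | yes refl = _
... | no s≢0   = ℚ.pos⇒nonNeg (s ℚ.* s) {{square-positive s≢0}}

positive≢0 : ∀ {s} → ℚ.Positive s → s ≢ 0ℚ
positive≢0 () refl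

definite : ∀ m .{{_ : ℚ.Positive m}} s t → s ℚ.* s ℚ.+ m ℚ.* (t ℚ.* t) ≡ 0ℚ → s ≡ 0ℚ × t ≡ 0ℚ
definite m s t eq with s ℚ.≟ 0ℚ | t ℚ.≟ 0ℚ
... | yes s≡0  | yes t≡0 = s≡0 , t≡0
... | yes refl | no t≢0  = ⊥-elim (positive≢0 {m ℚ.* (t ℚ.* t)} (ℚ.pos*pos⇒pos m (t ℚ.* t) {{square-positive t≢0}})
        (trans (sym (ℚ.+-identityˡ (m ℚ.* (t ℚ.* t)))) eq))
... | no s≢0   | _       = ⊥-elim (positive≢0 (subst ℚ.Positive (ℚ.+-comm (m ℚ.* (t ℚ.* t)) (s ℚ.* s))
        (ℚ.nonNeg+pos⇒pos (m ℚ.* (t ℚ.* t)) {{mt²≥0}} (s ℚ.* s) {{square-positive s≢0}})) eq)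
  where
  mt²≥0 = ℚ.nonNeg*nonNeg⇒nonNeg m {{ℚ.pos⇒nonNeg m}} (t ℚ.* t) {{square-nonNegative t}}

-- Linear independence of 1, A, B, AB over ℚ(z)

IsPolynomial : PowerSeries → Set
IsPolynomial f = ∃ λ p → f ≈ ⟦ p ⟧

opaque
  unfolding _⊞_ _⊠_ ⊟_ ⌜_⌝

  ⌜⌝-isPolynomial : ∀ p → IsPolynomial ⌜ p ⌝
  ⌜⌝-isPolynomial p = List.map ι p , λ _ → refl

  ⊞-isPolynomial : ∀ {f g} → IsPolynomial f → IsPolynomial g → IsPolynomial (f ⊞ g)
  ⊞-isPolynomial (p , f≈p) (q , g≈q) = p +ℚ q , λ n → trans (cong₂ ℚ._+_ (f≈p n) (g≈q n)) (sym (+ℚ-coefficient p q n))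

  *ℚ-homo : ∀ p q → ⟦ p *ℚ q ⟧ ≋ ⟦ p ⟧ ⊠ ⟦ q ⟧
  *ℚ-homo p q = pointwise λ n → trans (cong (λ r → ⟦ r ⟧ n) (sym (List.map-id (p *ℚ q))))
    (trans (coefficients≡ (ℚ[z]-Homomorphism.*ᴾ-homo p q) n)
           (cong₂ (λ r s → (⟦ r ⟧ ⊛ ⟦ s ⟧) n) (List.map-id p) (List.map-id q)))

  ⊠-isPolynomial : ∀ {f g} → IsPolynomial f → IsPolynomial g → IsPolynomial (f ⊠ g)
  ⊠-isPolynomial (p , f≈p) (q , g≈q) = p *ℚ q , coefficients≡
    (≋-trans (⊠-cong (pointwise f≈p) (pointwise g≈q)) (≋-sym (*ℚ-homo p q)))

  ⊟-isPolynomial : ∀ {f} → IsPolynomial f → IsPolynomial (⊟ f)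
  ⊟-isPolynomial (p , f≈p) = ℚ.- 1ℚ ·ℚ p , λ n → trans (cong ℚ.-_ (f≈p n))
    (trans (trans (cong ℚ.-_ (sym (ℚ.*-identityˡ (⟦ p ⟧ n)))) (ℚ.neg-distribˡ-* 1ℚ (⟦ p ⟧ n))) (sym (·ℚ-coefficient (ℚ.- 1ℚ) p n)))

  ⌜⌝-coefficient : ∀ p n → ⌜ p ⌝ n ≡ ⟦ List.map ι p ⟧ n
  ⌜⌝-coefficient p n = refl

valueℤ : List ℤ → ℤ → ℤ
valueℤ []      x = + 0
valueℤ (a ∷ p) x = a ℤ.+ x ℤ.* valueℤ p x

ι-valueℤ : ∀ p x → value (List.map ι p) (ι x) ≡ ι (valueℤ p x)
ι-valueℤ []      x = refl
ι-valueℤ (a ∷ p) x = begin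
  ι a ℚ.+ ι x ℚ.* value (List.map ι p) (ι x)    ≡⟨ cong (λ v → ι a ℚ.+ ι x ℚ.* v) (ι-valueℤ p x) ⟩
  ι a ℚ.+ ι x ℚ.* ι (valueℤ p x)                ≡⟨ cong (ι a ℚ.+_) (ι-* x (valueℤ p x)) ⟨
  ι a ℚ.+ ι (x ℤ.* valueℤ p x)                  ≡⟨ ι-+ a (x ℤ.* valueℤ p x) ⟨
  ι (valueℤ (a ∷ p) x)                          ∎
  where open ≡-Reasoning

ι-positive : ∀ n → ℚ.Positive (ι (+ suc n))
ι-positive n = ℚ.normalize-pos (suc n) 1

-- A polynomial with infinitely many negative values is not a square in ℚ(z).
record NonSquare (γ : List ℤ) : Set where
  field
    point     : ℕ → ℤ
    injective : ∀ {i j} → point i ≡ point j → i ≡ j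
    negative  : ∀ k → ∃ λ m → valueℤ γ (point k) ≡ -[1+ m ]

-- At a point where γ has the value -(m + 1), the values P and R of f and g satisfy P² + (m + 1)R² =
-- 0, so both are zero. Infinitely many such points annihilate both polynomials.
nonSquare : ∀ {γ f g} → NonSquare γ → IsPolynomial f → IsPolynomial g → f ⊠ f ≋ ⌜ γ ⌝ ⊠ (g ⊠ g) → f ≋ 𝟘 × g ≋ 𝟘
nonSquare {γ} {f} {g} γ-nonSquare (p , f≈p) (q , g≈q) f²≋γg² =
  vanish p f≈p (λ k → proj₁ (roots k)) , vanish q g≈q (λ k → proj₂ (roots k))
  where
  open NonSquare γ-nonSquare
  open ≡-Reasoning
  x : ℕ → ℚ
  x k = ι (point k)
  difference : Polynomial
  difference = p *ℚ p +ℚ (ι (- (+ 1)) ·ℚ (List.map ι γ *ℚ (q *ℚ q)))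
  square≋ : ⟦ p *ℚ p ⟧ ≋ ⟦ List.map ι γ *ℚ (q *ℚ q) ⟧
  square≋ = ≋-trans (*ℚ-homo p p) (≋-trans (≋-sym (⊠-cong (pointwise f≈p) (pointwise f≈p)))
    (≋-trans f²≋γg² (≋-trans (⊠-cong {x = ⌜ γ ⌝} (pointwise (⌜⌝-coefficient γ)) (⊠-cong (pointwise g≈q) (pointwise g≈q)))
      (≋-sym (≋-trans (*ℚ-homo (List.map ι γ) (q *ℚ q)) (⊠-congˡ (*ℚ-homo q q)))))))
  difference≈0 : ⟦ difference ⟧ ≈ 0#
  difference≈0 n = begin
    ⟦ difference ⟧ n
      ≡⟨ trans (+ℚ-coefficient (p *ℚ p) _ n)
           (cong₂ ℚ._+_ (coefficients≡ square≋ n) (·ℚ-coefficient (ι (- (+ 1))) (List.map ι γ *ℚ (q *ℚ q)) n)) ⟩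
    u ℚ.+ ι (- (+ 1)) ℚ.* u     ≡⟨ ℚ-solve 1 (λ c → c ⟨+⟩ ℚ-con (ι (- (+ 1))) ⟨*⟩ c ⟨=⟩ ℚ-con 0ℚ) refl u ⟩
    0ℚ                          ∎
    where u = ⟦ List.map ι γ *ℚ (q *ℚ q) ⟧ n
  roots : ∀ k → value p (x k) ≡ 0ℚ × value q (x k) ≡ 0ℚ
  roots k with negative k
  ... | m , γ≡ = definite (ι (+ suc m)) {{ι-positive m}} P R (begin
    P ℚ.* P ℚ.+ ι (+ suc m) ℚ.* (R ℚ.* R)
      ≡⟨ ℚ-solve 3 (λ p m r → p ⟨*⟩ p ⟨+⟩ m ⟨*⟩ (r ⟨*⟩ r) ⟨=⟩
           p ⟨*⟩ p ⟨+⟩ ℚ-con (ι (- (+ 1))) ⟨*⟩ (ℚ-con (ι (- (+ 1))) ⟨*⟩ m ⟨*⟩ (r ⟨*⟩ r)))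
           refl P (ι (+ suc m)) R ⟩
    P ℚ.* P ℚ.+ ι (- (+ 1)) ℚ.* (ι (- (+ 1)) ℚ.* ι (+ suc m) ℚ.* (R ℚ.* R))
      ≡⟨ cong (λ v → P ℚ.* P ℚ.+ ι (- (+ 1)) ℚ.* (v ℚ.* (R ℚ.* R))) γ≡′ ⟨
    P ℚ.* P ℚ.+ ι (- (+ 1)) ℚ.* (value (List.map ι γ) (x k) ℚ.* (R ℚ.* R))
      ≡⟨ cong₂ ℚ._+_ (value-* p p (x k)) (trans (value-· (ι (- (+ 1))) (List.map ι γ *ℚ (q *ℚ q)) (x k))
           (cong (ι (- (+ 1)) ℚ.*_) (trans (value-* (List.map ι γ) (q *ℚ q) (x k)) (cong (value (List.map ι γ) (x k) ℚ.*_) (value-* q q (x k)))))) ⟨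
    value (p *ℚ p) (x k) ℚ.+ value (ι (- (+ 1)) ·ℚ (List.map ι γ *ℚ (q *ℚ q))) (x k)
      ≡⟨ value-+ (p *ℚ p) (ι (- (+ 1)) ·ℚ (List.map ι γ *ℚ (q *ℚ q))) (x k) ⟨
    value difference (x k)
      ≡⟨ value-zero difference (x k) difference≈0 ⟩
    0ℚ ∎)
    where
    P = value p (x k)
    R = value q (x k)
    γ≡′ : value (List.map ι γ) (x k) ≡ ι (- (+ 1)) ℚ.* ι (+ suc m)
    γ≡′ = trans (ι-valueℤ γ (point k)) (trans (cong ι (trans γ≡ (sym (ℤ.-1*i≡-i (+ suc m))))) (ι-* (- (+ 1)) (+ suc m)))
  vanish : ∀ {h} r → h ≈ ⟦ r ⟧ → (∀ k → value r (x k) ≡ 0ℚ) → h ≋ 𝟘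
  vanish r h≈r root = pointwise λ n → trans (h≈r n)
    (trans (vanishing⇒≈0 x (λ eq → injective (ι-injective eq)) r 0 (λ k _ → root k) n) (sym (𝟘-coefficient n)))

αβ : List ℤ
αβ = α *ᵗ β

positives negatives : ℕ → ℤ
positives k = + 1 ℤ.+ + k
negatives k = - (+ 1 ℤ.+ + k)

α-nonSquare : NonSquare α
α-nonSquare = record
  { point = positives ; injective = λ { refl → refl }
  ; negative = λ k → 2 ℕ.+ 4 ℕ.* k , trans (identity (+ k)) (cong (λ i → - (+ 3 ℤ.+ i)) (sym (ℤ.pos-* 4 k))) }
  where
  identity : ∀ k → + 1 ℤ.+ (+ 1 ℤ.+ k) ℤ.* (- (+ 4) ℤ.+ (+ 1 ℤ.+ k) ℤ.* + 0) ≡ - (+ 3 ℤ.+ + 4 ℤ.* k)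
  identity = ℤ-Solver.solve-∀

β-nonSquare : NonSquare β
β-nonSquare = record
  { point = positives ; injective = λ { refl → refl }
  ; negative = λ k → 14 ℕ.+ (28 ℕ.+ 12 ℕ.* k) ℕ.* k , trans (identity (+ k)) (cong (λ i → - (+ 15 ℤ.+ i))
      (sym (trans (ℤ.pos-* (28 ℕ.+ 12 ℕ.* k) k) (cong (λ i → (+ 28 ℤ.+ i) ℤ.* + k) (ℤ.pos-* 12 k))))) }
  where
  identity : ∀ k → + 1 ℤ.+ (+ 1 ℤ.+ k) ℤ.* (- (+ 4) ℤ.+ (+ 1 ℤ.+ k) ℤ.* (- (+ 12) ℤ.+ (+ 1 ℤ.+ k) ℤ.* + 0)) ≡
                   - (+ 15 ℤ.+ (+ 28 ℤ.+ + 12 ℤ.* k) ℤ.* k)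
  identity = ℤ-Solver.solve-∀

-- At positive integers α and β are both negative and their product is positive. At negative
-- integers 1 + 2z is the only negative factor among 1 - 4z, 1 - 6z and 1 + 2z.
αβ-nonSquare : NonSquare αβ
αβ-nonSquare = record
  { point = negatives ; injective = λ { refl → refl }
  ; negative = λ k → 34 ℕ.+ (128 ℕ.+ (140 ℕ.+ 48 ℕ.* k) ℕ.* k) ℕ.* k , trans (identity (+ k)) (cong (λ i → - (+ 35 ℤ.+ i))
      (sym (trans (ℤ.pos-* (128 ℕ.+ (140 ℕ.+ 48 ℕ.* k) ℕ.* k) k) (cong (λ i → (+ 128 ℤ.+ i) ℤ.* + k)
        (trans (ℤ.pos-* (140 ℕ.+ 48 ℕ.* k) k) (cong (λ i → (+ 140 ℤ.+ i) ℤ.* + k) (ℤ.pos-* 48 k))))))) }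
  where
  identity : ∀ k → + 1 ℤ.+ (- (+ 1 ℤ.+ k)) ℤ.* (- (+ 8) ℤ.+ (- (+ 1 ℤ.+ k)) ℤ.* (+ 4 ℤ.+ (- (+ 1 ℤ.+ k)) ℤ.* (+ 48 ℤ.+ (- (+ 1 ℤ.+ k)) ℤ.* + 0))) ≡
                   - (+ 35 ℤ.+ (+ 128 ℤ.+ (+ 140 ℤ.+ + 48 ℤ.* k) ℤ.* k) ℤ.* k)
  identity = ℤ-Solver.solve-∀

⊟≋𝟘⇒≋ : ∀ {f g} → f ⊞ ⊟ g ≋ 𝟘 → f ≋ g
⊟≋𝟘⇒≋ {f} {g} f-g≋𝟘 = begin
  f                   ≈⟨ solve 2 (λ f g → f := f :- g :+ g) ≋-refl f g ⟩
  f ⊞ ⊟ g ⊞ g         ≈⟨ ⊞-congʳ f-g≋𝟘 ⟩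
  𝟘 ⊞ g               ≈⟨ ⊞-identityˡ g ⟩
  g                   ∎
  where open ≋-Reasoning

≋𝟘-stable : ∀ {f} → ¬ ¬ f ≋ 𝟘 → f ≋ 𝟘
≋𝟘-stable {f} ¬¬f≋𝟘 = pointwise λ n → decidable-stable (f n ℚ.≟ 𝟘 n) λ fn≢0 →
  ¬¬f≋𝟘 λ f≋𝟘 → fn≢0 (coefficients≡ f≋𝟘 n)

-- Multiplying by the conjugate a - bA gives a² = αb².
A-independent : ∀ {a b} → IsPolynomial a → IsPolynomial b → a ⊞ b ⊠ A ≋ 𝟘 → a ≋ 𝟘 × b ≋ 𝟘
A-independent {a} {b} a-poly b-poly a+bA≋𝟘 = nonSquare α-nonSquare a-poly b-poly
  (≋-modulo {h = b ⊠ b} A² (≋-modulo {h = a ⊞ ⊟ (b ⊠ A)} a+bA≋𝟘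
    (solve 4 (λ a b r s → a :* a := s :* (b :* b) :+ b :* b :* (r :* r :- s) :+ (a :- b :* r) :* (a :+ b :* r :- con []))
      ≋-refl a b A ⌜ α ⌝)))

-- Multiplying by the conjugate in B gives (a + bA)² = β(c + dA)², and the coordinates over 1 and A
-- give `norms` and `ab≋βcd`. Eliminating a from these two leaves a vanishing product, `factors`.
-- Which factor vanishes cannot be decided, hence the double negation.
AB-independent : ∀ {a b c d} → IsPolynomial a → IsPolynomial b → IsPolynomial c → IsPolynomial d →
  a ⊞ b ⊠ A ⊞ (c ⊞ d ⊠ A) ⊠ B ≋ 𝟘 → ¬ ¬ (a ≋ 𝟘 × b ≋ 𝟘 × c ≋ 𝟘 × d ≋ 𝟘)
AB-independent {a} {b} {c} {d} a-poly b-poly c-poly d-poly relation ¬zero = ¬zero (conclude₂ αb²≋βc²)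
  where
  open ≋-Reasoning
  αˢ = ⌜ α ⌝
  βˢ = ⌜ β ⌝
  conjugates : (a ⊠ a ⊞ αˢ ⊠ (b ⊠ b) ⊞ ⊟ (βˢ ⊠ (c ⊠ c ⊞ αˢ ⊠ (d ⊠ d)))) ⊞ ⌜ + 2 ∷ [] ⌝ ⊠ (a ⊠ b ⊞ ⊟ (βˢ ⊠ (c ⊠ d))) ⊠ A ≋ 𝟘
  conjugates = ≋-modulo {h = a ⊞ b ⊠ A ⊞ ⊟ ((c ⊞ d ⊠ A) ⊠ B)} relation
    (≋-modulo {h = (c ⊞ d ⊠ A) ⊠ (c ⊞ d ⊠ A)} B² (≋-modulo {h = ⊟ (b ⊠ b) ⊞ βˢ ⊠ (d ⊠ d)} A²
      (solve 8 (λ a b c d r s α β →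
        (a :* a :+ α :* (b :* b) :- β :* (c :* c :+ α :* (d :* d))) :+ con (+ 2 ∷ []) :* (a :* b :- β :* (c :* d)) :* r :=
        con [] :+ (a :+ b :* r :- (c :+ d :* r) :* s) :* (a :+ b :* r :+ (c :+ d :* r) :* s :- con []) :+
        (c :+ d :* r) :* (c :+ d :* r) :* (s :* s :- β) :+ (:- (b :* b) :+ β :* (d :* d)) :* (r :* r :- α))
        ≋-refl a b c d A B αˢ βˢ)))
  coordinates = A-independent
    (⊞-isPolynomial (⊞-isPolynomial (⊠-isPolynomial a-poly a-poly) (⊠-isPolynomial (⌜⌝-isPolynomial α) (⊠-isPolynomial b-poly b-poly)))
      (⊟-isPolynomial (⊠-isPolynomial (⌜⌝-isPolynomial β) (⊞-isPolynomial (⊠-isPolynomial c-poly c-poly)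
        (⊠-isPolynomial (⌜⌝-isPolynomial α) (⊠-isPolynomial d-poly d-poly))))))
    (⊠-isPolynomial (⌜⌝-isPolynomial (+ 2 ∷ [])) (⊞-isPolynomial (⊠-isPolynomial a-poly b-poly)
      (⊟-isPolynomial (⊠-isPolynomial (⌜⌝-isPolynomial β) (⊠-isPolynomial c-poly d-poly)))))
    conjugates
  norms : a ⊠ a ⊞ αˢ ⊠ (b ⊠ b) ≋ βˢ ⊠ (c ⊠ c ⊞ αˢ ⊠ (d ⊠ d))
  norms = ⊟≋𝟘⇒≋ (proj₁ coordinates)
  ab≋βcd : a ⊠ b ≋ βˢ ⊠ (c ⊠ d)
  ab≋βcd = ⊟≋𝟘⇒≋ (⊠-cancel two≉𝟘 (proj₂ coordinates))
  factors : (b ⊠ b ⊞ ⊟ (βˢ ⊠ (d ⊠ d))) ⊠ (αˢ ⊠ (b ⊠ b) ⊞ ⊟ (βˢ ⊠ (c ⊠ c))) ≋ 𝟘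
  factors = ≋-modulo {h = b ⊠ b} norms (≋-modulo {h = ⊟ (a ⊠ b ⊞ βˢ ⊠ (c ⊠ d))} ab≋βcd
    (solve 6 (λ a b c d α β →
      (b :* b :- β :* (d :* d)) :* (α :* (b :* b) :- β :* (c :* c)) :=
      con [] :+ b :* b :* (a :* a :+ α :* (b :* b) :- β :* (c :* c :+ α :* (d :* d))) :+
      :- (a :* b :+ β :* (c :* d)) :* (a :* b :- β :* (c :* d))) ≋-refl a b c d αˢ βˢ))
  Zero = a ≋ 𝟘 × b ≋ 𝟘 × c ≋ 𝟘 × d ≋ 𝟘
  conclude₁ : b ⊠ b ≋ βˢ ⊠ (d ⊠ d) → Zero
  conclude₁ b²≋βd² = proj₁ ac , proj₁ bd , proj₂ ac , proj₂ bd
    where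
    bd = nonSquare β-nonSquare b-poly d-poly b²≋βd²
    ac = nonSquare β-nonSquare a-poly c-poly (≋-modulo {h = 𝟙} norms
      (≋-modulo {h = ⊟ (αˢ ⊠ b)} (proj₁ bd) (≋-modulo {h = βˢ ⊠ αˢ ⊠ d} (proj₂ bd)
        (solve 6 (λ a b c d α β → a :* a := β :* (c :* c) :+ one′ :* (a :* a :+ α :* (b :* b) :- β :* (c :* c :+ α :* (d :* d))) :+
          :- (α :* b) :* (b :- con []) :+ β :* α :* d :* (d :- con [])) ≋-refl a b c d αˢ βˢ))))
  αb²≋βc² : αˢ ⊠ (b ⊠ b) ≋ βˢ ⊠ (c ⊠ c)
  -- Under `¬zero` the first factor is nonzero, by `conclude₁`, and can be cancelled.
  αb²≋βc² = ⊟≋𝟘⇒≋ (⊠-cancel (λ eq → ¬zero (conclude₁ (⊟≋𝟘⇒≋ eq))) factors)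
  conclude₂ : αˢ ⊠ (b ⊠ b) ≋ βˢ ⊠ (c ⊠ c) → Zero
  conclude₂ αb²≋βc² = proj₁ ad , b≋𝟘 , proj₂ bc , proj₂ ad
    where
    -- Multiplied by α the equation becomes (αb)² = αβ c².
    bc = nonSquare αβ-nonSquare (⊠-isPolynomial (⌜⌝-isPolynomial α) b-poly) c-poly
      (≋-modulo {h = αˢ} αb²≋βc² (solve 2 (λ b c → con α :* b :* (con α :* b) :=
        con αβ :* (c :* c) :+ con α :* (con α :* (b :* b) :- con β :* (c :* c))) ≋-refl b c))
    b≋𝟘 = ⊠-cancel α≉𝟘 (proj₁ bc)
    ad = nonSquare αβ-nonSquare a-poly d-poly (≋-modulo {h = 𝟙} norms
      (≋-modulo {h = ⊟ (αˢ ⊠ b)} b≋𝟘 (≋-modulo {h = βˢ ⊠ c} (proj₂ bc)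
        (solve 4 (λ a b c d → a :* a := con αβ :* (d :* d) :+
          one′ :* (a :* a :+ con α :* (b :* b) :- con β :* (c :* c :+ con α :* (d :* d))) :+
          :- (con α :* b) :* (b :- con []) :+ con β :* c :* (c :- con [])) ≋-refl a b c d))))

-- Independence of 1, G, G², G³ and the degree over ℚ(z)

horner : ∀ {m} → Vec PowerSeries m → PowerSeries → PowerSeries
horner []       F = 𝟘
horner (p ∷ ps) F = p ⊞ F ⊠ horner ps F

Matrix : Set
Matrix = Vec (Vec (List ℤ) 4) 4

entry : Matrix → Fin 4 → Fin 4 → List ℤ
entry M i j = lookup (lookup M i) j

-- Row k holds the coordinates of denominator³ Gᵏ with respect to 1, A, B, AB.
powers : Matrix
powers =
    ((- (+ 16) ∷ + 192 ∷ - (+ 672) ∷ + 256 ∷ + 1776 ∷ - (+ 576) ∷ - (+ 1376) ∷ + 0 ∷ - (+ 1152) ∷ - (+ 512) ∷ []) ∷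
     (+ 16 ∷ - (+ 160) ∷ + 384 ∷ + 256 ∷ - (+ 976) ∷ - (+ 480) ∷ + 192 ∷ - (+ 384) ∷ []) ∷
     (+ 16 ∷ - (+ 160) ∷ + 480 ∷ - (+ 320) ∷ - (+ 112) ∷ - (+ 672) ∷ + 160 ∷ + 320 ∷ []) ∷
     (- (+ 16) ∷ + 128 ∷ - (+ 256) ∷ + 0 ∷ - (+ 48) ∷ + 384 ∷ + 192 ∷ []) ∷ []) ∷
    ((- (+ 16) ∷ + 208 ∷ - (+ 832) ∷ + 624 ∷ + 2256 ∷ - (+ 2288) ∷ - (+ 1152) ∷ - (+ 704) ∷ - (+ 512) ∷ []) ∷
     (+ 16 ∷ - (+ 176) ∷ + 512 ∷ + 112 ∷ - (+ 1552) ∷ + 144 ∷ + 320 ∷ + 320 ∷ + 256 ∷ []) ∷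
     (+ 16 ∷ - (+ 176) ∷ + 608 ∷ - (+ 560) ∷ - (+ 304) ∷ - (+ 240) ∷ + 544 ∷ + 128 ∷ []) ∷
     (- (+ 16) ∷ + 144 ∷ - (+ 352) ∷ + 80 ∷ + 176 ∷ + 336 ∷ - (+ 32) ∷ []) ∷ []) ∷
    ((- (+ 16) ∷ + 224 ∷ - (+ 1008) ∷ + 1120 ∷ + 2608 ∷ - (+ 4768) ∷ - (+ 192) ∷ - (+ 128) ∷ + 512 ∷ []) ∷
     (+ 16 ∷ - (+ 192) ∷ + 656 ∷ - (+ 128) ∷ - (+ 2160) ∷ + 1344 ∷ + 576 ∷ + 512 ∷ []) ∷
     (+ 16 ∷ - (+ 192) ∷ + 752 ∷ - (+ 896) ∷ - (+ 432) ∷ + 576 ∷ + 448 ∷ []) ∷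
     (- (+ 16) ∷ + 160 ∷ - (+ 464) ∷ + 224 ∷ + 432 ∷ + 32 ∷ - (+ 128) ∷ []) ∷ []) ∷
    ((- (+ 16) ∷ + 240 ∷ - (+ 1200) ∷ + 1760 ∷ + 2736 ∷ - (+ 8064) ∷ + 2368 ∷ + 1536 ∷ []) ∷
     (+ 16 ∷ - (+ 208) ∷ + 816 ∷ - (+ 480) ∷ - (+ 2736) ∷ + 3264 ∷ + 448 ∷ - (+ 256) ∷ []) ∷
     (+ 16 ∷ - (+ 208) ∷ + 912 ∷ - (+ 1344) ∷ - (+ 432) ∷ + 1824 ∷ - (+ 384) ∷ []) ∷
     (- (+ 16) ∷ + 176 ∷ - (+ 592) ∷ + 448 ∷ + 688 ∷ - (+ 608) ∷ []) ∷ []) ∷ []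

-- Row j is, up to a common factor, row j of the adjugate of powersᵀ, so that cofactors · powersᵀ is the
-- diagonal matrix of determinants.
cofactors : Matrix
cofactors =
    ((+ 1 ∷ - (+ 12) ∷ + 28 ∷ - (+ 8) ∷ []) ∷
     (+ 1 ∷ - (+ 14) ∷ + 50 ∷ - (+ 44) ∷ []) ∷
     (+ 1 ∷ + 2 ∷ - (+ 20) ∷ - (+ 16) ∷ + 48 ∷ []) ∷
     (+ 1 ∷ + 0 ∷ - (+ 26) ∷ + 16 ∷ + 104 ∷ - (+ 32) ∷ []) ∷ []) ∷
    ((+ 3 ∷ - (+ 49) ∷ + 177 ∷ - (+ 156) ∷ - (+ 20) ∷ []) ∷
     (+ 3 ∷ - (+ 55) ∷ + 269 ∷ - (+ 424) ∷ + 108 ∷ + 48 ∷ []) ∷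
     (+ 3 ∷ + 9 ∷ - (+ 117) ∷ + 42 ∷ + 460 ∷ - (+ 248) ∷ - (+ 32) ∷ []) ∷
     (+ 3 ∷ + 3 ∷ - (+ 141) ∷ + 246 ∷ + 548 ∷ - (+ 968) ∷ []) ∷ []) ∷
    ((- (+ 2) ∷ + 52 ∷ - (+ 199) ∷ + 136 ∷ + 76 ∷ []) ∷
     (- (+ 2) ∷ + 56 ∷ - (+ 299) ∷ + 438 ∷ + 12 ∷ - (+ 88) ∷ []) ∷
     (- (+ 2) ∷ - (+ 24) ∷ + 161 ∷ + 38 ∷ - (+ 716) ∷ + 104 ∷ + 160 ∷ []) ∷
     (- (+ 2) ∷ - (+ 20) ∷ + 213 ∷ - (+ 228) ∷ - (+ 1000) ∷ + 1120 ∷ + 464 ∷ - (+ 64) ∷ []) ∷ []) ∷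
    ((- (+ 18) ∷ + 75 ∷ - (+ 33) ∷ - (+ 40) ∷ - (+ 20) ∷ []) ∷
     (- (+ 18) ∷ + 111 ∷ - (+ 147) ∷ - (+ 52) ∷ + 4 ∷ + 16 ∷ []) ∷
     (+ 14 ∷ - (+ 65) ∷ - (+ 55) ∷ + 306 ∷ + 84 ∷ - (+ 24) ∷ - (+ 32) ∷ []) ∷
     (+ 14 ∷ - (+ 93) ∷ + 47 ∷ + 490 ∷ - (+ 300) ∷ - (+ 312) ∷ - (+ 128) ∷ []) ∷ []) ∷ []

determinants : Vec (List ℤ) 4
determinants =
    (+ 0 ∷ + 0 ∷ + 0 ∷ + 0 ∷ + 0 ∷ + 0 ∷ + 0 ∷ + 0 ∷ + 0 ∷ + 0 ∷ + 1024 ∷ + 4096 ∷ + 4096 ∷ []) ∷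
    (+ 0 ∷ + 0 ∷ + 0 ∷ + 0 ∷ + 0 ∷ + 0 ∷ + 0 ∷ + 0 ∷ + 0 ∷ + 0 ∷ - (+ 1024) ∷ - (+ 2048) ∷ + 4096 ∷ + 8192 ∷ []) ∷
    (+ 0 ∷ + 0 ∷ + 0 ∷ + 0 ∷ + 0 ∷ + 0 ∷ + 0 ∷ + 0 ∷ + 0 ∷ + 0 ∷ - (+ 1024) ∷ - (+ 2048) ∷ + 4096 ∷ + 8192 ∷ []) ∷
    (+ 0 ∷ + 0 ∷ + 0 ∷ + 0 ∷ + 0 ∷ + 0 ∷ + 0 ∷ + 0 ∷ + 0 ∷ - (+ 1024) ∷ - (+ 2048) ∷ + 4096 ∷ + 8192 ∷ []) ∷ []

pow cof : Fin 4 → Fin 4 → List ℤ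
pow = entry powers
cof = entry cofactors

powers-correct : ∀ k → ⟦ homogenized (3 ℕ.∸ toℕ k) (toℕ k) ⟧ᴱ ≋
  ⌜ pow k 0F ⌝ ⊞ ⌜ pow k 1F ⌝ ⊠ A ⊞ (⌜ pow k 2F ⌝ ⊞ ⌜ pow k 3F ⌝ ⊠ A) ⊠ B
powers-correct k = ≋-trans (≋-reflexive (cong ⟦_⟧ᴱ (computed k))) (⟦⟧ᴱ-coordinates (pow k 0F) (pow k 1F) (pow k 2F) (pow k 3F))
  where
  computed : ∀ k → homogenized (3 ℕ.∸ toℕ k) (toℕ k) ≡ ((pow k 0F , pow k 1F) , (pow k 2F , pow k 3F))
  computed 0F = refl
  computed 1F = refl
  computed 2F = refl
  computed 3F = refl

opaque
  unfolding ⌜_⌝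

  determinants≉𝟘 : ∀ j → ⌜ lookup determinants j ⌝ ≉𝟘
  determinants≉𝟘 0F = coefficient≢0⇒≉𝟘 10 λ ()
  determinants≉𝟘 1F = coefficient≢0⇒≉𝟘 10 λ ()
  determinants≉𝟘 2F = coefficient≢0⇒≉𝟘 10 λ ()
  determinants≉𝟘 3F = coefficient≢0⇒≉𝟘 9 λ ()

module _ {p₀ p₁ p₂ p₃ : PowerSeries} where

  private
    cubic = horner (p₀ ∷ p₁ ∷ p₂ ∷ p₃ ∷ []) G

    coordinate : Fin 4 → PowerSeries
    coordinate i = p₀ ⊠ ⌜ pow 0F i ⌝ ⊞ p₁ ⊠ ⌜ pow 1F i ⌝ ⊞ p₂ ⊠ ⌜ pow 2F i ⌝ ⊞ p₃ ⊠ ⌜ pow 3F i ⌝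

  cubic-coordinates : ⟦ denominator ⟧ᴱ ↑ 3 ⊠ cubic ≋ coordinate 0F ⊞ coordinate 1F ⊠ A ⊞ (coordinate 2F ⊞ coordinate 3F ⊠ A) ⊠ B
  cubic-coordinates = begin
    D ⊠ cubic
      ≈⟨ solve 6 (λ d g p₀ p₁ p₂ p₃ → d :* (p₀ :+ g :* (p₁ :+ g :* (p₂ :+ g :* (p₃ :+ g :* con [])))) :=
           p₀ :* (d :* one′) :+ p₁ :* (d :* (g :* one′)) :+ p₂ :* (d :* (g :* (g :* one′))) :+ p₃ :* (d :* (g :* (g :* (g :* one′)))))
           ≋-refl D G p₀ p₁ p₂ p₃ ⟩
    p₀ ⊠ (D ⊠ G ↑ 0) ⊞ p₁ ⊠ (D ⊠ G ↑ 1) ⊞ p₂ ⊠ (D ⊠ G ↑ 2) ⊞ p₃ ⊠ (D ⊠ G ↑ 3)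
      ≈⟨ ⊞-cong (⊞-cong (⊞-cong (⊠-congˡ (power 0F 3 0 refl refl)) (⊠-congˡ (power 1F 2 1 refl refl)))
           (⊠-congˡ (power 2F 1 2 refl refl))) (⊠-congˡ (power 3F 0 3 refl refl)) ⟩
    p₀ ⊠ basis 0F ⊞ p₁ ⊠ basis 1F ⊞ p₂ ⊠ basis 2F ⊞ p₃ ⊠ basis 3F
      ≈⟨ solve 6 (λ p₀ p₁ p₂ p₃ a b →
           let basis′ = λ k → con (pow k 0F) :+ con (pow k 1F) :* a :+ (con (pow k 2F) :+ con (pow k 3F) :* a) :* b
               coordinate′ = λ i → p₀ :* con (pow 0F i) :+ p₁ :* con (pow 1F i) :+ p₂ :* con (pow 2F i) :+ p₃ :* con (pow 3F i)
           in p₀ :* basis′ 0F :+ p₁ :* basis′ 1F :+ p₂ :* basis′ 2F :+ p₃ :* basis′ 3F :=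
              coordinate′ 0F :+ coordinate′ 1F :* a :+ (coordinate′ 2F :+ coordinate′ 3F :* a) :* b) ≋-refl p₀ p₁ p₂ p₃ A B ⟩
    coordinate 0F ⊞ coordinate 1F ⊠ A ⊞ (coordinate 2F ⊞ coordinate 3F ⊠ A) ⊠ B ∎
    where
    open ≋-Reasoning
    D = ⟦ denominator ⟧ᴱ ↑ 3
    basis : Fin 4 → PowerSeries
    basis k = ⌜ pow k 0F ⌝ ⊞ ⌜ pow k 1F ⌝ ⊠ A ⊞ (⌜ pow k 2F ⌝ ⊞ ⌜ pow k 3F ⌝ ⊠ A) ⊠ B
    power : ∀ k i j → i ≡ 3 ℕ.∸ toℕ k → j ≡ toℕ k → ⟦ denominator ⟧ᴱ ↑ (i ℕ.+ j) ⊠ G ↑ j ≋ basis k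
    power k i j refl refl = ≋-trans (≋-sym (homogenized-homo i j)) (powers-correct k)

  private
    combination : ∀ j → (∀ i → coordinate i ≋ 𝟘) →
      ⌜ cof j 0F ⌝ ⊠ coordinate 0F ⊞ ⌜ cof j 1F ⌝ ⊠ coordinate 1F ⊞ ⌜ cof j 2F ⌝ ⊠ coordinate 2F ⊞ ⌜ cof j 3F ⌝ ⊠ coordinate 3F ≋ 𝟘
    combination j c≋𝟘 = ≋-trans
      (⊞-cong (⊞-cong (⊞-cong (⊠-congˡ (c≋𝟘 0F)) (⊠-congˡ (c≋𝟘 1F))) (⊠-congˡ (c≋𝟘 2F))) (⊠-congˡ (c≋𝟘 3F)))
      (solve 4 (λ a b c d → a :* con [] :+ b :* con [] :+ c :* con [] :+ d :* con [] := con []) ≋-refl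
        ⌜ cof j 0F ⌝ ⌜ cof j 1F ⌝ ⌜ cof j 2F ⌝ ⌜ cof j 3F ⌝)

    combination′ : Fin 4 → (p₀ p₁ p₂ p₃ : Expression 4) → Expression 4
    combination′ j p₀ p₁ p₂ p₃ = con (cof j 0F) :* c′ 0F :+ con (cof j 1F) :* c′ 1F :+ con (cof j 2F) :* c′ 2F :+ con (cof j 3F) :* c′ 3F
      where c′ = λ i → p₀ :* con (pow 0F i) :+ p₁ :* con (pow 1F i) :+ p₂ :* con (pow 2F i) :+ p₃ :* con (pow 3F i)

  -- Cramer's rule: row j of `cofactors` combines the four coordinates into a nonzero polynomial
  -- times the j-th coefficient.
  coordinates≋𝟘⇒p≋𝟘 : (∀ i → coordinate i ≋ 𝟘) → p₀ ≋ 𝟘 × p₁ ≋ 𝟘 × p₂ ≋ 𝟘 × p₃ ≋ 𝟘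
  coordinates≋𝟘⇒p≋𝟘 c≋𝟘 =
    ⊠-cancel (determinants≉𝟘 0F) (≋-trans
      (solve 4 (λ p₀ p₁ p₂ p₃ → con (lookup determinants 0F) :* p₀ := combination′ 0F p₀ p₁ p₂ p₃) ≋-refl p₀ p₁ p₂ p₃)
      (combination 0F c≋𝟘)) ,
    ⊠-cancel (determinants≉𝟘 1F) (≋-trans
      (solve 4 (λ p₀ p₁ p₂ p₃ → con (lookup determinants 1F) :* p₁ := combination′ 1F p₀ p₁ p₂ p₃) ≋-refl p₀ p₁ p₂ p₃)
      (combination 1F c≋𝟘)) ,
    ⊠-cancel (determinants≉𝟘 2F) (≋-trans
      (solve 4 (λ p₀ p₁ p₂ p₃ → con (lookup determinants 2F) :* p₂ := combination′ 2F p₀ p₁ p₂ p₃) ≋-refl p₀ p₁ p₂ p₃)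
      (combination 2F c≋𝟘)) ,
    ⊠-cancel (determinants≉𝟘 3F) (≋-trans
      (solve 4 (λ p₀ p₁ p₂ p₃ → con (lookup determinants 3F) :* p₃ := combination′ 3F p₀ p₁ p₂ p₃) ≋-refl p₀ p₁ p₂ p₃)
      (combination 3F c≋𝟘))

  G-independent : IsPolynomial p₀ → IsPolynomial p₁ → IsPolynomial p₂ → IsPolynomial p₃ →
    cubic ≋ 𝟘 → p₀ ≋ 𝟘 × p₁ ≋ 𝟘 × p₂ ≋ 𝟘 × p₃ ≋ 𝟘
  G-independent p₀-poly p₁-poly p₂-poly p₃-poly cubic≋𝟘 =
    stable (λ p≋𝟘 → proj₁ p≋𝟘) , stable (λ p≋𝟘 → proj₁ (proj₂ p≋𝟘)) ,
    stable (λ p≋𝟘 → proj₁ (proj₂ (proj₂ p≋𝟘))) , stable (λ p≋𝟘 → proj₂ (proj₂ (proj₂ p≋𝟘)))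
    where
    coordinate-isPolynomial : ∀ i → IsPolynomial (coordinate i)
    coordinate-isPolynomial i = ⊞-isPolynomial (⊞-isPolynomial (⊞-isPolynomial
      (⊠-isPolynomial p₀-poly (⌜⌝-isPolynomial (pow 0F i))) (⊠-isPolynomial p₁-poly (⌜⌝-isPolynomial (pow 1F i))))
      (⊠-isPolynomial p₂-poly (⌜⌝-isPolynomial (pow 2F i)))) (⊠-isPolynomial p₃-poly (⌜⌝-isPolynomial (pow 3F i)))
    -- Vanishing of a series is stable under double negation, so the result of `AB-independent` may
    -- be used for each conclusion separately.
    stable : ∀ {f} → (p₀ ≋ 𝟘 × p₁ ≋ 𝟘 × p₂ ≋ 𝟘 × p₃ ≋ 𝟘 → f ≋ 𝟘) → f ≋ 𝟘
    stable conclude = ≋𝟘-stable λ f≉𝟘 → AB-independent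
      (coordinate-isPolynomial 0F) (coordinate-isPolynomial 1F) (coordinate-isPolynomial 2F) (coordinate-isPolynomial 3F)
      (≋-trans (≋-sym cubic-coordinates) (≋-trans (⊠-congˡ cubic≋𝟘) (⊠-zeroʳ (⟦ denominator ⟧ᴱ ↑ 3))))
      λ (c₀ , c₁ , c₂ , c₃) → f≉𝟘 (conclude (coordinates≋𝟘⇒p≋𝟘 λ { 0F → c₀ ; 1F → c₁ ; 2F → c₂ ; 3F → c₃ }))

horner-scale : ∀ {m} d (ps : Vec PowerSeries m) F → horner (Vec.map (d ⊠_) ps) F ≋ d ⊠ horner ps F
horner-scale d []       F = ≋-sym (⊠-zeroʳ d)
horner-scale d (p ∷ ps) F = ≋-trans (⊞-congˡ (⊠-congˡ (horner-scale d ps F)))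
  (solve 4 (λ d p f h → d :* p :+ f :* (d :* h) := d :* (p :+ f :* h)) ≋-refl d p F (horner ps F))

horner-cong : ∀ {m} (ps : Vec PowerSeries m) {F F′} → F ≋ F′ → horner ps F ≋ horner ps F′
horner-cong []       F≋F′ = ≋-refl
horner-cong (p ∷ ps) F≋F′ = ⊞-congˡ (⊠-cong F≋F′ (horner-cong ps F≋F′))

-- The numerator of P(F) as a polynomial in F.
clear : ∀ {m} → Vec RationalFunction m → PowerSeries → Vec PowerSeries m
clear []                   F = []
clear (p / q [ q≉0 ] ∷ rs) F = ⟦ p ⟧ ⊠ Laurent.den (evaluate rs (fromSeries F)) ∷ Vec.map (⟦ q ⟧ ⊠_) (clear rs F)

opaque
  unfolding _⊞_ _⊠_ ⌜_⌝

  num-nil : ∀ F → Laurent.num (evaluate [] (fromSeries F)) ≋ 𝟘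
  num-nil F = ≋-refl

  num-cons : ∀ {m} p q q≉0 (rs : Vec RationalFunction m) F → let e = evaluate rs (fromSeries F) in
    Laurent.num (evaluate (p / q [ q≉0 ] ∷ rs) (fromSeries F)) ≋ ⟦ p ⟧ ⊠ (𝟙 ⊠ Laurent.den e) ⊞ (F ⊠ Laurent.num e) ⊠ ⟦ q ⟧
  num-cons p q q≉0 rs F = pointwise λ _ → refl

  den-cons′ : ∀ {m} p q q≉0 (rs : Vec RationalFunction m) F →
    Laurent.den (evaluate (p / q [ q≉0 ] ∷ rs) (fromSeries F)) ≋ ⟦ q ⟧ ⊠ (𝟙 ⊠ Laurent.den (evaluate rs (fromSeries F)))
  den-cons′ p q q≉0 rs F = pointwise λ _ → refl

  ≃0⇒num≋𝟘 : ∀ x → x ≃ 0ᴸ → Laurent.num x ≋ 𝟘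
  ≃0⇒num≋𝟘 (a / b [ _ ]) a1≈0b = ≋-trans (≋-sym (⊠-identityʳ a)) (≋-trans (pointwise a1≈0b) (⊠-zeroˡ b))

  num≋𝟘⇒≃0 : ∀ x → Laurent.num x ≋ 𝟘 → x ≃ 0ᴸ
  num≋𝟘⇒≃0 (a / b [ _ ]) a≋𝟘 = coefficients≡ (≋-trans (⊠-identityʳ a) (≋-trans a≋𝟘 (≋-sym (⊠-zeroˡ b))))

  ≉0⇒≉𝟘 : ∀ {f} → ¬ f ≈ 0# → f ≉𝟘
  ≉0⇒≉𝟘 f≉0 f≋𝟘 = f≉0 (coefficients≡ f≋𝟘)

den-cons : ∀ {m} p q q≉0 (rs : Vec RationalFunction m) F →
  Laurent.den (evaluate (p / q [ q≉0 ] ∷ rs) (fromSeries F)) ≋ ⟦ q ⟧ ⊠ Laurent.den (evaluate rs (fromSeries F))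
den-cons p q q≉0 rs F = ≋-trans (den-cons′ p q q≉0 rs F) (⊠-congˡ (⊠-identityˡ (Laurent.den (evaluate rs (fromSeries F)))))

num≋horner-clear : ∀ {m} (rs : Vec RationalFunction m) F → Laurent.num (evaluate rs (fromSeries F)) ≋ horner (clear rs F) F
num≋horner-clear []                   F = num-nil F
num≋horner-clear (p / q [ q≉0 ] ∷ rs) F = begin
  Laurent.num (evaluate (p / q [ q≉0 ] ∷ rs) (fromSeries F))
    ≈⟨ num-cons p q q≉0 rs F ⟩
  ⟦ p ⟧ ⊠ (𝟙 ⊠ den) ⊞ (F ⊠ num) ⊠ ⟦ q ⟧
    ≈⟨ ⊞-congˡ (⊠-congʳ (⊠-congˡ (num≋horner-clear rs F))) ⟩
  ⟦ p ⟧ ⊠ (𝟙 ⊠ den) ⊞ (F ⊠ horner (clear rs F) F) ⊠ ⟦ q ⟧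
    ≈⟨ solve 5 (λ p q d f h → p :* (one′ :* d) :+ f :* h :* q := p :* d :+ f :* (q :* h)) ≋-refl
         ⟦ p ⟧ ⟦ q ⟧ den F (horner (clear rs F) F) ⟩
  ⟦ p ⟧ ⊠ den ⊞ F ⊠ (⟦ q ⟧ ⊠ horner (clear rs F) F)
    ≈⟨ ⊞-congˡ (⊠-congˡ (horner-scale ⟦ q ⟧ (clear rs F) F)) ⟨
  ⟦ p ⟧ ⊠ den ⊞ F ⊠ horner (Vec.map (⟦ q ⟧ ⊠_) (clear rs F)) F ∎
  where
  open ≋-Reasoning
  num = Laurent.num (evaluate rs (fromSeries F))
  den = Laurent.den (evaluate rs (fromSeries F))

≋-isPolynomial : ∀ {f g} → f ≋ g → IsPolynomial g → IsPolynomial f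
≋-isPolynomial f≋g (p , g≈p) = p , λ n → trans (coefficients≡ f≋g n) (g≈p n)

⟦⟧-isPolynomial : ∀ p → IsPolynomial ⟦ p ⟧
⟦⟧-isPolynomial p = p , λ _ → refl

den-isPolynomial : ∀ {m} (rs : Vec RationalFunction m) F → IsPolynomial (Laurent.den (evaluate rs (fromSeries F)))
den-isPolynomial []                   F = ⟦⟧-isPolynomial (1ℚ ∷ [])
den-isPolynomial (p / q [ q≉0 ] ∷ rs) F = ≋-isPolynomial (den-cons p q q≉0 rs F)
  (⊠-isPolynomial (⟦⟧-isPolynomial q) (den-isPolynomial rs F))

clear-isPolynomial : ∀ {m} (rs : Vec RationalFunction m) F → VecAll.All IsPolynomial (clear rs F)
clear-isPolynomial []                   F = []
clear-isPolynomial (p / q [ q≉0 ] ∷ rs) F = ⊠-isPolynomial (⟦⟧-isPolynomial p) (den-isPolynomial rs F) ∷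
  VecAll.map⁺ (VecAll.map (⊠-isPolynomial (⟦⟧-isPolynomial q)) (clear-isPolynomial rs F))

last-map : ∀ {X Y : Set} {m} (f : X → Y) (xs : Vec X (suc m)) → Vec.last (Vec.map f xs) ≡ f (Vec.last xs)
last-map f (x ∷ [])     = refl
last-map f (x ∷ y ∷ xs) = last-map f (y ∷ xs)

last-clear : ∀ {m} (rs : Vec RationalFunction (suc m)) F → ¬ fromRational (Vec.last rs) ≃ 0ᴸ → Vec.last (clear rs F) ≉𝟘
last-clear (p / q [ q≉0 ] ∷ [])     F last≉0 = ⊠-≉𝟘 (λ p≋𝟘 → last≉0 (num≋𝟘⇒≃0 (⟦ p ⟧ / ⟦ q ⟧ [ q≉0 ]) p≋𝟘)) (≉0⇒≉𝟘 1#≉0#)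
last-clear (p / q [ q≉0 ] ∷ r ∷ rs) F last≉0 = subst _≉𝟘 (sym (last-map (⟦ q ⟧ ⊠_) (clear (r ∷ rs) F)))
  (⊠-≉𝟘 (≉0⇒≉𝟘 q≉0) (last-clear (r ∷ rs) F last≉0))

horner-pad : ∀ {m} (ps : Vec PowerSeries m) F → horner (ps Vec.∷ʳ 𝟘) F ≋ horner ps F
horner-pad []       F = solve 1 (λ f → con [] :+ f :* con [] := con []) ≋-refl F
horner-pad (p ∷ ps) F = ⊞-congˡ (⊠-congˡ (horner-pad ps F))

𝟘-isPolynomial : IsPolynomial 𝟘
𝟘-isPolynomial = ⌜⌝-isPolynomial []

-- Padding with zero coefficients makes every polynomial of degree below 4 a cubic.
last≋𝟘 : ∀ {e} (ps : Vec PowerSeries (suc e)) → e ℕ.< 4 → VecAll.All IsPolynomial ps → horner ps G ≋ 𝟘 → Vec.last ps ≋ 𝟘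
last≋𝟘 (p ∷ []) _ (p-poly ∷ []) eq =
  proj₁ (G-independent p-poly 𝟘-isPolynomial 𝟘-isPolynomial 𝟘-isPolynomial
    (≋-trans (horner-pad (p ∷ 𝟘 ∷ 𝟘 ∷ []) G) (≋-trans (horner-pad (p ∷ 𝟘 ∷ []) G) (≋-trans (horner-pad (p ∷ []) G) eq))))
last≋𝟘 (p ∷ q ∷ []) _ (p-poly ∷ q-poly ∷ []) eq =
  proj₁ (proj₂ (G-independent p-poly q-poly 𝟘-isPolynomial 𝟘-isPolynomial
    (≋-trans (horner-pad (p ∷ q ∷ 𝟘 ∷ []) G) (≋-trans (horner-pad (p ∷ q ∷ []) G) eq))))
last≋𝟘 (p ∷ q ∷ r ∷ []) _ (p-poly ∷ q-poly ∷ r-poly ∷ []) eq =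
  proj₁ (proj₂ (proj₂ (G-independent p-poly q-poly r-poly 𝟘-isPolynomial (≋-trans (horner-pad (p ∷ q ∷ r ∷ []) G) eq))))
last≋𝟘 (p ∷ q ∷ r ∷ s ∷ []) _ (p-poly ∷ q-poly ∷ r-poly ∷ s-poly ∷ []) eq =
  proj₂ (proj₂ (proj₂ (G-independent p-poly q-poly r-poly s-poly eq)))
last≋𝟘 (_ ∷ _ ∷ _ ∷ _ ∷ _ ∷ _) (ℕ.s≤s (ℕ.s≤s (ℕ.s≤s (ℕ.s≤s ()))))

overℚ[z] : List ℤ → RationalFunction
overℚ[z] p = List.map ι p / 1ℚ ∷ [] [ 1#≉0# ]

opaque
  unfolding ⌜_⌝

  ⟦1⟧≋𝟙 : ⟦ 1ℚ ∷ [] ⟧ ≋ 𝟙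
  ⟦1⟧≋𝟙 = ≋-refl

  ⟦map-ι⟧≋⌜⌝ : ∀ p → ⟦ List.map ι p ⟧ ≋ ⌜ p ⌝
  ⟦map-ι⟧≋⌜⌝ p = ≋-refl

  leading≢0 : ¬ ⌜ q₄ ⌝ 1 ≡ 0ℚ
  leading≢0 ()

den-overℚ[z] : ∀ {m} (ps : Vec (List ℤ) m) F → Laurent.den (evaluate (Vec.map overℚ[z] ps) (fromSeries F)) ≋ 𝟙
den-overℚ[z] []       F = ⟦1⟧≋𝟙
den-overℚ[z] (p ∷ ps) F = ≋-trans (den-cons (List.map ι p) (1ℚ ∷ []) 1#≉0# (Vec.map overℚ[z] ps) F)
  (≋-trans (⊠-cong ⟦1⟧≋𝟙 (den-overℚ[z] ps F)) (⊠-identityˡ 𝟙))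

clear-overℚ[z] : ∀ {m} (ps : Vec (List ℤ) m) F → horner (clear (Vec.map overℚ[z] ps) F) F ≋ horner (Vec.map ⌜_⌝ ps) F
clear-overℚ[z] []       F = ≋-refl
clear-overℚ[z] (p ∷ ps) F = ⊞-cong
  (≋-trans (⊠-cong (⟦map-ι⟧≋⌜⌝ p) (den-overℚ[z] ps F)) (⊠-identityʳ ⌜ p ⌝))
  (⊠-congˡ (≋-trans (horner-scale ⟦ 1ℚ ∷ [] ⟧ (clear (Vec.map overℚ[z] ps) F) F)
    (≋-trans (⊠-cong ⟦1⟧≋𝟙 (clear-overℚ[z] ps F)) (⊠-identityˡ (horner (Vec.map ⌜_⌝ ps) F)))))

quarticCoefficients : Vec (List ℤ) 5
quarticCoefficients = q₀ ∷ q₁ ∷ q₂ ∷ q₃ ∷ q₄ ∷ []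

horner-Quartic : ∀ F → horner (Vec.map ⌜_⌝ quarticCoefficients) F ≋ Quartic F
horner-Quartic = solve 1 (λ f →
  con q₀ :+ f :* (con q₁ :+ f :* (con q₂ :+ f :* (con q₃ :+ f :* (con q₄ :+ f :* con [])))) :=
  con q₀ :+ con q₁ :* f :+ con q₂ :* (f :* (f :* one′)) :+
  con q₃ :* (f :* (f :* (f :* one′))) :+ con q₄ :* (f :* (f :* (f :* (f :* one′))))) ≋-refl

algebraicOfDegree-4 : ∀ {F} → F ≋ G → Quartic F ≋ 𝟘 → AlgebraicOfDegree F 4
algebraicOfDegree-4 {F} F≋G qF = (quarticPolynomial , num≋𝟘⇒≃0 (evaluate coefficients (fromSeries F)) (begin
    Laurent.num (evaluate coefficients (fromSeries F))   ≈⟨ num≋horner-clear coefficients F ⟩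
    horner (clear coefficients F) F                      ≈⟨ clear-overℚ[z] quarticCoefficients F ⟩
    horner (Vec.map ⌜_⌝ quarticCoefficients) F           ≈⟨ horner-Quartic F ⟩
    Quartic F                                            ≈⟨ qF ⟩
    𝟘                                                    ∎))
  , λ e e<4 P annihilates → let rs = PolynomialOfDegree.coefficients P in
      last-clear rs F (PolynomialOfDegree.leading≉0 P)
        (last≋𝟘 (clear rs F) e<4 (clear-isPolynomial rs F) (begin
          horner (clear rs F) G                        ≈⟨ horner-cong (clear rs F) F≋G ⟨
          horner (clear rs F) F                        ≈⟨ num≋horner-clear rs F ⟨
          Laurent.num (evaluate rs (fromSeries F))     ≈⟨ ≃0⇒num≋𝟘 (evaluate rs (fromSeries F)) annihilates ⟩
          𝟘                                            ∎))
  where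
  open ≋-Reasoning
  coefficients = Vec.map overℚ[z] quarticCoefficients
  quarticPolynomial : PolynomialOfDegree 4
  quarticPolynomial = record
    { coefficients = coefficients
    ; leading≉0    = λ leading≃0 → coefficient≢0⇒≉𝟘 1 leading≢0
        (≋-trans (≋-sym (⟦map-ι⟧≋⌜⌝ q₄)) (≃0⇒num≋𝟘 (fromRational (overℚ[z] q₄)) leading≃0))
    }

-- Occurrences of letters in words

δ : ℕ → ℕ → ℕ
δ a b with a ℕ.≟ b
... | yes _ = 1
... | no  _ = 0

δ-refl : ∀ a → δ a a ≡ 1
δ-refl a with a ℕ.≟ a
... | yes _  = refl
... | no a≢a = ⊥-elim (a≢a refl)

δ-≢ : ∀ {a b} → a ≢ b → δ a b ≡ 0
δ-≢ {a} {b} a≢b with a ℕ.≟ b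
... | yes a≡b = ⊥-elim (a≢b a≡b)
... | no _    = refl

occ : ℕ → List ℕ → ℕ
occ a []      = 0
occ a (x ∷ v) = δ a x + occ a v

below : ℕ → ℕ → ℕ
below a zero    = 0
below a (suc m) = δ a m + below a m

occ-++ : ∀ a u v → occ a (u ++ v) ≡ occ a u + occ a v
occ-++ a []      v = refl
occ-++ a (x ∷ u) v = trans (cong (λ k → δ a x + k) (occ-++ a u v)) (sym (ℕ.+-assoc (δ a x) _ _))

infix 4 _∈ʷ_
-- Membership as a subsequence of one letter, so that it composes with containment of patterns by
-- transitivity.
_∈ʷ_ : ℕ → List ℕ → Set
a ∈ʷ v = a ∷ [] ⊆ v

∈ʷ-head : ∀ {a v} → a ∈ʷ a ∷ v
∈ʷ-head {v = v} = refl ∷ minimum v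

∈ʷ⇒occ>0 : ∀ {a v} → a ∈ʷ v → 0 < occ a v
∈ʷ⇒occ>0 {a} (y ∷ʳ a∈v)               = ℕ.m≤n⇒m≤o+n (δ a y) (∈ʷ⇒occ>0 a∈v)
∈ʷ⇒occ>0 {a} {_ ∷ v} (refl ∷ _) rewrite δ-refl a = s≤s z≤n

occ>0⇒∈ʷ : ∀ a v → 0 < occ a v → a ∈ʷ v
occ>0⇒∈ʷ a (x ∷ v) 0<occ with a ℕ.≟ x
... | yes refl = ∈ʷ-head
... | no  _    = x ∷ʳ occ>0⇒∈ʷ a v 0<occ

∉ʷ⇒occ≡0 : ∀ {a v} → ¬ a ∈ʷ v → occ a v ≡ 0
∉ʷ⇒occ≡0 {a} {v} a∉v = ℕ.n≤0⇒n≡0 (ℕ.≮⇒≥ (λ 0<occ → a∉v (occ>0⇒∈ʷ a v 0<occ)))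

below>0⇒< : ∀ {a} m → 0 < below a m → a < m
below>0⇒< {a} (suc m) 0<b with a ℕ.≟ m
... | yes refl = ℕ.n<1+n a
... | no  _    = ℕ.m<n⇒m<1+n (below>0⇒< m 0<b)

<⇒below≡1 : ∀ {a m} → a < m → below a m ≡ 1
≥⇒below≡0 : ∀ {a m} → m ≤ a → below a m ≡ 0
<⇒below≡1 {a} {suc m} (s≤s a≤m) with a ℕ.≟ m
... | yes refl = cong suc (≥⇒below≡0 (ℕ.≤-refl {a}))
... | no a≢m   = <⇒below≡1 (ℕ.≤∧≢⇒< a≤m a≢m)
≥⇒below≡0 {a} {zero}  _   = refl
≥⇒below≡0 {a} {suc m} m<a = cong₂ _+_ (δ-≢ (λ a≡m → ℕ.<⇒≢ m<a (sym a≡m))) (≥⇒below≡0 (ℕ.<⇒≤ m<a))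

All-∈ʷ : ∀ {P : ℕ → Set} {a v} → All P v → a ∈ʷ v → P a
All-∈ʷ pv a∈v = All.head (Sublist.All-resp-⊆ a∈v pv)

either-order : ∀ {a b v} → a ≢ b → a ∈ʷ v → b ∈ʷ v → a ∷ b ∷ [] ⊆ v ⊎ b ∷ a ∷ [] ⊆ v
either-order a≢b (y ∷ʳ a∈v)  (.y ∷ʳ b∈v)  with either-order a≢b a∈v b∈v
... | inj₁ ab = inj₁ (y ∷ʳ ab)
... | inj₂ ba = inj₂ (y ∷ʳ ba)
either-order a≢b (y ∷ʳ a∈v)  (refl ∷ _)   = inj₂ (refl ∷ a∈v)
either-order a≢b (refl ∷ _)  (y ∷ʳ b∈v)   = inj₁ (refl ∷ b∈v)
either-order a≢b (refl ∷ _)  (refl ∷ _)   = ⊥-elim (a≢b refl)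

-- If no `b` came after this `a`, two of them would precede it and form the excluded pattern.
after-one-of-two : ∀ {a b v} → a ≢ b → a ∈ʷ v → 2 ≤ occ b v → ¬ b ∷ b ∷ a ∷ [] ⊆ v → a ∷ b ∷ [] ⊆ v
after-one-of-two {a} {b} {x ∷ v} a≢b (.x ∷ʳ a∈v) 2≤occ ¬bba with b ℕ.≟ x
... | no b≢x = x ∷ʳ after-one-of-two a≢b a∈v 2≤occ (λ bba → ¬bba (x ∷ʳ bba))
... | yes refl with either-order a≢b a∈v (occ>0⇒∈ʷ b v (ℕ.s≤s⁻¹ 2≤occ))
...   | inj₁ ab = x ∷ʳ ab
...   | inj₂ ba = ⊥-elim (¬bba (refl ∷ ba))
after-one-of-two {a} {b} {x ∷ v} a≢b (refl ∷ _) 2≤occ ¬bba with b ℕ.≟ x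
... | yes refl = ⊥-elim (a≢b refl)
... | no _     = refl ∷ occ>0⇒∈ʷ b v (ℕ.≤-trans (s≤s z≤n) 2≤occ)

-- Completions of a prefix, one letter at a time

-- What remains of a word: v completes a prefix after which the labels in q have occurred once, in this
-- order, those in ps and those below m have not occurred, and m is the least one that has.
record Completes (q ps : List ℕ) (m : ℕ) (v : List ℕ) : Set where
  field
    count   : ∀ a → occ a v ≡ occ a q + (2 * occ a ps + 2 * below a m)
    no-abba : ∀ {a b} → a ≢ b → ¬ a ∷ b ∷ b ∷ a ∷ [] ⊆ v
    no-bba  : ∀ {a b} → a ≢ b → a ∈ʷ q → ¬ b ∷ b ∷ a ∷ [] ⊆ v
    no-ba   : ∀ {a b} → a ≢ b → a ∷ b ∷ [] ⊆ q → ¬ b ∷ a ∷ [] ⊆ v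
    no-123  : ∀ {a b c} → a < b → b < c → ¬ a ∷ b ∷ c ∷ [] ⊆ v
    no-23   : ∀ {b c} → m < b → b < c → ¬ b ∷ c ∷ [] ⊆ v

-- A letter y above m ends an ascent, so from then on no larger letter may follow: the inequalities
-- in `push-up` and `pop` bound by y all labels still to come. Popping at the front only is what
-- excludes nestings. In `push-low` the equation says that the labels strictly between y and m
-- become pending.
data Step (y : ℕ) : (q ps : List ℕ) (m : ℕ) (q′ ps′ : List ℕ) (m′ : ℕ) → Set where
  push-low : ∀ {q ps m ps′} → y < m → ¬ y ∈ʷ q →
             (∀ a → occ a ps + below a m ≡ occ a ps′ + (δ a y + below a y)) →
             Step y q ps m (q ++ y ∷ []) ps′ y
  push-up  : ∀ {q ps m} → m < y → All (_< y) q → All (_≤ y) ps →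
             Step y q (y ∷ ps) m (q ++ y ∷ []) ps m
  pop      : ∀ {q ps m} → m ≤ y → All (_≢ y) q → All (_≢ y) ps → (m < y → All (_≤ y) q × All (_≤ y) ps) →
             Step y (y ∷ q) ps m q ps m

remaining : ∀ {q ps m v} → Completes q ps m v → ∀ {a} → a ∈ʷ v → a ∈ʷ q ⊎ a ∈ʷ ps ⊎ a < m
remaining {q} {ps} {m} C {a} a∈v with occ a q in eq₁ | occ a ps in eq₂ | below a m in eq₃ | Completes.count C a
... | suc _ | _     | _     | _  = inj₁ (occ>0⇒∈ʷ a q (subst (0 <_) (sym eq₁) (s≤s z≤n)))
... | zero  | suc _ | _     | _  = inj₂ (inj₁ (occ>0⇒∈ʷ a ps (subst (0 <_) (sym eq₂) (s≤s z≤n))))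
... | zero  | zero  | suc _ | _  = inj₂ (inj₂ (below>0⇒< m (subst (0 <_) (sym eq₃) (s≤s z≤n))))
... | zero  | zero  | zero  | eq = ⊥-elim (ℕ.<-irrefl (sym eq) (∈ʷ⇒occ>0 a∈v))

bounded : ∀ {q ps m v y} → Completes q ps m v → m ≤ y → All (_≤ y) q → All (_≤ y) ps → ∀ {a} → a ∈ʷ v → a ≤ y
bounded C m≤y q≤y ps≤y a∈v with remaining C a∈v
... | inj₁ a∈q         = All-∈ʷ q≤y a∈q
... | inj₂ (inj₁ a∈ps) = All-∈ʷ ps≤y a∈ps
... | inj₂ (inj₂ a<m)  = ℕ.≤-trans (ℕ.<⇒≤ a<m) m≤y

∈ʷ-∷ʳ : ∀ {a y} q → a ∈ʷ q ++ y ∷ [] → a ∈ʷ q ⊎ a ≡ y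
∈ʷ-∷ʳ []      (refl ∷ _)     = inj₂ refl
∈ʷ-∷ʳ []      (_ ∷ʳ ())
∈ʷ-∷ʳ (x ∷ q) (refl ∷ _)     = inj₁ ∈ʷ-head
∈ʷ-∷ʳ (x ∷ q) (.x ∷ʳ a∈qy)   with ∈ʷ-∷ʳ q a∈qy
... | inj₁ a∈q = inj₁ (x ∷ʳ a∈q)
... | inj₂ a≡y = inj₂ a≡y

⊆-∷ʳ-pair : ∀ {a b y} q → a ∷ b ∷ [] ⊆ q ++ y ∷ [] → a ∷ b ∷ [] ⊆ q ⊎ (a ∈ʷ q × b ≡ y)
⊆-∷ʳ-pair []      (_ ∷ʳ ())
⊆-∷ʳ-pair []      (refl ∷ ())
⊆-∷ʳ-pair (x ∷ q) (refl ∷ b∈qy) with ∈ʷ-∷ʳ q b∈qy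
... | inj₁ b∈q  = inj₁ (refl ∷ b∈q)
... | inj₂ refl = inj₂ (∈ʷ-head , refl)
⊆-∷ʳ-pair (x ∷ q) (.x ∷ʳ ab⊆qy) with ⊆-∷ʳ-pair q ab⊆qy
... | inj₁ ab⊆q         = inj₁ (x ∷ʳ ab⊆q)
... | inj₂ (a∈q , refl) = inj₂ (x ∷ʳ a∈q , refl)

∈ʷ-pair : ∀ {a y q} → a ∈ʷ q → a ∷ y ∷ [] ⊆ q ++ y ∷ []
∈ʷ-pair {a} {y} {q} a∈q = Sublist.++⁺ a∈q (⊆-refl {x = y ∷ []})

private
  push-count : ∀ {q ps m ps′ m′ y v} (a : ℕ) → occ a ps + below a m ≡ occ a ps′ + (δ a y + below a m′) →
    (δ a y + occ a v ≡ occ a q + (2 * occ a ps + 2 * below a m) → occ a v ≡ occ a (q ++ y ∷ []) + (2 * occ a ps′ + 2 * below a m′))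
    × (occ a v ≡ occ a (q ++ y ∷ []) + (2 * occ a ps′ + 2 * below a m′) → δ a y + occ a v ≡ occ a q + (2 * occ a ps + 2 * below a m))
  push-count {q} {ps} {m} {ps′} {m′} {y} {v} a eq rewrite occ-++ a q (y ∷ []) =
    (λ h → ℕ.+-cancelˡ-≡ (δ a y) _ _ (trans h rearranged)) , (λ h → trans (cong (λ k → δ a y + k) h) (sym rearranged))
    where
    open ≡-Reasoning
    shuffle : ∀ d q p b → q + 2 * (p + (d + b)) ≡ d + (q + (d + 0) + (2 * p + 2 * b))
    shuffle = ℕ-Solver.solve-∀
    double : ∀ q p b → q + (2 * p + 2 * b) ≡ q + 2 * (p + b)
    double = ℕ-Solver.solve-∀
    rearranged : occ a q + (2 * occ a ps + 2 * below a m) ≡ δ a y + (occ a q + (δ a y + 0) + (2 * occ a ps′ + 2 * below a m′))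
    rearranged = begin
      occ a q + (2 * occ a ps + 2 * below a m)                 ≡⟨ double (occ a q) (occ a ps) (below a m) ⟩
      occ a q + 2 * (occ a ps + below a m)                     ≡⟨ cong (λ k → occ a q + 2 * k) eq ⟩
      occ a q + 2 * (occ a ps′ + (δ a y + below a m′))         ≡⟨ shuffle (δ a y) (occ a q) (occ a ps′) (below a m′) ⟩
      δ a y + (occ a q + (δ a y + 0) + (2 * occ a ps′ + 2 * below a m′)) ∎

  push-up-count : ∀ a y ps m → occ a (y ∷ ps) + below a m ≡ occ a ps + (δ a y + below a m)
  push-up-count a y ps m = rearrange (δ a y) (occ a ps) (below a m)
    where
    rearrange : ∀ d p b → d + p + b ≡ p + (d + b)
    rearrange = ℕ-Solver.solve-∀

module _ {y m m′ : ℕ} {q ps q′ ps′ v : List ℕ} where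

  private
    push-bba : Completes q ps m (y ∷ v) → ∀ {a b} → a ≢ b → a ∈ʷ q ++ y ∷ [] → ¬ b ∷ b ∷ a ∷ [] ⊆ v
    push-bba C a≢b a∈qy bba with ∈ʷ-∷ʳ q a∈qy
    ... | inj₁ a∈q  = Completes.no-bba C a≢b a∈q (y ∷ʳ bba)
    ... | inj₂ refl = Completes.no-abba C a≢b (refl ∷ bba)

    push-ba : Completes q ps m (y ∷ v) → ∀ {a b} → a ≢ b → a ∷ b ∷ [] ⊆ q ++ y ∷ [] → ¬ b ∷ a ∷ [] ⊆ v
    push-ba C a≢b ab⊆qy ba with ⊆-∷ʳ-pair q ab⊆qy
    ... | inj₁ ab⊆q         = Completes.no-ba C a≢b ab⊆q (y ∷ʳ ba)
    ... | inj₂ (a∈q , refl) = Completes.no-bba C a≢b a∈q (refl ∷ ba)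

  -- Forbidden patterns that start with the letter read turn into shorter ones for the rest: abba
  -- into bba, bba into ba, 123 into 23.
  step-complete : Step y q ps m q′ ps′ m′ → Completes q ps m (y ∷ v) → Completes q′ ps′ m′ v
  step-complete (push-low y<m y∉q counts) C = record
    { count   = λ a → proj₁ (push-count {q} {ps} {m} {ps′} {y} {y} {v} a (counts a)) (Completes.count C a)
    ; no-abba = λ a≢b abba → Completes.no-abba C a≢b (y ∷ʳ abba)
    ; no-bba  = push-bba C
    ; no-ba   = push-ba C
    ; no-123  = λ a<b b<c abc → Completes.no-123 C a<b b<c (y ∷ʳ abc)
    ; no-23   = λ y<b b<c bc → Completes.no-123 C y<b b<c (refl ∷ bc)
    }
  step-complete (push-up m<y q<y ps≤y) C = record
    { count   = λ a → proj₁ (push-count {q} {y ∷ ps′} {m} {ps′} {m} {y} {v} a (push-up-count a y ps′ m)) (Completes.count C a)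
    ; no-abba = λ a≢b abba → Completes.no-abba C a≢b (y ∷ʳ abba)
    ; no-bba  = push-bba C
    ; no-ba   = push-ba C
    ; no-123  = λ a<b b<c abc → Completes.no-123 C a<b b<c (y ∷ʳ abc)
    ; no-23   = λ m<b b<c bc → Completes.no-23 C m<b b<c (y ∷ʳ bc)
    }
  step-complete (pop m≤y q≢y ps≢y _) C = record
    { count   = λ a → ℕ.+-cancelˡ-≡ (δ a y) _ _ (trans (Completes.count C a) (ℕ.+-assoc (δ a y) (occ a q′) _))
    ; no-abba = λ a≢b abba → Completes.no-abba C a≢b (y ∷ʳ abba)
    ; no-bba  = λ a≢b a∈q bba → Completes.no-bba C a≢b (y ∷ʳ a∈q) (y ∷ʳ bba)
    ; no-ba   = λ a≢b ab⊆q ba → Completes.no-ba C a≢b (y ∷ʳ ab⊆q) (y ∷ʳ ba)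
    ; no-123  = λ a<b b<c abc → Completes.no-123 C a<b b<c (y ∷ʳ abc)
    ; no-23   = λ m<b b<c bc → Completes.no-23 C m<b b<c (y ∷ʳ bc)
    }

  private
    push-sound : ¬ y ∈ʷ q → m′ ≤ m → m′ ≤ y → (m < y → ∀ {a} → a ∈ʷ v → a ≤ y) →
      (∀ a → occ a (y ∷ v) ≡ occ a q + (2 * occ a ps + 2 * below a m)) →
      Completes (q ++ y ∷ []) ps′ m′ v → Completes q ps m (y ∷ v)
    push-sound y∉q m′≤m m′≤y v≤y counts C = record
      { count   = counts
      ; no-abba = λ { a≢b (.y ∷ʳ abba) → Completes.no-abba C a≢b abba
                    ; a≢b (refl ∷ bba) → Completes.no-bba C a≢b (Sublist.++⁺ˡ q ∈ʷ-head) bba }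
      ; no-bba  = λ { a≢b a∈q (.y ∷ʳ bba) → Completes.no-bba C a≢b (Sublist.++⁺ʳ (y ∷ []) a∈q) bba
                    ; a≢b a∈q (refl ∷ ba) → Completes.no-ba C a≢b (∈ʷ-pair a∈q) ba }
      ; no-ba   = λ { a≢b ab⊆q (.y ∷ʳ ba) → Completes.no-ba C a≢b (Sublist.++⁺ʳ (y ∷ []) ab⊆q) ba
                    ; {a} a≢b ab⊆q (refl ∷ _) → y∉q (⊆-trans (a ∷ʳ ⊆-refl) ab⊆q) }
      ; no-123  = λ { a<b b<c (.y ∷ʳ abc) → Completes.no-123 C a<b b<c abc
                    ; a<b b<c (refl ∷ bc) → Completes.no-23 C (ℕ.≤-<-trans m′≤y a<b) b<c bc }
      ; no-23   = λ { m<b b<c (.y ∷ʳ bc) → Completes.no-23 C (ℕ.≤-<-trans m′≤m m<b) b<c bc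
                    ; m<b b<c (refl ∷ c∈v) → ℕ.<⇒≱ b<c (v≤y m<b c∈v) }
      }

  -- A forbidden pattern that starts at y would leave a shorter forbidden one in `v`, or contradict
  -- the side conditions: these bound the letters after an ascent, and after a pop they leave no
  -- further y.
  step-sound : Step y q ps m q′ ps′ m′ → Completes q′ ps′ m′ v → Completes q ps m (y ∷ v)
  step-sound (push-low y<m y∉q counts) C = push-sound y∉q (ℕ.<⇒≤ y<m) ℕ.≤-refl
    (λ m<y → ⊥-elim (ℕ.<-asym m<y y<m))
    (λ a → proj₂ (push-count {q} {ps} {m} {ps′} {y} {y} {v} a (counts a)) (Completes.count C a)) C
  step-sound (push-up m<y q<y ps≤y) C = push-sound (λ y∈q → ℕ.<-irrefl refl (All-∈ʷ q<y y∈q)) ℕ.≤-refl (ℕ.<⇒≤ m<y)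
    (λ _ → bounded C (ℕ.<⇒≤ m<y) (All.++⁺ (All.map ℕ.<⇒≤ q<y) (ℕ.≤-refl ∷ [])) ps≤y)
    (λ a → proj₂ (push-count {q} {y ∷ ps′} {m} {ps′} {m} {y} {v} a (push-up-count a y ps′ m)) (Completes.count C a)) C
  step-sound (pop m≤y q≢y ps≢y below-y) C = record
    { count   = λ a → trans (cong (λ k → δ a y + k) (Completes.count C a)) (sym (ℕ.+-assoc (δ a y) (occ a q′) _))
    ; no-abba = λ { a≢b (.y ∷ʳ abba) → Completes.no-abba C a≢b abba
                  ; {_} {b} a≢b (refl ∷ bba) → y∉v (⊆-trans (b ∷ʳ b ∷ʳ ⊆-refl) bba) }
    ; no-bba  = λ { a≢b (.y ∷ʳ a∈q) (.y ∷ʳ bba) → Completes.no-bba C a≢b a∈q bba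
                  ; {_} {b} a≢b (refl ∷ _) (.y ∷ʳ bba) → y∉v (⊆-trans (b ∷ʳ b ∷ʳ ⊆-refl) bba)
                  ; {a} a≢b _ (refl ∷ ba) → y∉v (⊆-trans (refl ∷ a ∷ʳ []) ba) }
    ; no-ba   = λ { a≢b (.y ∷ʳ ab⊆q) (.y ∷ʳ ba) → Completes.no-ba C a≢b ab⊆q ba
                  ; {a} a≢b (.y ∷ʳ ab⊆q) (refl ∷ _) → All-∈ʷ q≢y (⊆-trans (a ∷ʳ ⊆-refl) ab⊆q) refl
                  ; {_} {b} a≢b (refl ∷ _) (.y ∷ʳ ba) → y∉v (⊆-trans (b ∷ʳ ⊆-refl) ba)
                  ; a≢b (refl ∷ _) (refl ∷ _) → a≢b refl }
    ; no-123  = λ { a<b b<c (.y ∷ʳ abc) → Completes.no-123 C a<b b<c abc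
                  ; a<b b<c (refl ∷ bc) → Completes.no-23 C (ℕ.≤-<-trans m≤y a<b) b<c bc }
    ; no-23   = λ { m<b b<c (.y ∷ʳ bc) → Completes.no-23 C m<b b<c bc
                  ; m<b b<c (refl ∷ c∈v) → ℕ.<⇒≱ b<c (bounded C m≤y (proj₁ (below-y m<b)) (proj₂ (below-y m<b)) c∈v) }
    }
    where
    y∉v : ¬ y ∈ʷ v
    y∉v y∈v with remaining C y∈v
    ... | inj₁ y∈q         = All-∈ʷ q≢y y∈q refl
    ... | inj₂ (inj₁ y∈ps) = All-∈ʷ ps≢y y∈ps refl
    ... | inj₂ (inj₂ y<m)  = ℕ.<⇒≱ y<m m≤y

-- States, their moves, and why no other letter can follow

-- The queue holds the labels that have occurred once. In low it consists of labels that were minima when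
-- they occurred, in wait it is m, x and in up it is x followed by such labels, where x was never a minimum.
data State : Set where
  low  : (q ps : List ℕ) (m : ℕ) → State
  wait : (x : ℕ) (ps : List ℕ) (m : ℕ) → State
  up   : (x : ℕ) (q ps : List ℕ) (m : ℕ) → State

queue pending : State → List ℕ
queue (low q _ _)  = q
queue (wait x _ m) = m ∷ x ∷ []
queue (up x q _ _) = x ∷ q
pending (low _ ps _)  = ps
pending (wait _ ps _) = ps
pending (up _ _ ps _) = ps

floor : State → ℕ
floor (low _ _ m)  = m
floor (wait _ _ m) = m
floor (up _ _ _ m) = m

-- Tries m - 1, m - 2, ... as the new minimum. A label passed over goes to the end of the pending
-- list, which therefore stays decreasing.
lowers : (List ℕ → List ℕ → ℕ → State) → List ℕ → List ℕ → ℕ → List (ℕ × State)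
lowers f q ps zero    = []
lowers f q ps (suc y) = (y , f (q ++ y ∷ []) ps y) ∷ lowers f q (ps ++ y ∷ []) y

-- While labels are pending, a new minimum is offered only if the present one no longer waits, and a
-- pending label only if no larger label waits. Once such a label has joined m, the state `wait`
-- forces m to leave.
moves : State → List (ℕ × State)
moves (low [] [] m)                 = lowers low [] [] m
moves (low [] (x ∷ ps) m)           = (x , up x [] ps m) ∷ lowers low [] (x ∷ ps) m
moves (low (l ∷ []) [] m)           = (l , low [] [] m) ∷ lowers low (l ∷ []) [] m
moves (low (l ∷ []) (x ∷ ps) m)     = (l , low [] (x ∷ ps) m) ∷ (x , wait x ps m) ∷ []
moves (low (l ∷ l′ ∷ q) [] m)       = (l , low (l′ ∷ q) [] m) ∷ lowers low (l ∷ l′ ∷ q) [] m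
moves (low (l ∷ l′ ∷ q) (x ∷ ps) m) = (l , low (l′ ∷ q) (x ∷ ps) m) ∷ []
moves (wait x ps m)                 = (m , up x [] ps m) ∷ []
moves (up x [] ps m)                = (x , low [] ps m) ∷ lowers (up x) [] ps m
moves (up x (l ∷ q) [] m)           = (x , low (l ∷ q) [] m) ∷ lowers (up x) (l ∷ q) [] m
moves (up x (l ∷ q) (p ∷ ps) m)     = (x , low (l ∷ q) (p ∷ ps) m) ∷ []

Accepts : State → List ℕ → Set
Accepts st = Completes (queue st) (pending st) (floor st)

Moves : ℕ → State → State → Set
Moves y st st′ = Step y (queue st) (pending st) (floor st) (queue st′) (pending st′) (floor st′)

-- A nonempty queue of lower labels ends in m itself. The inequalities at the earlier labels are
-- those of `pop-greater`: when such a label leaves, nothing larger may remain.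
data Lows (ps : List ℕ) (m : ℕ) : List ℕ → Set where
  []   : Lows ps m []
  last : Lows ps m (m ∷ [])
  _∷_  : ∀ {l l′ q} → m < l × All (_< l) (l′ ∷ q) × All (_< l) ps → Lows ps m (l′ ∷ q) → Lows ps m (l ∷ l′ ∷ q)

record Pending (ps : List ℕ) (m : ℕ) : Set where
  constructor pendingOk
  field
    decreasing : AllPairs _>_ ps
    above      : All (m <_) ps

record Upper (x : ℕ) (q ps : List ℕ) (m : ℕ) : Set where
  constructor upper
  field
    m<x  : m < x
    q<x  : All (_< x) q
    ps<x : All (_< x) ps

WF : State → Set
WF (low q ps m)  = Lows ps m q × Pending ps m
WF (wait x ps m) = Upper x [] ps m × Pending ps m
WF (up x q ps m) = Upper x q ps m × Lows ps m q × Pending ps m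

-- The condition under which any label below the frontier k may come next.
record Front (q ps : List ℕ) (k : ℕ) : Set where
  constructor front
  field
    ps-decreasing : AllPairs _>_ ps
    k≤ps          : All (k ≤_) ps
    q-decreasing  : AllPairs _>_ q
    k≤q           : All (k ≤_) q
    ps<q          : All (λ l → All (_< l) ps) q

front-suc : ∀ {q ps y} → Front q ps (suc y) → Front q (ps ++ y ∷ []) y
front-suc (front ps↓ y<ps q↓ y<q ps<q) = front
  (AllPairs.++⁺ ps↓ ([] ∷ []) (All.map (λ y<p → y<p ∷ []) y<ps))
  (All.++⁺ (All.map ℕ.<⇒≤ y<ps) (ℕ.≤-refl ∷ []))
  q↓
  (All.map ℕ.<⇒≤ y<q)
  (All.zipWith (λ (y<l , ps<l) → All.++⁺ ps<l (y<l ∷ [])) (y<q , ps<q))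

front-lows : ∀ {q ps y} → Front q ps (suc y) → Lows ps y (q ++ y ∷ [])
front-lows {[]}         _ = last
front-lows {l ∷ []}     (front _ _ _ (y<l ∷ _) (ps<l ∷ _)) = (y<l , y<l ∷ [] , ps<l) ∷ last
front-lows {l ∷ l′ ∷ q} (front ps↓ y<ps (l>q ∷ q↓) (y<l ∷ y<q) (ps<l ∷ ps<q)) =
  (y<l , All.++⁺ l>q (y<l ∷ []) , ps<l) ∷ front-lows (front ps↓ y<ps q↓ y<q ps<q)

record Lowered (f : List ℕ → List ℕ → ℕ → State) (q ps : List ℕ) (k y : ℕ) (st : State) : Set where
  constructor lowered
  field
    {ps′}   : List ℕ
    result  : st ≡ f (q ++ y ∷ []) ps′ y
    y<k     : y < k
    counts  : ∀ a → occ a ps + below a k ≡ occ a ps′ + (δ a y + below a y)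
    front′  : Front q ps′ (suc y)
    bounds  : ∀ {x} → k ≤ x → All (_< x) ps → All (_< x) ps′

lowers-sound : ∀ {f q ps k y st} → Front q ps k → (y , st) ∈ lowers f q ps k → Lowered f q ps k y st
lowers-sound {k = suc y} fr (here refl) = lowered refl (ℕ.n<1+n y) (λ a → refl) fr (λ _ ps<x → ps<x)
lowers-sound {f} {q} {ps} {suc k} fr (there ∈lowers) with lowers-sound {f} {q} {ps ++ k ∷ []} {k} (front-suc fr) ∈lowers
... | lowered refl y<k counts fr′ bounds = lowered refl (ℕ.m<n⇒m<1+n y<k)
  (λ a → trans (shift a) (counts a)) fr′
  (λ k<x ps<x → bounds (ℕ.<⇒≤ k<x) (All.++⁺ ps<x (k<x ∷ [])))
  where
  rearrange : ∀ p d b → p + (d + b) ≡ p + (d + 0) + b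
  rearrange = ℕ-Solver.solve-∀
  shift : ∀ a → occ a ps + (δ a k + below a k) ≡ occ a (ps ++ k ∷ []) + below a k
  shift a = trans (rearrange (occ a ps) (δ a k) (below a k)) (cong (λ i → i + below a k) (sym (occ-++ a ps (k ∷ []))))

lowers-complete : ∀ f q ps {k y} → y < k → ∃ λ st → (y , st) ∈ lowers f q ps k
lowers-complete f q ps {suc k} {y} (s≤s y≤k) with y ℕ.≟ k
... | yes refl = _ , here refl
... | no y≢k with lowers-complete f q (ps ++ k ∷ []) (ℕ.≤∧≢⇒< y≤k y≢k)
...   | st , ∈lowers = st , there ∈lowers

lowers-below : ∀ f q ps k → All (λ (y , _) → y < k) (lowers f q ps k)
lowers-below f q ps zero    = []
lowers-below f q ps (suc k) = ℕ.n<1+n k ∷ All.map ℕ.m<n⇒m<1+n (lowers-below f q (ps ++ k ∷ []) k)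

Distinct : List (ℕ × State) → Set
Distinct = AllPairs (λ (y , _) (y′ , _) → y ≢ y′)

lowers-distinct : ∀ f q ps k → Distinct (lowers f q ps k)
lowers-distinct f q ps zero    = []
lowers-distinct f q ps (suc k) =
  All.map (λ y<k k≡y → ℕ.<⇒≢ y<k (sym k≡y)) (lowers-below f q (ps ++ k ∷ []) k) ∷ lowers-distinct f q (ps ++ k ∷ []) k

lows≥m : ∀ {ps m q} → Lows ps m q → All (m ≤_) q
lows≥m []                      = []
lows≥m last                    = ℕ.≤-refl ∷ []
lows≥m ((m<l , _) ∷ lows)      = ℕ.<⇒≤ m<l ∷ lows≥m lows

lows-decreasing : ∀ {ps m q} → Lows ps m q → AllPairs _>_ q
lows-decreasing []                        = []
lows-decreasing last                      = [] ∷ []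
lows-decreasing ((_ , q<l , _) ∷ lows)    = q<l ∷ lows-decreasing lows

lows-last : ∀ {ps m l q} → Lows ps m (l ∷ q) → m ∈ʷ l ∷ q
lows-last last                  = ∈ʷ-head
lows-last (_∷_ {l = l} _ lows)  = l ∷ʳ lows-last lows

initial-front : ∀ {ps m q} → q ≡ [] ⊎ ps ≡ [] → Lows ps m q → Pending ps m → Front q ps m
initial-front q≡[]⊎ps≡[] lows (pendingOk ps↓ m<ps) = front ps↓ (All.map ℕ.<⇒≤ m<ps) (lows-decreasing lows) (lows≥m lows) (ps<q q≡[]⊎ps≡[])
  where
  ps<q : ∀ {q ps} → q ≡ [] ⊎ ps ≡ [] → All (λ l → All (_< l) ps) q
  ps<q (inj₁ refl) = []
  ps<q (inj₂ refl) = All.universal (λ _ → []) _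

Sound : State → Set
Sound st = ∀ {y st′} → (y , st′) ∈ moves st → Moves y st st′ × WF st′

low-lowers : ∀ {q ps m y st′} → q ≡ [] ⊎ ps ≡ [] → WF (low q ps m) → (y , st′) ∈ lowers low q ps m →
  Moves y (low q ps m) st′ × WF st′
low-lowers q⊎ps (lows , pend) ∈lowers with lowers-sound (initial-front q⊎ps lows pend) ∈lowers
... | lowered refl y<m counts fr@(front ps↓ y<ps q↓ y<q ps<q) _ =
  push-low y<m (λ y∈q → ℕ.<-irrefl refl (All-∈ʷ y<q y∈q)) counts , front-lows fr , pendingOk ps↓ y<ps

up-lowers : ∀ {x q ps m y st′} → q ≡ [] ⊎ ps ≡ [] → WF (up x q ps m) → (y , st′) ∈ lowers (up x) q ps m →
  Moves y (up x q ps m) st′ × WF st′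
up-lowers {x} {q} q⊎ps (upper m<x q<x ps<x , lows , pend) ∈lowers with lowers-sound (initial-front q⊎ps lows pend) ∈lowers
... | lowered refl y<m counts fr@(front ps↓ y<ps q↓ y<q ps<q) bounds =
  push-low y<m (λ y∈xq → ℕ.<-irrefl refl (All-∈ʷ (ℕ.<-trans y<m m<x ∷ y<q) y∈xq)) counts ,
  upper (ℕ.<-trans y<m m<x) (All.++⁺ q<x (ℕ.<-trans y<m m<x ∷ [])) (bounds (ℕ.<⇒≤ m<x) ps<x) ,
  front-lows fr , pendingOk ps↓ y<ps

<⇒≢-sym : ∀ {a b} → a < b → b ≢ a
<⇒≢-sym a<b b≡a = ℕ.<⇒≢ a<b (sym b≡a)

pop-last : ∀ {ps m} → Pending ps m → Moves m (low (m ∷ []) ps m) (low [] ps m)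
pop-last (pendingOk _ m<ps) = pop ℕ.≤-refl [] (All.map <⇒≢-sym m<ps) (λ m<m → ⊥-elim (ℕ.<-irrefl refl m<m))

pop-greater : ∀ {y q ps m} → m < y → All (_< y) q → All (_< y) ps → Step y (y ∷ q) ps m q ps m
pop-greater m<y q<y ps<y = pop (ℕ.<⇒≤ m<y) (All.map ℕ.<⇒≢ q<y) (All.map ℕ.<⇒≢ ps<y)
  (λ _ → All.map ℕ.<⇒≤ q<y , All.map ℕ.<⇒≤ ps<y)

pending-tail : ∀ {x ps m} → Pending (x ∷ ps) m → Upper x [] ps m × Pending ps m
pending-tail (pendingOk (x>ps ∷ ps↓) (m<x ∷ m<ps)) = upper m<x [] x>ps , pendingOk ps↓ m<ps

sound : ∀ st → WF st → Sound st
sound (low [] [] m)                 wf ∈moves = low-lowers (inj₁ refl) wf ∈moves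
sound (low [] (x ∷ ps) m)           wf (there ∈moves) = low-lowers (inj₁ refl) wf ∈moves
sound (low [] (x ∷ ps) m)           (_ , pend) (here refl) with pending-tail pend
... | u@(upper m<x _ ps<x) , pend′ = push-up m<x [] (All.map ℕ.<⇒≤ ps<x) , u , [] , pend′
sound (low (l ∷ []) [] m)           (last , pend) (here refl) = pop-last pend , [] , pend
sound (low (l ∷ []) [] m)           wf (there ∈moves) = low-lowers (inj₂ refl) wf ∈moves
sound (low (l ∷ []) (x ∷ ps) m)     (last , pend) (here refl) = pop-last pend , [] , pend
sound (low (l ∷ []) (x ∷ ps) m)     (last , pend) (there (here refl)) with pending-tail pend
... | u@(upper m<x _ ps<x) , pend′ = push-up m<x (m<x ∷ []) (All.map ℕ.<⇒≤ ps<x) , u , pend′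
sound (low (l ∷ l′ ∷ q) [] m)       ((m<l , q<l , ps<l) ∷ lows , pend) (here refl) = pop-greater m<l q<l ps<l , lows , pend
sound (low (l ∷ l′ ∷ q) [] m)       wf (there ∈moves) = low-lowers (inj₂ refl) wf ∈moves
sound (low (l ∷ l′ ∷ q) (x ∷ ps) m) ((m<l , q<l , ps<l) ∷ lows , pend) (here refl) = pop-greater m<l q<l ps<l , lows , pend
sound (wait x ps m)                 (upper m<x _ ps<x , pend@(pendingOk _ m<ps)) (here refl) =
  pop ℕ.≤-refl (<⇒≢-sym m<x ∷ []) (All.map <⇒≢-sym m<ps) (λ m<m → ⊥-elim (ℕ.<-irrefl refl m<m)) ,
  upper m<x [] ps<x , [] , pend
sound (up x [] ps m)                (upper m<x q<x ps<x , lows , pend) (here refl) = pop-greater m<x q<x ps<x , lows , pend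
sound (up x [] ps m)                wf (there ∈moves) = up-lowers (inj₁ refl) wf ∈moves
sound (up x (l ∷ q) [] m)           (upper m<x q<x ps<x , lows , pend) (here refl) = pop-greater m<x q<x ps<x , lows , pend
sound (up x (l ∷ q) [] m)           wf (there ∈moves) = up-lowers (inj₂ refl) wf ∈moves
sound (up x (l ∷ q) (p ∷ ps) m)     (upper m<x q<x ps<x , lows , pend) (here refl) = pop-greater m<x q<x ps<x , lows , pend

distinct : ∀ st → WF st → Distinct (moves st)
distinct (low [] [] m)                 wf = lowers-distinct low [] [] m
distinct (low [] (x ∷ ps) m)           (_ , pendingOk _ (m<x ∷ _)) =
  All.map (λ y<m → <⇒≢-sym (ℕ.<-trans y<m m<x)) (lowers-below low [] (x ∷ ps) m) ∷ lowers-distinct low [] (x ∷ ps) m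
distinct (low (l ∷ []) [] m)           (last , _) = All.map <⇒≢-sym (lowers-below low (l ∷ []) [] m) ∷ lowers-distinct low (l ∷ []) [] m
distinct (low (l ∷ []) (x ∷ ps) m)     (last , pendingOk _ (m<x ∷ _)) = (ℕ.<⇒≢ m<x ∷ []) ∷ [] ∷ []
distinct (low (l ∷ l′ ∷ q) [] m)       ((m<l , _) ∷ _ , _) =
  All.map (λ y<m → <⇒≢-sym (ℕ.<-trans y<m m<l)) (lowers-below low (l ∷ l′ ∷ q) [] m) ∷ lowers-distinct low (l ∷ l′ ∷ q) [] m
distinct (low (l ∷ l′ ∷ q) (x ∷ ps) m) wf = [] ∷ []
distinct (wait x ps m)                 wf = [] ∷ []
distinct (up x [] ps m)                (upper m<x _ _ , _) =
  All.map (λ y<m → <⇒≢-sym (ℕ.<-trans y<m m<x)) (lowers-below (up x) [] ps m) ∷ lowers-distinct (up x) [] ps m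
distinct (up x (l ∷ q) [] m)           (upper m<x _ _ , _) =
  All.map (λ y<m → <⇒≢-sym (ℕ.<-trans y<m m<x)) (lowers-below (up x) (l ∷ q) [] m) ∷ lowers-distinct (up x) (l ∷ q) [] m
distinct (up x (l ∷ q) (p ∷ ps) m)     wf = [] ∷ []

module _ {q ps v : List ℕ} {m y : ℕ} (C : Completes q ps m (y ∷ v)) where
  open Completes C

  occ-tail : ∀ {a} → a ≢ y → occ a v ≡ occ a q + (2 * occ a ps + 2 * below a m)
  occ-tail {a} a≢y = trans (cong (λ k → k + occ a v) (sym (δ-≢ a≢y))) (count a)

  queued-later : ∀ {a} → a ≢ y → a ∈ʷ q → a ∈ʷ v
  queued-later {a} a≢y a∈q = occ>0⇒∈ʷ a v (subst (0 <_) (sym (occ-tail a≢y)) (ℕ.m≤n⇒m≤n+o _ (∈ʷ⇒occ>0 a∈q)))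

  pending-twice : ∀ {a} → a ≢ y → a ∈ʷ ps → 2 ≤ occ a v
  pending-twice {a} a≢y a∈ps = subst (2 ≤_) (sym (occ-tail a≢y))
    (ℕ.m≤n⇒m≤o+n (occ a q) (ℕ.m≤n⇒m≤n+o (2 * below a m) (ℕ.*-monoʳ-≤ 2 (∈ʷ⇒occ>0 a∈ps))))

  pending-later : ∀ {a} → a ≢ y → a ∈ʷ ps → a ∈ʷ v
  pending-later {a} a≢y a∈ps = occ>0⇒∈ʷ a v (ℕ.≤-trans (s≤s z≤n) (pending-twice a≢y a∈ps))

  -- If y overtook h, an h would still have to follow, and the occurrences h y y h would nest.
  not-behind : ∀ {h} → y ≢ h → h ∷ y ∷ [] ⊆ q → ⊥
  not-behind {h} y≢h hy⊆q = no-ba h≢y hy⊆q (refl ∷ queued-later h≢y (⊆-trans (refl ∷ (y ∷ʳ [])) hy⊆q))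
    where h≢y = λ h≡y → y≢h (sym h≡y)

  -- A copy of t is still to come, so m, y, t would be a 123.
  nothing-above : ∀ {t} → m < y → y < t → t ∈ʷ q ⊎ t ∈ʷ ps → ⊥
  nothing-above m<y y<t (inj₁ t∈q)  = no-23 m<y y<t (refl ∷ queued-later (<⇒≢-sym y<t) t∈q)
  nothing-above m<y y<t (inj₂ t∈ps) = no-23 m<y y<t (refl ∷ pending-later (<⇒≢-sym y<t) t∈ps)

  -- The second m and both p are still to come. A p after that m completes the 123 y m p; otherwise
  -- p p m nests with the m already read.
  no-lower : ∀ {p} → y < m → m < p → m ∈ʷ q → p ∈ʷ ps → ⊥
  no-lower {p} y<m m<p m∈q p∈ps = no-123 y<m m<p (refl ∷ after-one-of-two (ℕ.<⇒≢ m<p)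
    (queued-later (<⇒≢-sym y<m) m∈q) (pending-twice (<⇒≢-sym (ℕ.<-trans y<m m<p)) p∈ps)
    (λ ppm → no-bba (ℕ.<⇒≢ m<p) m∈q (y ∷ʳ ppm)))

Possible : ℕ → State → Set
Possible y st = ∃ λ st′ → (y , st′) ∈ moves st

Complete : State → Set
Complete st = ∀ {y v} → Accepts st (y ∷ v) → Possible y st

later : ∀ {y st st′} {ms : List (ℕ × State)} → (∃ λ st″ → (y , st″) ∈ ms) → ∃ λ st″ → (y , st″) ∈ (st , st′) ∷ ms
later (st″ , ∈ms) = st″ , there ∈ms

complete : ∀ st → WF st → Complete st
complete (low [] [] m) wf C with remaining C ∈ʷ-head
... | inj₁ ()
... | inj₂ (inj₁ ())
... | inj₂ (inj₂ y<m) = lowers-complete low [] [] y<m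
complete (low [] (x ∷ ps) m) (_ , pendingOk (ps<x ∷ _) (m<x ∷ m<ps)) C with remaining C ∈ʷ-head
... | inj₁ ()
... | inj₂ (inj₁ (refl ∷ _))     = _ , here refl
... | inj₂ (inj₁ (.x ∷ʳ y∈ps))   = ⊥-elim (nothing-above C (All-∈ʷ m<ps y∈ps) (All-∈ʷ ps<x y∈ps) (inj₂ ∈ʷ-head))
... | inj₂ (inj₂ y<m)            = later (lowers-complete low [] (x ∷ ps) y<m)
complete (low (l ∷ []) [] m) (last , _) C with remaining C ∈ʷ-head
... | inj₁ (refl ∷ _)     = _ , here refl
... | inj₁ (_ ∷ʳ ())
... | inj₂ (inj₁ ())
... | inj₂ (inj₂ y<m)     = later (lowers-complete low (l ∷ []) [] y<m)
complete (low (l ∷ []) (x ∷ ps) m) (last , pendingOk (ps<x ∷ _) (m<x ∷ m<ps)) C with remaining C ∈ʷ-head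
... | inj₁ (refl ∷ _)          = _ , here refl
... | inj₁ (_ ∷ʳ ())
... | inj₂ (inj₁ (refl ∷ _))   = _ , there (here refl)
... | inj₂ (inj₁ (.x ∷ʳ y∈ps)) = ⊥-elim (nothing-above C (All-∈ʷ m<ps y∈ps) (All-∈ʷ ps<x y∈ps) (inj₂ ∈ʷ-head))
... | inj₂ (inj₂ y<m)          = ⊥-elim (no-lower C y<m m<x ∈ʷ-head ∈ʷ-head)
complete (low (l ∷ l′ ∷ q) [] m) ((_ , q<l , _) ∷ _ , _) C with remaining C ∈ʷ-head
... | inj₁ (refl ∷ _)     = _ , here refl
... | inj₁ (.l ∷ʳ y∈q)    = ⊥-elim (not-behind C (ℕ.<⇒≢ (All-∈ʷ q<l y∈q)) (refl ∷ y∈q))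
... | inj₂ (inj₁ ())
... | inj₂ (inj₂ y<m)     = later (lowers-complete low (l ∷ l′ ∷ q) [] y<m)
complete (low (l ∷ l′ ∷ q) (x ∷ ps) m) (lows@((_ , q<l , ps<l) ∷ _) , pendingOk _ m<ps) C with remaining C ∈ʷ-head
... | inj₁ (refl ∷ _)     = _ , here refl
... | inj₁ (.l ∷ʳ y∈q)    = ⊥-elim (not-behind C (ℕ.<⇒≢ (All-∈ʷ q<l y∈q)) (refl ∷ y∈q))
... | inj₂ (inj₁ y∈ps)    = ⊥-elim (nothing-above C (All-∈ʷ m<ps y∈ps) (All-∈ʷ ps<l y∈ps) (inj₁ ∈ʷ-head))
... | inj₂ (inj₂ y<m)     = ⊥-elim (no-lower C y<m (All-∈ʷ m<ps (∈ʷ-head {x})) (lows-last lows) ∈ʷ-head)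
complete (wait x ps m) (upper m<x _ ps<x , pendingOk _ m<ps) {y} {v} C with remaining C ∈ʷ-head
... | inj₁ (refl ∷ _)           = _ , here refl
... | inj₁ (.m ∷ʳ (refl ∷ _))   = ⊥-elim (not-behind C (<⇒≢-sym m<x) ⊆-refl)
... | inj₁ (.m ∷ʳ .x ∷ʳ ())
... | inj₂ (inj₁ y∈ps)          = ⊥-elim (nothing-above C (All-∈ʷ m<ps y∈ps) (All-∈ʷ ps<x y∈ps) (inj₁ (m ∷ʳ ∈ʷ-head)))
... | inj₂ (inj₂ y<m)           = ⊥-elim (order (either-order (ℕ.<⇒≢ m<x)
        (queued-later C (<⇒≢-sym y<m) ∈ʷ-head) (queued-later C (<⇒≢-sym (ℕ.<-trans y<m m<x)) (m ∷ʳ ∈ʷ-head))))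
  where
  -- Both orders of the remaining m and x fail: m x extends y to a 123, and x m nests with the m and
  -- x already read.
  order : m ∷ x ∷ [] ⊆ v ⊎ x ∷ m ∷ [] ⊆ v → ⊥
  order (inj₁ mx) = Completes.no-123 C y<m m<x (refl ∷ mx)
  order (inj₂ xm) = Completes.no-ba C (ℕ.<⇒≢ m<x) ⊆-refl (y ∷ʳ xm)
complete (up x [] ps m) (upper m<x _ ps<x , _ , pendingOk _ m<ps) C with remaining C ∈ʷ-head
... | inj₁ (refl ∷ _)     = _ , here refl
... | inj₁ (.x ∷ʳ ())
... | inj₂ (inj₁ y∈ps)    = ⊥-elim (nothing-above C (All-∈ʷ m<ps y∈ps) (All-∈ʷ ps<x y∈ps) (inj₁ ∈ʷ-head))
... | inj₂ (inj₂ y<m)     = later (lowers-complete (up x) [] ps y<m)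
complete (up x (l ∷ q) [] m) (upper m<x q<x _ , _ , _) C with remaining C ∈ʷ-head
... | inj₁ (refl ∷ _)     = _ , here refl
... | inj₁ (.x ∷ʳ y∈q)    = ⊥-elim (not-behind C (ℕ.<⇒≢ (All-∈ʷ q<x y∈q)) (refl ∷ y∈q))
... | inj₂ (inj₁ ())
... | inj₂ (inj₂ y<m)     = later (lowers-complete (up x) (l ∷ q) [] y<m)
complete (up x (l ∷ q) (p ∷ ps) m) (upper m<x q<x ps<x , lows , pendingOk _ m<ps) C with remaining C ∈ʷ-head
... | inj₁ (refl ∷ _)     = _ , here refl
... | inj₁ (.x ∷ʳ y∈q)    = ⊥-elim (not-behind C (ℕ.<⇒≢ (All-∈ʷ q<x y∈q)) (refl ∷ y∈q))
... | inj₂ (inj₁ y∈ps)    = ⊥-elim (nothing-above C (All-∈ʷ m<ps y∈ps) (All-∈ʷ ps<x y∈ps) (inj₁ ∈ʷ-head))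
... | inj₂ (inj₂ y<m)     = ⊥-elim (no-lower C y<m (All-∈ʷ m<ps (∈ʷ-head {p})) (x ∷ʳ lows-last lows) ∈ʷ-head)

-- Enumeration of the completions of a state

completions : ℕ → State → List (List ℕ)
branches : ℕ → List (ℕ × State) → List (List ℕ)
completions zero    (low [] [] zero) = [] ∷ []
completions zero    _                = []
completions (suc k) st               = branches k (moves st)
branches k []              = []
branches k ((y , st) ∷ ms) = map (y ∷_) (completions k st) ++ branches k ms

branches⁻ : ∀ {k v} ms → v ∈ branches k ms → ∃₂ λ y w → ∃ λ st → v ≡ y ∷ w × (y , st) ∈ ms × w ∈ completions k st
branches⁻ {k} ((y , st) ∷ ms) v∈ with ∈.∈-++⁻ (map (y ∷_) (completions k st)) v∈
... | inj₁ v∈map with ∈.∈-map⁻ (y ∷_) v∈map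
...   | w , w∈ , refl = y , w , st , refl , here refl , w∈
branches⁻ {k} ((y , st) ∷ ms) v∈ | inj₂ v∈branches with branches⁻ ms v∈branches
...   | y′ , w , st′ , refl , ∈ms , w∈ = y′ , w , st′ , refl , there ∈ms , w∈

branches⁺ : ∀ {k y w st ms} → (y , st) ∈ ms → w ∈ completions k st → y ∷ w ∈ branches k ms
branches⁺ (here refl)   w∈ = ∈.∈-++⁺ˡ (∈.∈-map⁺ _ w∈)
branches⁺ {k} {ms = (y , st) ∷ ms} (there ∈ms) w∈ = ∈.∈-++⁺ʳ (map (y ∷_) (completions k st)) (branches⁺ ∈ms w∈)

empty-completes : Completes [] [] 0 []
empty-completes = record
  { count   = λ _ → refl
  ; no-abba = λ _ ()
  ; no-bba  = λ _ ()
  ; no-ba   = λ _ ()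
  ; no-123  = λ _ _ ()
  ; no-23   = λ _ _ ()
  }

completions-sound : ∀ k st → WF st → ∀ {v} → v ∈ completions k st → length v ≡ k × Accepts st v
completions-sound zero    (low [] [] zero) wf (here refl) = refl , empty-completes
completions-sound (suc k) st wf v∈ with branches⁻ (moves st) v∈
... | y , w , st′ , refl , ∈moves , w∈ with sound st wf ∈moves
...   | step , wf′ with completions-sound k st′ wf′ w∈
...     | length≡ , accepts = cong suc length≡ , step-sound step accepts

accepts-[] : ∀ st → Accepts st [] → st ≡ low [] [] 0
accepts-[] (low [] [] zero)    C = refl
accepts-[] (low [] [] (suc m)) C with count₀ ← Completes.count C m rewrite δ-refl m with () ← count₀
accepts-[] (low [] (x ∷ ps) m) C with count₀ ← Completes.count C x rewrite δ-refl x with () ← count₀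
accepts-[] (low (l ∷ q) ps m)  C with count₀ ← Completes.count C l rewrite δ-refl l with () ← count₀
accepts-[] (wait x ps m)       C with count₀ ← Completes.count C m rewrite δ-refl m with () ← count₀
accepts-[] (up x q ps m)       C with count₀ ← Completes.count C x rewrite δ-refl x with () ← count₀

completions-complete : ∀ k st → WF st → ∀ {v} → length v ≡ k → Accepts st v → v ∈ completions k st
completions-complete zero    st wf {[]}    refl C with accepts-[] st C
... | refl = here refl
completions-complete (suc k) st wf {y ∷ v} length≡ C with complete st wf C
... | st′ , ∈moves with sound st wf ∈moves
...   | step , wf′ = branches⁺ ∈moves (completions-complete k st′ wf′ (ℕ.suc-injective length≡) (step-complete step C))

branches-unique : ∀ {k} ms → Distinct ms → (∀ {y st} → (y , st) ∈ ms → Unique (completions k st)) → Unique (branches k ms)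
branches-unique []              _              _      = []
branches-unique {k} ((y , st) ∷ ms) (y≢ ∷ distinct) unique = Unique.++⁺
  (Unique.map⁺ (λ { refl → refl }) (unique (here refl))) (branches-unique ms distinct (λ ∈ms → unique (there ∈ms))) disjoint
  where
  disjoint : Disjoint (map (y ∷_) (completions k st)) (branches k ms)
  disjoint (v∈map , v∈branches) with ∈.∈-map⁻ (y ∷_) v∈map | branches⁻ ms v∈branches
  ... | _ , _ , refl | _ , _ , _ , refl , ∈ms , _ = All.lookup y≢ ∈ms refl

completions-unique : ∀ k st → WF st → Unique (completions k st)
completions-unique zero    (low [] [] zero)    wf = [] ∷ []
completions-unique zero    (low [] [] (suc _)) wf = []
completions-unique zero    (low [] (_ ∷ _) _)  wf = []
completions-unique zero    (low (_ ∷ _) _ _)   wf = []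
completions-unique zero    (wait _ _ _)        wf = []
completions-unique zero    (up _ _ _ _)        wf = []
completions-unique (suc k) st                  wf = branches-unique (moves st) (distinct st wf)
  (λ ∈moves → completions-unique k _ (proj₂ (sound st wf ∈moves)))

-- Counting completions by coefficients of the series

-- The generating function, by the number of labels below the minimum, of the completions of a state.
series : State → PowerSeries
series (low [] [] _)            = G
series (low [] (_ ∷ ps) _)      = E⁺ (length ps)
series (low (_ ∷ q) [] _)       = Q (suc (length q))
series (low (_ ∷ _) (_ ∷ ps) _) = S⁺ (length ps)
series (wait _ ps _)            = X (length ps)
series (up _ [] ps _)           = X (length ps)
series (up _ (_ ∷ q) [] _)      = W (suc (length q))
series (up _ (_ ∷ _) (_ ∷ ps) _) = S⁺ (length ps)

-- The length of every completion: a queued label comes once more, a pending or lower one twice.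
weight : State → ℕ
weight st = length (queue st) + 2 * (length (pending st) + floor st)

number : {A : Set} → List A → ℚ
number xs = ι (+ length xs)

number-branches : ∀ k y st ms → number (branches k ((y , st) ∷ ms)) ≡ number (completions k st) ℚ.+ number (branches k ms)
number-branches k y st ms = trans
  (cong (λ n → ι (+ n)) (trans (List.length-++ (map (y ∷_) (completions k st)))
    (cong (λ i → i + length (branches k ms)) (List.length-map (y ∷_) (completions k st)))))
  (ι-+ (+ length (completions k st)) (+ length (branches k ms)))

length-∷ʳ : ∀ {A : Set} (xs : List A) y → length (xs ++ y ∷ []) ≡ suc (length xs)
length-∷ʳ xs y = trans (List.length-++ xs) (ℕ.+-comm (length xs) 1)

-- `N` is the number of pending labels plus m. It stays constant as labels are passed over, since
-- these move from below m to the pending list, and so the number `k` of letters left after the push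
-- is the same for all branches. `T` belongs to the branch with nothing pending.
module Lowers (f : List ℕ → List ℕ → ℕ → State) (q : List ℕ) (T : PowerSeries) (k N : ℕ)
  (value₀ : ∀ y → suc y ≡ N → number (completions k (f (q ++ y ∷ []) [] y)) ≡ T y)
  (value⁺ : ∀ p ps y → suc (suc (length ps) + y) ≡ N → number (completions k (f (q ++ y ∷ []) (p ∷ ps) y)) ≡ S⁺ (length ps) y)
  where
  open ≡-Reasoning

  number-lowers⁺ : ∀ p ps m → suc (length ps) + m ≡ N → number (branches k (lowers f q (p ∷ ps) m)) ≡ Y⁺ (length ps) m
  number-lowers⁺ p ps zero    _  = sym (trans (coefficients≡ (Y⁺-equation (length ps)) 0) (z⊠-zero (S⁺ (length ps) ⊞ Y⁺ (suc (length ps)))))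
  number-lowers⁺ p ps (suc y) eq = begin
    number (branches k (lowers f q (p ∷ ps) (suc y)))
      ≡⟨ number-branches k y (f (q ++ y ∷ []) (p ∷ ps) y) (lowers f q (p ∷ ps ++ y ∷ []) y) ⟩
    number (completions k (f (q ++ y ∷ []) (p ∷ ps) y)) ℚ.+ number (branches k (lowers f q (p ∷ ps ++ y ∷ []) y))
      ≡⟨ cong₂ ℚ._+_ (value⁺ p ps y (trans (sym (ℕ.+-suc (suc (length ps)) y)) eq))
           (number-lowers⁺ p (ps ++ y ∷ []) y (trans (cong (λ n → suc n + y) (length-∷ʳ ps y)) (trans (sym (ℕ.+-suc (suc (length ps)) y)) eq))) ⟩
    S⁺ (length ps) y ℚ.+ Y⁺ (length (ps ++ y ∷ [])) y
      ≡⟨ cong (λ n → S⁺ (length ps) y ℚ.+ Y⁺ n y) (length-∷ʳ ps y) ⟩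
    S⁺ (length ps) y ℚ.+ Y⁺ (suc (length ps)) y
      ≡⟨ ⊞-coefficient (S⁺ (length ps)) (Y⁺ (suc (length ps))) y ⟨
    (S⁺ (length ps) ⊞ Y⁺ (suc (length ps))) y
      ≡⟨ z⊠-suc (S⁺ (length ps) ⊞ Y⁺ (suc (length ps))) y ⟨
    (z ⊠ (S⁺ (length ps) ⊞ Y⁺ (suc (length ps)))) (suc y)
      ≡⟨ coefficients≡ (Y⁺-equation (length ps)) (suc y) ⟨
    Y⁺ (length ps) (suc y) ∎

  number-lowers₀ : ∀ m → m ≡ N → number (branches k (lowers f q [] m)) ≡ (z ⊠ (T ⊞ Y⁺ 0)) m
  number-lowers₀ zero    _  = sym (z⊠-zero (T ⊞ Y⁺ 0))
  number-lowers₀ (suc y) eq = begin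
    number (branches k (lowers f q [] (suc y)))
      ≡⟨ number-branches k y (f (q ++ y ∷ []) [] y) (lowers f q (y ∷ []) y) ⟩
    number (completions k (f (q ++ y ∷ []) [] y)) ℚ.+ number (branches k (lowers f q (y ∷ []) y))
      ≡⟨ cong₂ ℚ._+_ (value₀ y eq) (number-lowers⁺ y [] y eq) ⟩
    T y ℚ.+ Y⁺ 0 y
      ≡⟨ ⊞-coefficient T (Y⁺ 0) y ⟨
    (T ⊞ Y⁺ 0) y
      ≡⟨ z⊠-suc (T ⊞ Y⁺ 0) y ⟨
    (z ⊠ (T ⊞ Y⁺ 0)) (suc y) ∎

-- Moves may lengthen the queue or the pending list, but each uses up a letter, so the induction is
-- on the number of letters left. Each move then matches a summand of the recurrence for its state.
number-completions : ∀ k st → weight st ≡ k → number (completions k st) ≡ series st (floor st)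
number-completions zero (low [] [] zero) _ = sym (begin
  G 0                                   ≡⟨ coefficients≡ G-equation 0 ⟩
  (𝟙 ⊞ z ⊠ (Q 1 ⊞ Y⁺ 0)) 0              ≡⟨ ⊞-coefficient 𝟙 (z ⊠ (Q 1 ⊞ Y⁺ 0)) 0 ⟩
  𝟙 0 ℚ.+ (z ⊠ (Q 1 ⊞ Y⁺ 0)) 0          ≡⟨ cong₂ ℚ._+_ 𝟙-zero (z⊠-zero (Q 1 ⊞ Y⁺ 0)) ⟩
  1ℚ ℚ.+ 0ℚ                             ≡⟨ ℚ.+-identityʳ 1ℚ ⟩
  1ℚ                                    ∎)
  where open ≡-Reasoning
number-completions zero (low [] [] (suc m)) ()
number-completions (suc k) st eq = step st eq
  where
  open ≡-Reasoning
  IH : ∀ st → weight st ≡ k → number (completions k st) ≡ series st (floor st)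
  IH = number-completions k

  single : ∀ y st → weight st ≡ k → number (branches k ((y , st) ∷ [])) ≡ series st (floor st)
  single y st eq = trans (number-branches k y st []) (trans (ℚ.+-identityʳ (number (completions k st))) (IH st eq))

  first : ∀ y st ms {f g} → weight st ≡ k → series st (floor st) ≡ f →
    number (branches k ms) ≡ g → number (branches k ((y , st) ∷ ms)) ≡ f ℚ.+ g
  first y st ms eq f≡ g≡ = trans (number-branches k y st ms) (cong₂ ℚ._+_ (trans (IH st eq) f≡) g≡)

  low-weight : ∀ q ps y {N} → suc (length ps + y) ≡ N → suc k ≡ length q + 2 * N → weight (low (q ++ y ∷ []) ps y) ≡ k
  low-weight q ps y refl eq = ℕ.suc-injective (trans (trans (cong (λ n → suc (n + 2 * (length ps + y))) (length-∷ʳ q y))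
    (rearrange (length q) (length ps + y))) (sym eq))
    where
    rearrange : ∀ q n → suc (suc q + 2 * n) ≡ q + 2 * suc n
    rearrange = ℕ-Solver.solve-∀

  up-weight : ∀ x q ps y {N} → suc (length ps + y) ≡ N → suc k ≡ suc (length q) + 2 * N → weight (up x (q ++ y ∷ []) ps y) ≡ k
  up-weight x q ps y refl eq = ℕ.suc-injective (trans (trans (cong (λ n → suc (suc n + 2 * (length ps + y))) (length-∷ʳ q y))
    (rearrange (length q) (length ps + y))) (sym eq))
    where
    rearrange : ∀ q n → suc (suc (suc q) + 2 * n) ≡ suc q + 2 * suc n
    rearrange = ℕ-Solver.solve-∀

  low-nonempty : ∀ q y → series (low (q ++ y ∷ []) [] y) ≡ Q (suc (length q))
  low-nonempty []      y = refl
  low-nonempty (l ∷ q) y = cong (λ n → Q (suc n)) (length-∷ʳ q y)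

  low-nonempty⁺ : ∀ q p ps y → series (low (q ++ y ∷ []) (p ∷ ps) y) ≡ S⁺ (length ps)
  low-nonempty⁺ []      p ps y = refl
  low-nonempty⁺ (_ ∷ _) p ps y = refl

  up-nonempty : ∀ x q y → series (up x (q ++ y ∷ []) [] y) ≡ W (suc (length q))
  up-nonempty x []      y = refl
  up-nonempty x (l ∷ q) y = cong (λ n → W (suc n)) (length-∷ʳ q y)

  up-nonempty⁺ : ∀ x q p ps y → series (up x (q ++ y ∷ []) (p ∷ ps) y) ≡ S⁺ (length ps)
  up-nonempty⁺ x []      p ps y = refl
  up-nonempty⁺ x (_ ∷ _) p ps y = refl

  module Low (q : List ℕ) (N : ℕ) (eq : suc k ≡ length q + 2 * N) = Lowers low q (Q (suc (length q))) k N
    (λ y y≡ → trans (IH (low (q ++ y ∷ []) [] y) (low-weight q [] y y≡ eq)) (cong (λ f → f y) (low-nonempty q y)))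
    (λ p ps y y≡ → trans (IH (low (q ++ y ∷ []) (p ∷ ps) y) (low-weight q (p ∷ ps) y y≡ eq)) (cong (λ f → f y) (low-nonempty⁺ q p ps y)))

  module Up (x : ℕ) (q : List ℕ) (N : ℕ) (eq : suc k ≡ suc (length q) + 2 * N) = Lowers (up x) q (W (suc (length q))) k N
    (λ y y≡ → trans (IH (up x (q ++ y ∷ []) [] y) (up-weight x q [] y y≡ eq)) (cong (λ f → f y) (up-nonempty x q y)))
    (λ p ps y y≡ → trans (IH (up x (q ++ y ∷ []) (p ∷ ps) y) (up-weight x q (p ∷ ps) y y≡ eq)) (cong (λ f → f y) (up-nonempty⁺ x q p ps y)))

  ⊞-at : ∀ {f g h} m → f ≋ g ⊞ h → g m ℚ.+ h m ≡ f m
  ⊞-at {f} {g} {h} m f≋ = sym (trans (coefficients≡ f≋ m) (⊞-coefficient g h m))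

  raised : ∀ p m → 2 * (suc p + m) ≡ suc (suc (2 * (p + m)))
  raised = ℕ-Solver.solve-∀

  step : ∀ st → weight st ≡ suc k → number (branches k (moves st)) ≡ series st (floor st)
  step (low [] [] (suc m)) eq = begin
    number (branches k (lowers low [] [] (suc m)))       ≡⟨ Low.number-lowers₀ [] (suc m) (sym eq) (suc m) refl ⟩
    (z ⊠ (Q 1 ⊞ Y⁺ 0)) (suc m)                           ≡⟨ ℚ.+-identityˡ _ ⟨
    0ℚ ℚ.+ (z ⊠ (Q 1 ⊞ Y⁺ 0)) (suc m)                    ≡⟨ cong (ℚ._+ (z ⊠ (Q 1 ⊞ Y⁺ 0)) (suc m)) (𝟙-suc m) ⟨
    𝟙 (suc m) ℚ.+ (z ⊠ (Q 1 ⊞ Y⁺ 0)) (suc m)             ≡⟨ ⊞-at (suc m) G-equation ⟩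
    G (suc m)                                            ∎
  step (low [] (x ∷ ps) m) eq = trans
    (first x (up x [] ps m) (lowers low [] (x ∷ ps) m) (ℕ.suc-injective (trans (sym (raised (length ps) m)) eq)) refl
      (Low.number-lowers⁺ [] _ (sym eq) x ps m refl))
    (⊞-at m (E⁺-equation (length ps)))
  step (low (l ∷ []) [] m) eq = trans
    (first l (low [] [] m) (lowers low (l ∷ []) [] m) (ℕ.suc-injective eq) (sym (coefficients≡ Q-zero m))
      (Low.number-lowers₀ (l ∷ []) m (sym eq) m refl))
    (⊞-at m (Q-suc 0))
  step (low (l ∷ []) (x ∷ ps) m) eq = trans
    (first l (low [] (x ∷ ps) m) ((x , wait x ps m) ∷ []) (ℕ.suc-injective eq) refl
      (single x (wait x ps m) (trans (sym (raised (length ps) m)) (ℕ.suc-injective eq))))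
    (⊞-at m (S⁺-equation (length ps)))
  step (low (l ∷ l′ ∷ q) [] m) eq = trans
    (first l (low (l′ ∷ q) [] m) (lowers low (l ∷ l′ ∷ q) [] m) (ℕ.suc-injective eq) refl
      (Low.number-lowers₀ (l ∷ l′ ∷ q) m (sym eq) m refl))
    (⊞-at m (Q-suc (suc (length q))))
  step (low (l ∷ l′ ∷ q) (x ∷ ps) m) eq = single l (low (l′ ∷ q) (x ∷ ps) m) (ℕ.suc-injective eq)
  step (wait x ps m) eq = single m (up x [] ps m) (ℕ.suc-injective eq)
  -- Here the two families meet: the moves give `W 0`, while the recurrence in the number of pending
  -- labels needs `X 0`. V was chosen to make them equal.
  step (up x [] [] m) eq = trans
    (first x (low [] [] m) (lowers (up x) [] [] m) (ℕ.suc-injective eq) (sym (coefficients≡ Q-zero m))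
      (Up.number-lowers₀ x [] m (sym eq) m refl))
    (trans (⊞-at m (W-suc 0)) (trans (coefficients≡ W-zero m) (sym (coefficients≡ (⊠-identityʳ V) m))))
  step (up x [] (p ∷ ps) m) eq = trans
    (first x (low [] (p ∷ ps) m) (lowers (up x) [] (p ∷ ps) m) (ℕ.suc-injective eq) refl
      (Up.number-lowers⁺ x [] _ (sym eq) p ps m refl))
    (⊞-at m (X⁺-equation (length ps)))
  step (up x (l ∷ q) [] m) eq = trans
    (first x (low (l ∷ q) [] m) (lowers (up x) (l ∷ q) [] m) (ℕ.suc-injective eq) refl
      (Up.number-lowers₀ x (l ∷ q) m (sym eq) m refl))
    (⊞-at m (W-suc (suc (length q))))
  step (up x (l ∷ q) (p ∷ ps) m) eq = single x (low (l ∷ q) (p ∷ ps) m) (ℕ.suc-injective eq)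

-- From words over Fin n to lists of natural numbers

letters : ∀ {n k} → Vec (Fin n) k → List ℕ
letters []      = []
letters (x ∷ w) = toℕ x ∷ letters w

length-letters : ∀ {n k} (w : Vec (Fin n) k) → length (letters w) ≡ k
length-letters []      = refl
length-letters (x ∷ w) = cong suc (length-letters w)

letters-injective : ∀ {n k} {w w′ : Vec (Fin n) k} → letters w ≡ letters w′ → w ≡ w′
letters-injective {w = []}    {[]}     eq = refl
letters-injective {w = x ∷ w} {x′ ∷ w′} eq =
  cong₂ _∷_ (Fin.toℕ-injective (List.∷-injectiveˡ eq)) (letters-injective (List.∷-injectiveʳ eq))

fromLetters : ∀ {n k} v → length v ≡ k → (∀ {a} → a ∈ʷ v → a < n) → ∃ λ (w : Vec (Fin n) k) → letters w ≡ v
fromLetters []      refl _   = [] , refl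
fromLetters (x ∷ v) refl v<n with fromLetters v refl (λ a∈v → v<n (x ∷ʳ a∈v))
... | w , eq = fromℕ< (v<n ∈ʷ-head) ∷ w , cong₂ _∷_ (Fin.toℕ-fromℕ< (v<n ∈ʷ-head)) eq

letters< : ∀ {n k a} (w : Vec (Fin n) k) → a ∈ʷ letters w → a < n
letters< (x ∷ w) (refl ∷ _)   = Fin.toℕ<n x
letters< (x ∷ w) (_ ∷ʳ a∈w)   = letters< w a∈w

occ-letters : ∀ {n k} (a : Fin n) (w : Vec (Fin n) k) → occ (toℕ a) (letters w) ≡ Vec.count (Fin._≟ a) w
occ-letters a []      = refl
occ-letters a (x ∷ w) with x Fin.≟ a
... | yes refl = cong₂ _+_ (δ-refl (toℕ x)) (occ-letters a w)
... | no x≢a   = cong₂ _+_ (δ-≢ (λ a≡x → x≢a (Fin.toℕ-injective (sym a≡x)))) (occ-letters a w)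

after : ∀ {n k} → Vec (Fin n) k → Fin k → List ℕ
after (x ∷ w) Fin.zero    = letters w
after (x ∷ w) (Fin.suc i) = after w i

from-lookup : ∀ {n k} (w : Vec (Fin n) k) i → toℕ (lookup w i) ∷ after w i ⊆ letters w
from-lookup (x ∷ w) Fin.zero    = ⊆-refl
from-lookup (x ∷ w) (Fin.suc i) = toℕ x ∷ʳ from-lookup w i

after-lookup : ∀ {n k} (w : Vec (Fin n) k) {i j} → i Fin.< j → toℕ (lookup w j) ∷ after w j ⊆ after w i
after-lookup (x ∷ w) {Fin.zero}  {Fin.suc j} _         = from-lookup w j
after-lookup (x ∷ w) {Fin.suc i} {Fin.suc j} (s≤s i<j) = after-lookup w i<j

to-lookup : ∀ {n k a v} (w : Vec (Fin n) k) → a ∷ v ⊆ letters w → ∃ λ i → toℕ (lookup w i) ≡ a × v ⊆ after w i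
to-lookup (x ∷ w) (refl ∷ v⊆)  = Fin.zero , refl , v⊆
to-lookup (x ∷ w) (_ ∷ʳ av⊆)   with to-lookup w av⊆
... | i , eq , v⊆ = Fin.suc i , eq , v⊆

to-after : ∀ {n k a v} (w : Vec (Fin n) k) i → a ∷ v ⊆ after w i → ∃ λ j → i Fin.< j × toℕ (lookup w j) ≡ a × v ⊆ after w j
to-after (x ∷ w) Fin.zero    av⊆ with to-lookup w av⊆
... | j , eq , v⊆ = Fin.suc j , s≤s z≤n , eq , v⊆
to-after (x ∷ w) (Fin.suc i) av⊆ with to-after w i av⊆
... | j , i<j , eq , v⊆ = Fin.suc j , s≤s i<j , eq , v⊆

Good : ∀ {n} → Word n → Set
Good w = IsNonnesting w × ¬ Contains123 w

good? : ∀ {n} (w : Word n) → Dec (Good w)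
good? w = isNonnesting? w ×-dec ¬? (contains123? w)

-- No label has occurred yet, so n, which exceeds them all, stands in for the minimum, and the first
-- letter lowers it.
start : ℕ → State
start n = low [] [] n

start-wf : ∀ n → WF (start n)
start-wf n = [] , pendingOk [] []

good⇒accepts : ∀ {n} (w : Word n) → Good w → Accepts (start n) (letters w)
good⇒accepts {n} w (nonnesting twice noNesting , no123) = record
  { count   = count
  ; no-abba = no-abba
  ; no-bba  = λ _ ()
  ; no-ba   = λ _ ()
  ; no-123  = no-123
  ; no-23   = λ n<b _ bc → ℕ.<-asym n<b (letters< w (⊆-trans (refl ∷ minimum _) bc))
  }
  where
  count : ∀ a → occ a (letters w) ≡ 2 * below a n
  count a with a ℕ.<? n
  ... | yes a<n rewrite <⇒below≡1 a<n = trans (cong (λ b → occ b (letters w)) (sym (Fin.toℕ-fromℕ< a<n)))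
          (trans (occ-letters (fromℕ< a<n) w) (twice (fromℕ< a<n)))
  ... | no a≮n rewrite ≥⇒below≡0 (ℕ.≮⇒≥ a≮n) = ∉ʷ⇒occ≡0 (λ a∈w → a≮n (letters< w a∈w))
  no-abba : ∀ {a b} → a ≢ b → ¬ a ∷ b ∷ b ∷ a ∷ [] ⊆ letters w
  no-abba a≢b abba with to-lookup w abba
  ... | i , wi≡a , bba with to-after w i bba
  ...   | j , i<j , wj≡b , ba with to-after w j ba
  ...     | k , j<k , wk≡b , a′ with to-after w k a′
  ...       | ℓ , k<ℓ , wℓ≡a , _ = noNesting (i , j , k , ℓ , i<j , j<k , k<ℓ , lookup w i , lookup w j ,
                (λ wi≡wj → a≢b (trans (sym wi≡a) (trans (cong toℕ wi≡wj) wj≡b))) ,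
                refl , Fin.toℕ-injective (trans wℓ≡a (sym wi≡a)) , refl , Fin.toℕ-injective (trans wk≡b (sym wj≡b)))
  no-123 : ∀ {a b c} → a < b → b < c → ¬ a ∷ b ∷ c ∷ [] ⊆ letters w
  no-123 a<b b<c abc with to-lookup w abc
  ... | i , refl , bc with to-after w i bc
  ...   | j , i<j , refl , c′ with to-after w j c′
  ...     | k , j<k , refl , _ = no123 (i , j , k , i<j , j<k , a<b , b<c)

accepts⇒good : ∀ {n} (w : Word n) → Accepts (start n) (letters w) → Good w
accepts⇒good {n} w C = nonnesting twice noNesting , no123
  where
  open Completes C
  twice : EachLabelTwice w
  twice a = trans (sym (occ-letters a w)) (trans (count (toℕ a)) (cong (2 *_) (<⇒below≡1 (Fin.toℕ<n a))))
  noNesting : ¬ HasNesting w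
  noNesting (i , j , k , ℓ , i<j , j<k , k<ℓ , a , b , a≢b , refl , wℓ≡a , refl , wk≡b) =
    no-abba (λ eq → a≢b (Fin.toℕ-injective eq)) (⊆-trans
      (refl ∷ ⊆-trans (refl ∷ ⊆-trans (cong toℕ (sym wk≡b) ∷ ⊆-trans (cong toℕ (sym wℓ≡a) ∷ minimum _)
        (after-lookup w k<ℓ)) (after-lookup w j<k)) (after-lookup w i<j)) (from-lookup w i))
  no123 : ¬ Contains123 w
  no123 (i , j , k , i<j , j<k , a<b , b<c) = no-123 a<b b<c
    (⊆-trans (refl ∷ ⊆-trans (refl ∷ ⊆-trans (refl ∷ minimum _) (after-lookup w j<k)) (after-lookup w i<j)) (from-lookup w i))

allVecs-unique : ∀ n k → Unique (allVecs n k)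
allVecs-unique n zero    = [] ∷ []
allVecs-unique n (suc k) = Unique.cartesianProductWith⁺ _∷_ (λ eq → Vec.∷-injectiveˡ eq , Vec.∷-injectiveʳ eq)
  (Unique.allFin⁺ n) (allVecs-unique n k)

∈-allVecs : ∀ {n k} (w : Vec (Fin n) k) → w ∈ allVecs n k
∈-allVecs []      = here refl
∈-allVecs (x ∷ w) = ∈.∈-cartesianProductWith⁺ _∷_ (∈.∈-allFin x) (∈-allVecs w)

-- Both lists are free of duplicates and have the same members, so one is a permutation of the
-- other.
c≡length-completions : ∀ n → c n ≡ length (completions (2 * n) (start n))
c≡length-completions n = trans (sym (List.length-map letters goods)) (↭-length (∼bag⇒↭ (unique∧set⇒bag
  (Unique.map⁺ letters-injective (Unique.filter⁺ good? (allVecs-unique n (2 * n))))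
  (completions-unique (2 * n) (start n) (start-wf n))
  (mk⇔ to from))))
  where
  goods = filter good? (allVecs n (2 * n))
  to : ∀ {v} → v ∈ map letters goods → v ∈ completions (2 * n) (start n)
  to v∈ with ∈.∈-map⁻ letters v∈
  ... | w , w∈ , refl = completions-complete (2 * n) (start n) (start-wf n) (length-letters w)
          (good⇒accepts w (proj₂ (∈.∈-filter⁻ good? {xs = allVecs n (2 * n)} w∈)))
  from : ∀ {v} → v ∈ completions (2 * n) (start n) → v ∈ map letters goods
  from {v} v∈ with completions-sound (2 * n) (start n) (start-wf n) v∈
  ... | length≡ , C with fromLetters v length≡ (λ a∈v → below-n (remaining C a∈v))
    where
    below-n : ∀ {a} → _ → a < n
    below-n (inj₂ (inj₂ a<n)) = a<n
  ...   | w , refl = ∈.∈-map⁺ letters (∈.∈-filter⁺ good? (∈-allVecs w) (accepts⇒good w C))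

C≋G : C ≋ G
C≋G = pointwise λ n → trans (cong (λ k → ι (+ k)) (c≡length-completions n)) (number-completions (2 * n) (start n) refl)

corollary1p2 : AlgebraicOfDegree C 4
    × (C 0 ≡ 1ℚ × C 1 ≡ 1ℚ × quartic C ≈ 0#)
    × (∀ (F : PowerSeries) → F 0 ≡ 1ℚ → F 1 ≡ 1ℚ → quartic F ≈ 0# → F ≈ C)
-- The values at 0 and 1 are computed from the definition of `c` by listing all words.
corollary1p2 = algebraicOfDegree-4 C≋G Quartic-C , (refl , refl , quartic-C) ,
  λ F F0 F1 qF → coefficients≡ (unique F0 F1 (quartic≈0⇒ F qF) refl refl Quartic-C)
  where
  Quartic-C : Quartic C ≋ 𝟘
  Quartic-C = ≋-trans (≋-sym (horner-Quartic C)) (≋-trans (horner-cong (Vec.map ⌜_⌝ quarticCoefficients) C≋G)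
    (≋-trans (horner-Quartic G) Quartic-G))
  quartic-C : quartic C ≈ 0#
  quartic-C n = trans (sym (Quartic≈quartic C n)) (trans (coefficients≡ Quartic-C n) (𝟘-coefficient n))
  quartic≈0⇒ : ∀ F → quartic F ≈ 0# → Quartic F ≋ 𝟘
  quartic≈0⇒ F qF = pointwise λ n → trans (Quartic≈quartic F n) (trans (qF n) (sym (𝟘-coefficient n)))
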